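{- Suppose that $s \ge 3$ and that a sequence of finite $s$-uniform hypergraphs $\mathcal{H} = \mathcal{H}_n$ with $v(\mathcal{H}) \to \infty$ satisfies $\Delta_2(\mathcal{H}) = O(1)$. There is a positive constant $c$ such that, for every sequence $p = p_n \in [0,1]$ with $p \le c \cdot v(\mathcal{H})^{ -1/(s-1)}$, letting $V = V(\mathcal{H})$, \[ \Pr\big(\mathcal{H}[V_p] \text{ is } 2\text{ -choosable}\big) \to 1 . \]
   Context: $v(\mathcal{H})$ is the number of vertices of $\mathcal{H}$. $\Delta_2(\mathcal{H})$ is the maximum, over all pairs of distinct vertices, of the number of edges of $\mathcal{H}$ containing both. $V_p$ is the random subset of $V$ obtained by retaining each element independently with probability $p$, and $\mathcal{H}[V_p]$ is the subhypergraph of $\mathcal{H}$ induced by $V_p$. A hypergraph $\mathcal{G}$ is $2$-choosable if, for every assignment of two-element lists of colours to its vertices, there is a colouring of the vertices, giving each vertex a colour from its list, in which no edge is monochromatic. -}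

module Defs where

open import Data.Bool.Base using (Bool; true; false; if_then_else_)
open import Data.Fin.Base using (Fin; zero; suc; toℕ; splitAt; _↑ˡ_; _↑ʳ_)
import Data.Fin.Properties as Fin
open import Data.Fin.Subset using (Subset; _∈_; _⊆_; ∣_∣; _∩_; _─_; inside; outside)
open import Data.Fin.Subset.Properties using (_∈?_; _⊆?_; anySubset?; x∈p∩q⁺)
open import Data.Integer.Base as ℤ using (+_; -[1+_]; +≤+; +<+)
import Data.Integer.Properties as ℤ
import Data.Integer.Solver as ℤ
open import Data.List.Base using (List; []; _∷_; _++_; length; map; filter; foldr; allFin; cartesianProduct)
open import Data.List.Extrema.Nat using (max)
import Data.List.Membership.Propositional as List
open import Data.List.Relation.Unary.All as All using (All; []; _∷_)
import Data.List.Relation.Unary.All.Properties as All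
open import Data.List.Relation.Unary.AllPairs using ([]; _∷_)
open import Data.List.Relation.Unary.Any using (here; there)
open import Data.List.Relation.Unary.Unique.Propositional using (Unique)
import Data.List.Relation.Unary.Unique.Propositional.Properties as Unique
open import Data.Nat.Base as ℕ using (ℕ; zero; suc; z≤n; s≤s)
import Data.Nat.Properties as ℕ
import Data.Nat.Solver as ℕ
open import Data.Product.Base using (Σ; ∃; ∃-syntax; _×_; _,_; proj₁; proj₂; uncurry)
open import Data.Rational.Base as ℚ using (ℚ; mkℚ; 0ℚ; 1ℚ; ½; *<*; fromℚᵘ; toℚᵘ)
import Data.Rational.Properties as ℚ
import Data.Rational.Solver as ℚ
open import Data.Rational.Unnormalised.Base as ℚᵘ using (ℚᵘ; mkℚᵘ; *≤*; *≡*)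
import Data.Rational.Unnormalised.Properties as ℚᵘ
open import Data.Sum.Base using (inj₁; inj₂; [_,_]′)
open import Data.Vec.Base as Vec using (Vec; []; _∷_)
import Data.Vec.Properties as Vec
open import Function.Base using (_∘_; id)
open import Level using (Level)
open import Relation.Binary.PropositionalEquality
open import Relation.Nullary using (¬_; Dec; yes; no; does; contradiction)
open import Relation.Nullary.Decidable using (map′; ¬?; _×-dec_; _→-dec_)
open import Relation.Unary using (Pred; Decidable)

private
  variable
    a ℓ : Level
    N : ℕ

-- Real numbers, as Cauchy sequences of rationals.  Arithmetic is
-- termwise; order and limits, not propositional equality, are the
-- meaningful relations on ℝ.

Cauchy : (ℕ → ℚ) → Set
Cauchy x = ∀ (ε : ℚ) → 0ℚ ℚ.< ε →
  ∃[ K ] ∀ m n → K ℕ.≤ m → K ℕ.≤ n → ℚ.∣ x m ℚ.- x n ∣ ℚ.< ε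

record ℝ : Set where
  constructor mkℝ
  field
    seq    : ℕ → ℚ
    cauchy : Cauchy seq

open ℝ public

private
  0<½ : 0ℚ ℚ.< ½
  0<½ = ℚ.positive⁻¹ ½

  0<* : ∀ {p q} → 0ℚ ℚ.< p → 0ℚ ℚ.< q → 0ℚ ℚ.< p ℚ.* q
  0<* {p} {q} 0<p 0<q = subst (ℚ._< p ℚ.* q) (ℚ.*-zeroʳ p)
    (ℚ.*-monoʳ-<-pos p {{ℚ.positive 0<p}} 0<q)

  halves : ∀ ε → ε ℚ.* ½ ℚ.+ ε ℚ.* ½ ≡ ε
  halves ε = trans (sym (ℚ.*-distribˡ-+ ε ½ ½)) (ℚ.*-identityʳ ε)

  const-cauchy : ∀ q → Cauchy (λ _ → q)
  const-cauchy q ε 0<ε = 0 , λ _ _ _ _ →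
    subst (ℚ._< ε) (sym (cong ℚ.∣_∣ (ℚ.+-inverseʳ q))) 0<ε

  +-cauchy : ∀ x y → Cauchy x → Cauchy y → Cauchy (λ n → x n ℚ.+ y n)
  +-cauchy x y cx cy ε 0<ε
    with cx (ε ℚ.* ½) (0<* 0<ε 0<½) | cy (ε ℚ.* ½) (0<* 0<ε 0<½)
  ... | K , hx | L , hy = K ℕ.⊔ L , λ m n m≥ n≥ → begin-strict
    ℚ.∣ (x m ℚ.+ y m) ℚ.- (x n ℚ.+ y n) ∣
      ≡⟨ cong ℚ.∣_∣ (regroup (x m) (y m) (x n) (y n)) ⟩
    ℚ.∣ (x m ℚ.- x n) ℚ.+ (y m ℚ.- y n) ∣
      ≤⟨ ℚ.∣p+q∣≤∣p∣+∣q∣ (x m ℚ.- x n) (y m ℚ.- y n) ⟩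
    ℚ.∣ x m ℚ.- x n ∣ ℚ.+ ℚ.∣ y m ℚ.- y n ∣
      <⟨ ℚ.+-mono-< (hx m n (ℕ.m⊔n≤o⇒m≤o K L m≥) (ℕ.m⊔n≤o⇒m≤o K L n≥))
                    (hy m n (ℕ.m⊔n≤o⇒n≤o K L m≥) (ℕ.m⊔n≤o⇒n≤o K L n≥)) ⟩
    ε ℚ.* ½ ℚ.+ ε ℚ.* ½
      ≡⟨ halves ε ⟩
    ε ∎
    where
    open ℚ.≤-Reasoning
    open ℚ.+-*-Solver
    regroup : ∀ a b c d → (a ℚ.+ b) ℚ.- (c ℚ.+ d) ≡ (a ℚ.- c) ℚ.+ (b ℚ.- d)
    regroup = solve 4 (λ a b c d → (a :+ b) :- (c :+ d) := (a :- c) :+ (b :- d)) refl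

  neg-cauchy : ∀ x → Cauchy x → Cauchy (λ n → ℚ.- x n)
  neg-cauchy x cx ε 0<ε with cx ε 0<ε
  ... | K , h = K , λ m n m≥ n≥ →
    subst (ℚ._< ε) (trans (sym (ℚ.∣-p∣≡∣p∣ (x m ℚ.- x n)))
                          (cong ℚ.∣_∣ (regroup (x m) (x n)))) (h m n m≥ n≥)
    where
    open ℚ.+-*-Solver
    regroup : ∀ a b → ℚ.- (a ℚ.- b) ≡ ℚ.- a ℚ.- ℚ.- b
    regroup = solve 2 (λ a b → :- (a :- b) := (:- a) :- (:- b)) refl

  bounded : ∀ x → Cauchy x →
    ∃[ B ] 0ℚ ℚ.< B × ∃[ K ] ∀ n → K ℕ.≤ n → ℚ.∣ x n ∣ ℚ.≤ B
  bounded x cx with cx 1ℚ (ℚ.positive⁻¹ 1ℚ)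
  ... | K , h = 1ℚ ℚ.+ ℚ.∣ x K ∣
              , ℚ.+-mono-<-≤ (ℚ.positive⁻¹ 1ℚ) (ℚ.0≤∣p∣ (x K))
              , K , λ n n≥ → begin
    ℚ.∣ x n ∣                        ≡⟨ cong ℚ.∣_∣ (regroup (x n) (x K)) ⟩
    ℚ.∣ (x n ℚ.- x K) ℚ.+ x K ∣      ≤⟨ ℚ.∣p+q∣≤∣p∣+∣q∣ (x n ℚ.- x K) (x K) ⟩
    ℚ.∣ x n ℚ.- x K ∣ ℚ.+ ℚ.∣ x K ∣  ≤⟨ ℚ.+-monoˡ-≤ ℚ.∣ x K ∣ (ℚ.<⇒≤ (h n K n≥ ℕ.≤-refl)) ⟩
    1ℚ ℚ.+ ℚ.∣ x K ∣                 ∎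
    where
    open ℚ.≤-Reasoning
    open ℚ.+-*-Solver
    regroup : ∀ a b → a ≡ (a ℚ.- b) ℚ.+ b
    regroup = solve 2 (λ a b → a := (a :- b) :+ b) refl

  shrink : ∀ ε D → 0ℚ ℚ.< ε → 0ℚ ℚ.< D → ∃[ δ ] 0ℚ ℚ.< δ × D ℚ.* δ ≡ ε
  shrink ε D 0<ε 0<D = ε ℚ.* 1/D , 0<* 0<ε 0<1/D , (begin
    D ℚ.* (ε ℚ.* 1/D)  ≡⟨ cong (D ℚ.*_) (ℚ.*-comm ε 1/D) ⟩
    D ℚ.* (1/D ℚ.* ε)  ≡⟨ ℚ.*-assoc D 1/D ε ⟨
    D ℚ.* 1/D ℚ.* ε    ≡⟨ cong (ℚ._* ε) (ℚ.*-inverseʳ D) ⟩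
    1ℚ ℚ.* ε           ≡⟨ ℚ.*-identityˡ ε ⟩
    ε                  ∎)
    where
    open ≡-Reasoning
    instance
      D-pos : ℚ.Positive D
      D-pos = ℚ.positive 0<D
      D-nonZero : ℚ.NonZero D
      D-nonZero = ℚ.pos⇒nonZero D
    1/D : ℚ
    1/D = ℚ.1/ D
    0<1/D : 0ℚ ℚ.< 1/D
    0<1/D = ℚ.positive⁻¹ 1/D {{ℚ.1/pos⇒pos D}}

  product-small : ∀ D δ {u w} → 0ℚ ℚ.< D → ℚ.∣ u ∣ ℚ.≤ D → ℚ.∣ w ∣ ℚ.< δ →
    ℚ.∣ u ℚ.* w ∣ ℚ.< D ℚ.* δ
  product-small D δ {u} {w} 0<D u≤D w<δ = begin-strict
    ℚ.∣ u ℚ.* w ∣        ≡⟨ ℚ.∣p*q∣≡∣p∣*∣q∣ u w ⟩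
    ℚ.∣ u ∣ ℚ.* ℚ.∣ w ∣  ≤⟨ ℚ.*-monoʳ-≤-nonNeg ℚ.∣ w ∣ {{ℚ.∣-∣-nonNeg w}} u≤D ⟩
    D ℚ.* ℚ.∣ w ∣        <⟨ ℚ.*-monoʳ-<-pos D {{ℚ.positive 0<D}} w<δ ⟩
    D ℚ.* δ              ∎
    where open ℚ.≤-Reasoning

  *-regroup : ∀ a b c d → a ℚ.* b ℚ.- c ℚ.* d ≡ a ℚ.* (b ℚ.- d) ℚ.+ d ℚ.* (a ℚ.- c)
  *-regroup = solve 4 (λ a b c d → a :* b :- c :* d := a :* (b :- d) :+ d :* (a :- c)) refl
    where open ℚ.+-*-Solver

  *-cauchy : ∀ x y → Cauchy x → Cauchy y → Cauchy (λ n → x n ℚ.* y n)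
  *-cauchy x y cx cy ε 0<ε =
    let B , 0<B , K₁ , bx = bounded x cx
        C , 0<C , K₂ , by = bounded y cy
        δ , 0<δ , Bδ≡     = shrink (ε ℚ.* ½) B (0<* 0<ε 0<½) 0<B
        η , 0<η , Cη≡     = shrink (ε ℚ.* ½) C (0<* 0<ε 0<½) 0<C
        K₃ , hy           = cy δ 0<δ
        K₄ , hx           = cx η 0<η
    in (K₁ ℕ.⊔ K₂) ℕ.⊔ (K₃ ℕ.⊔ K₄) , λ m n m≥ n≥ →
    let m₁₂ = ℕ.m⊔n≤o⇒m≤o (K₁ ℕ.⊔ K₂) (K₃ ℕ.⊔ K₄) m≥
        m₃₄ = ℕ.m⊔n≤o⇒n≤o (K₁ ℕ.⊔ K₂) (K₃ ℕ.⊔ K₄) m≥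
        n₁₂ = ℕ.m⊔n≤o⇒m≤o (K₁ ℕ.⊔ K₂) (K₃ ℕ.⊔ K₄) n≥
        n₃₄ = ℕ.m⊔n≤o⇒n≤o (K₁ ℕ.⊔ K₂) (K₃ ℕ.⊔ K₄) n≥
    in estimate m n B C δ η Bδ≡ Cη≡ 0<B 0<C
         (bx m (ℕ.m⊔n≤o⇒m≤o K₁ K₂ m₁₂)) (by n (ℕ.m⊔n≤o⇒n≤o K₁ K₂ n₁₂))
         (hy m n (ℕ.m⊔n≤o⇒m≤o K₃ K₄ m₃₄) (ℕ.m⊔n≤o⇒m≤o K₃ K₄ n₃₄))
         (hx m n (ℕ.m⊔n≤o⇒n≤o K₃ K₄ m₃₄) (ℕ.m⊔n≤o⇒n≤o K₃ K₄ n₃₄))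
    where
    estimate : ∀ m n B C δ η → B ℚ.* δ ≡ ε ℚ.* ½ → C ℚ.* η ≡ ε ℚ.* ½ →
      0ℚ ℚ.< B → 0ℚ ℚ.< C → ℚ.∣ x m ∣ ℚ.≤ B → ℚ.∣ y n ∣ ℚ.≤ C →
      ℚ.∣ y m ℚ.- y n ∣ ℚ.< δ → ℚ.∣ x m ℚ.- x n ∣ ℚ.< η →
      ℚ.∣ x m ℚ.* y m ℚ.- x n ℚ.* y n ∣ ℚ.< ε
    estimate m n B C δ η Bδ≡ Cη≡ 0<B 0<C xm≤ yn≤ dy< dx< = begin-strict
      ℚ.∣ x m ℚ.* y m ℚ.- x n ℚ.* y n ∣
        ≡⟨ cong ℚ.∣_∣ (*-regroup (x m) (y m) (x n) (y n)) ⟩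
      ℚ.∣ x m ℚ.* (y m ℚ.- y n) ℚ.+ y n ℚ.* (x m ℚ.- x n) ∣
        ≤⟨ ℚ.∣p+q∣≤∣p∣+∣q∣ (x m ℚ.* (y m ℚ.- y n)) (y n ℚ.* (x m ℚ.- x n)) ⟩
      ℚ.∣ x m ℚ.* (y m ℚ.- y n) ∣ ℚ.+ ℚ.∣ y n ℚ.* (x m ℚ.- x n) ∣
        <⟨ ℚ.+-mono-< (product-small B δ {x m} {y m ℚ.- y n} 0<B xm≤ dy<)
                      (product-small C η {y n} {x m ℚ.- x n} 0<C yn≤ dx<) ⟩
      B ℚ.* δ ℚ.+ C ℚ.* η
        ≡⟨ cong₂ ℚ._+_ Bδ≡ Cη≡ ⟩
      ε ℚ.* ½ ℚ.+ ε ℚ.* ½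
        ≡⟨ halves ε ⟩
      ε ∎
      where open ℚ.≤-Reasoning

infixl 6 _+ℝ_ _-ℝ_
infixl 7 _*ℝ_
infixr 8 _^ℝ_
infix  4 _≤ℝ_ _<ℝ_

fromℚ : ℚ → ℝ
fromℚ q = mkℝ (λ _ → q) (const-cauchy q)

0ℝ 1ℝ : ℝ
0ℝ = fromℚ 0ℚ
1ℝ = fromℚ 1ℚ

_+ℝ_ _-ℝ_ _*ℝ_ : ℝ → ℝ → ℝ
x +ℝ y = mkℝ (λ n → seq x n ℚ.+ seq y n) (+-cauchy (seq x) (seq y) (cauchy x) (cauchy y))
x -ℝ y = mkℝ (λ n → seq x n ℚ.- seq y n)
  (+-cauchy (seq x) (λ n → ℚ.- seq y n) (cauchy x) (neg-cauchy (seq y) (cauchy y)))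
x *ℝ y = mkℝ (λ n → seq x n ℚ.* seq y n) (*-cauchy (seq x) (seq y) (cauchy x) (cauchy y))

_^ℝ_ : ℝ → ℕ → ℝ
x ^ℝ zero  = 1ℝ
x ^ℝ suc n = x *ℝ x ^ℝ n

sumℝ : List ℝ → ℝ
sumℝ = foldr _+ℝ_ 0ℝ

_≤ℝ_ _<ℝ_ : ℝ → ℝ → Set
x ≤ℝ y = ∀ (ε : ℚ) → 0ℚ ℚ.< ε → ∃[ K ] ∀ n → K ℕ.≤ n → seq x n ℚ.≤ seq y n ℚ.+ ε
x <ℝ y = ∃[ ε ] 0ℚ ℚ.< ε × ∃[ K ] ∀ n → K ℕ.≤ n → seq x n ℚ.+ ε ℚ.≤ seq y n

infix 4 _⟶_ _⟶∞

_⟶_ : (ℕ → ℝ) → ℝ → Set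
u ⟶ l = ∀ (ε : ℝ) → 0ℝ <ℝ ε →
  ∃[ K ] ∀ n → K ℕ.≤ n → l -ℝ ε <ℝ u n × u n <ℝ l +ℝ ε

_⟶∞ : (ℕ → ℕ) → Set
u ⟶∞ = ∀ M → ∃[ K ] ∀ n → K ℕ.≤ n → M ℕ.≤ u n

-- The largest j ≤ b with jᵏ v ≤ mᵏ (for k ≥ 1).
floorSearch : (v k m b : ℕ) → ℕ
floorSearch v k m zero    = 0
floorSearch v k m (suc b) with suc b ℕ.^ k ℕ.* v ℕ.≤? m ℕ.^ k
... | yes _ = suc b
... | no  _ = floorSearch v k m b

-- For v, k ≥ 1 this is ⌊ m · v ^ (-1/k) ⌋, which is at most m.
floorRoot : (v k m : ℕ) → ℕ
floorRoot v k m = floorSearch v k m m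

private
  cross : ∀ a b m n → a ℕ.* suc n ℕ.≤ b ℕ.* suc m → mkℚᵘ (+ a) m ℚᵘ.≤ mkℚᵘ (+ b) n
  cross a b m n le = *≤* (subst₂ ℤ._≤_ (ℤ.pos-* a (suc n)) (ℤ.pos-* b (suc m)) (+≤+ le))

  split : ∀ a n → mkℚᵘ (+ suc a) n ℚᵘ.≃ mkℚᵘ (+ a) n ℚᵘ.+ mkℚᵘ (+ 1) n
  split a n = *≡* (trans (cong₂ ℤ._*_ (ℤ.pos-+ 1 a) (ℤ.pos-* (suc n) (suc n)))
                         (distribute (+ a) (+ suc n)))
    where
    open ℤ.+-*-Solver
    distribute : ∀ f d → (+ 1 ℤ.+ f) ℤ.* (d ℤ.* d) ≡ (f ℤ.* d ℤ.+ + 1 ℤ.* d) ℤ.* d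
    distribute = solve 2 (λ f d → (con (+ 1) :+ f) :* (d :* d)
                               := (f :* d :+ con (+ 1) :* d) :* d) refl

  fromℚᵘ-≤-+ : ∀ p q r → p ℚᵘ.≤ q ℚᵘ.+ r → fromℚᵘ p ℚ.≤ fromℚᵘ q ℚ.+ fromℚᵘ r
  fromℚᵘ-≤-+ p q r p≤q+r = ℚ.toℚᵘ-cancel-≤ (begin
    toℚᵘ (fromℚᵘ p)                       ≃⟨ ℚ.toℚᵘ-fromℚᵘ p ⟩
    p                                     ≤⟨ p≤q+r ⟩
    q ℚᵘ.+ r                              ≃⟨ ℚᵘ.+-cong (ℚ.toℚᵘ-fromℚᵘ q) (ℚ.toℚᵘ-fromℚᵘ r) ⟨
    toℚᵘ (fromℚᵘ q) ℚᵘ.+ toℚᵘ (fromℚᵘ r)  ≃⟨ ℚ.toℚᵘ-homo-+ (fromℚᵘ q) (fromℚᵘ r) ⟨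
    toℚᵘ (fromℚᵘ q ℚ.+ fromℚᵘ r)          ∎)
    where open ℚᵘ.≤-Reasoning

  fromℚᵘ-< : ∀ p q → p ℚᵘ.< toℚᵘ q → fromℚᵘ p ℚ.< q
  fromℚᵘ-< p q lt = ℚ.toℚᵘ-cancel-< (ℚᵘ.<-respˡ-≃ (ℚᵘ.≃-sym (ℚ.toℚᵘ-fromℚᵘ p)) lt)

  reciprocal-< : ∀ j d n → suc d ℕ.≤ n → mkℚᵘ (+ 1) n ℚᵘ.< mkℚᵘ (+ suc j) d
  reciprocal-< j d n d<n = ℚᵘ.*<* (subst₂ ℤ._<_ (ℤ.pos-* 1 (suc d)) (ℤ.pos-* (suc j) (suc n))
    (+<+ (ℕ.<-≤-trans (s≤s (subst (ℕ._≤ n) (sym (ℕ.+-identityʳ (suc d))) d<n))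
                      (ℕ.m≤m+n (suc n) (j ℕ.* suc n)))))

  reciprocal-small : ∀ ε → 0ℚ ℚ.< ε → ∃[ K ] ∀ n → K ℕ.≤ n → fromℚᵘ (mkℚᵘ (+ 1) n) ℚ.< ε
  reciprocal-small (mkℚ (+ zero) _ _) (*<* (+<+ ()))
  reciprocal-small (mkℚ -[1+ _ ] _ _) (*<* ())
  reciprocal-small ε@(mkℚ (+ suc j) d _) _ = suc d , λ n d<n →
    fromℚᵘ-< (mkℚᵘ (+ 1) n) ε (reciprocal-< j d n d<n)

  ∣-∣-< : ∀ a b {ε} → a ℚ.- b ℚ.< ε → b ℚ.- a ℚ.< ε → ℚ.∣ a ℚ.- b ∣ ℚ.< ε
  ∣-∣-< a b {ε} ab ba with ℚ.∣p∣≡p∨∣p∣≡-p (a ℚ.- b)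
  ... | inj₁ eq = subst (ℚ._< ε) (sym eq) ab
  ... | inj₂ eq = subst (ℚ._< ε) (sym (trans eq (flip-sub a b))) ba
    where
    open ℚ.+-*-Solver
    flip-sub : ∀ a b → ℚ.- (a ℚ.- b) ≡ b ℚ.- a
    flip-sub = solve 2 (λ a b → :- (a :- b) := b :- a) refl

  close⇒cauchy : ∀ (x r : ℕ → ℚ) → (∀ m n → x m ℚ.≤ x n ℚ.+ r n) →
    (∀ ε → 0ℚ ℚ.< ε → ∃[ K ] ∀ n → K ℕ.≤ n → r n ℚ.< ε) → Cauchy x
  close⇒cauchy x r close small ε 0<ε =
    let K , r< = small ε 0<ε
    in K , λ m n m≥ n≥ → ∣-∣-< (x m) (x n) (diff m n (r< n n≥)) (diff n m (r< m m≥))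
    where
    open ℚ.+-*-Solver
    cancel : ∀ a e → (a ℚ.+ e) ℚ.- a ≡ e
    cancel = solve 2 (λ a e → (a :+ e) :- a := e) refl
    diff : ∀ m n → r n ℚ.< ε → x m ℚ.- x n ℚ.< ε
    diff m n lt = subst (x m ℚ.- x n ℚ.<_) (cancel (x n) ε)
      (ℚ.+-monoˡ-< (ℚ.- x n) (ℚ.≤-<-trans (close m n) (ℚ.+-monoʳ-< (x n) lt)))

  ^-distribʳ-* : ∀ a b k → (a ℕ.* b) ℕ.^ k ≡ a ℕ.^ k ℕ.* b ℕ.^ k
  ^-distribʳ-* a b zero    = refl
  ^-distribʳ-* a b (suc k) = trans (cong (a ℕ.* b ℕ.*_) (^-distribʳ-* a b k))
    (solve 4 (λ a b c d → a :* b :* (c :* d) := a :* c :* (b :* d)) refl a b (a ℕ.^ k) (b ℕ.^ k))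
    where open ℕ.+-*-Solver

  ^-cancelʳ-< : ∀ {a b} k → a ℕ.^ k ℕ.< b ℕ.^ k → a ℕ.< b
  ^-cancelʳ-< k lt = ℕ.≰⇒> λ b≤a → ℕ.<⇒≱ lt (ℕ.^-monoˡ-≤ k b≤a)

module _ (v k : ℕ) .{{_ : ℕ.NonZero v}} .{{_ : ℕ.NonZero k}} where

  search-lower : ∀ m b → floorSearch v k m b ℕ.^ k ℕ.* v ℕ.≤ m ℕ.^ k
  search-lower m zero = subst (λ z → z ℕ.* v ℕ.≤ m ℕ.^ k) (sym (0^ k)) z≤n
    where
    0^ : ∀ k → .{{_ : ℕ.NonZero k}} → 0 ℕ.^ k ≡ 0
    0^ (suc _) = refl
  search-lower m (suc b) with suc b ℕ.^ k ℕ.* v ℕ.≤? m ℕ.^ k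
  ... | yes p = p
  ... | no  _ = search-lower m b

  search-upper : ∀ m b i → floorSearch v k m b ℕ.< i → i ℕ.≤ b → m ℕ.^ k ℕ.< i ℕ.^ k ℕ.* v
  search-upper m zero zero () _
  search-upper m (suc b) i lt i≤ with suc b ℕ.^ k ℕ.* v ℕ.≤? m ℕ.^ k
  ... | yes p = contradiction lt (ℕ.≤⇒≯ i≤)
  ... | no ¬p with ℕ.m≤n⇒m<n∨m≡n i≤
  ...   | inj₁ (s≤s i≤b) = search-upper m b i lt i≤b
  ...   | inj₂ refl      = ℕ.≰⇒> ¬p

  floorRoot-lower : ∀ m → floorRoot v k m ℕ.^ k ℕ.* v ℕ.≤ m ℕ.^ k
  floorRoot-lower m = search-lower m m

  floorRoot-upper : ∀ m → m ℕ.^ k ℕ.< suc (floorRoot v k m) ℕ.^ k ℕ.* v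
  floorRoot-upper m with suc (floorRoot v k m) ℕ.≤? m
  ... | yes p = search-upper m m _ ℕ.≤-refl p
  ... | no ¬p = ℕ.<-≤-trans (ℕ.^-monoˡ-< k (ℕ.≰⇒> ¬p)) (ℕ.m≤m*n _ v)

  floorRoot-cross : ∀ m n → .{{_ : ℕ.NonZero m}} →
    floorRoot v k m ℕ.* n ℕ.< suc (floorRoot v k n) ℕ.* m
  floorRoot-cross m n = ^-cancelʳ-< k (ℕ.*-cancelʳ-< v _ _ (begin-strict
    (fm ℕ.* n) ℕ.^ k ℕ.* v        ≡⟨ cong (ℕ._* v) (^-distribʳ-* fm n k) ⟩
    fm ℕ.^ k ℕ.* n ℕ.^ k ℕ.* v    ≡⟨ swap (fm ℕ.^ k) (n ℕ.^ k) v ⟩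
    fm ℕ.^ k ℕ.* v ℕ.* n ℕ.^ k    ≤⟨ ℕ.*-monoˡ-≤ (n ℕ.^ k) (floorRoot-lower m) ⟩
    m ℕ.^ k ℕ.* n ℕ.^ k           <⟨ ℕ.*-monoʳ-< (m ℕ.^ k) {{ℕ.m^n≢0 m k}} (floorRoot-upper n) ⟩
    m ℕ.^ k ℕ.* (sfn ℕ.^ k ℕ.* v) ≡⟨ swap′ (m ℕ.^ k) (sfn ℕ.^ k) v ⟩
    sfn ℕ.^ k ℕ.* m ℕ.^ k ℕ.* v   ≡⟨ cong (ℕ._* v) (^-distribʳ-* sfn m k) ⟨
    (sfn ℕ.* m) ℕ.^ k ℕ.* v       ∎))
    where
    open ℕ.≤-Reasoning
    open ℕ.+-*-Solver
    fm  = floorRoot v k m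
    sfn = suc (floorRoot v k n)
    swap : ∀ a b c → a ℕ.* b ℕ.* c ≡ a ℕ.* c ℕ.* b
    swap = solve 3 (λ a b c → a :* b :* c := a :* c :* b) refl
    swap′ : ∀ a b c → a ℕ.* (b ℕ.* c) ≡ b ℕ.* a ℕ.* c
    swap′ = solve 3 (λ a b c → a :* (b :* c) := b :* a :* c) refl

  approxᵘ : ℕ → ℚᵘ
  approxᵘ n = mkℚᵘ (+ floorRoot v k (suc n)) n

  approxᵘ-close : ∀ m n → approxᵘ m ℚᵘ.≤ approxᵘ n ℚᵘ.+ mkℚᵘ (+ 1) n
  approxᵘ-close m n = ℚᵘ.≤-respʳ-≃ (split (floorRoot v k (suc n)) n)
    (cross (floorRoot v k (suc m)) (suc (floorRoot v k (suc n))) m n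
      (ℕ.<⇒≤ (floorRoot-cross (suc m) (suc n))))

  approx-cauchy : Cauchy (λ n → fromℚᵘ (approxᵘ n))
  approx-cauchy = close⇒cauchy (λ n → fromℚᵘ (approxᵘ n)) (λ n → fromℚᵘ (mkℚᵘ (+ 1) n))
    (λ m n → fromℚᵘ-≤-+ (approxᵘ m) (approxᵘ n) (mkℚᵘ (+ 1) n) (approxᵘ-close m n))
    reciprocal-small

infixl 8 _^-1/_

-- The n-th approximant is v ^ (-1/k) rounded down to a multiple of
-- 1/(n+1).  The value is 0, by convention, when v = 0 or k = 0.
_^-1/_ : ℕ → ℕ → ℝ
zero    ^-1/ k     = 0ℝ
(suc v) ^-1/ zero  = 0ℝ
(suc v) ^-1/ suc k = mkℝ (λ n → + floorRoot (suc v) (suc k) (suc n) ℚ./ suc n)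
                         (approx-cauchy (suc v) (suc k))

-- The vertex set is a subset of an ambient Fin N, so that an induced
-- subhypergraph lives in the same ambient set.  The list of edges has
-- no repetitions: it represents a set of edges.
record Hypergraph (N : ℕ) : Set where
  field
    vertices : Subset N
    edges    : List (Subset N)
    unique   : Unique edges
    edges⊆   : All (_⊆ vertices) edges

open Hypergraph public

∣V∣ : Hypergraph N → ℕ
∣V∣ H = ∣ vertices H ∣

Uniform : ℕ → Hypergraph N → Set
Uniform s H = All (λ e → ∣ e ∣ ≡ s) (edges H)

codegree : Hypergraph N → Fin N → Fin N → ℕ
codegree H x y = length (filter (λ e → x ∈? e ×-dec y ∈? e) (edges H))

distinctPairs : Hypergraph N → List (Fin N × Fin N)
distinctPairs {N} H = filter (λ (x , y) → ¬? (x Fin.≟ y)) (cartesianProduct V V)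
  where V = filter (_∈? vertices H) (allFin N)

Δ₂ : Hypergraph N → ℕ
Δ₂ H = max 0 (map (uncurry (codegree H)) (distinctPairs H))

private
  ⊆-∩ : {e V W : Subset N} → e ⊆ V × e ⊆ W → e ⊆ V ∩ W
  ⊆-∩ (e⊆V , e⊆W) x∈e = x∈p∩q⁺ (e⊆V x∈e , e⊆W x∈e)

-- H [ W ] has vertex set V(H) ∩ W, i.e. W itself when W ⊆ V(H).
_[_] : Hypergraph N → Subset N → Hypergraph N
H [ W ] = record
  { vertices = vertices H ∩ W
  ; edges    = filter (_⊆? W) (edges H)
  ; unique   = Unique.filter⁺ (_⊆? W) (unique H)
  ; edges⊆   = All.zipWith ⊆-∩
                 (All.filter⁺ (_⊆? W) (edges⊆ H) , All.all-filter (_⊆? W) (edges H))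
  }

Monochromatic : ∀ {C : Set} → (Fin N → C) → Subset N → Set
Monochromatic f e = ∃[ c ] ∀ {x} → x ∈ e → f x ≡ c

TwoElement : List ℕ → Set
TwoElement L = length L ≡ 2 × Unique L

-- Colours are natural numbers.  Lists and colourings are total on the
-- ambient Fin N, but only their values on vertices matter.
TwoChoosable : Hypergraph N → Set
TwoChoosable {N} H =
  ∀ (L : Fin N → List ℕ) → (∀ {x} → x ∈ vertices H → TwoElement (L x)) →
  ∃[ f ] (∀ {x} → x ∈ vertices H → f x List.∈ L x) ×
         All (λ e → ¬ Monochromatic f e) (edges H)

-- 2-choosability is decidable: up to renaming, at most 2N colours are
-- used, so only finitely many list assignments need to be inspected.
private
  allVec? : ∀ {B} n {P : Vec (Fin B) n → Set ℓ} → Decidable P → Dec (∀ v → P v)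
  allVec? zero    P? = map′ (λ p → λ { [] → p }) (λ f → f []) (P? [])
  allVec? (suc n) P? = map′ (λ f → λ { (x ∷ v) → f x v }) (λ f x v → f (x ∷ v))
    (Fin.all? λ x → allVec? n (λ v → P? (x ∷ v)))

  choice : ∀ {C : Set} → (Fin N → C) → (Fin N → C) → Subset N → Fin N → C
  choice l r b x = if Vec.lookup b x then l x else r x

  monochromatic? : ∀ {B} (f : Fin N → Fin B) → Decidable (Monochromatic f)
  monochromatic? f e = map′ (λ (c , h) → c , λ {x} → h x) (λ (c , h) → c , λ x → h {x})
    (Fin.any? λ c → Fin.all? λ x → (x ∈? e) →-dec (f x Fin.≟ c))

  module _ (H : Hypergraph N) where

    B : ℕ
    B = suc (N ℕ.+ N)

    Colourable : (l r : Vec (Fin B) N) → Set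
    Colourable l r = ∃[ b ] All (λ e → ¬ Monochromatic (choice (Vec.lookup l) (Vec.lookup r) b) e) (edges H)

    Distinct : (l r : Vec (Fin B) N) → Set
    Distinct l r = ∀ x → x ∈ vertices H → Vec.lookup l x ≢ Vec.lookup r x

    Bounded : Set
    Bounded = ∀ l r → Distinct l r → Colourable l r

    bounded? : Dec Bounded
    bounded? = allVec? N λ l → allVec? N λ r →
      Fin.all? (λ x → (x ∈? vertices H) →-dec ¬? (Vec.lookup l x Fin.≟ Vec.lookup r x))
      →-dec anySubset? (λ b → All.all? (λ e → ¬? (monochromatic? _ e)) (edges H))

    choosable⇒bounded : TwoChoosable H → Bounded
    choosable⇒bounded tc l r l≢r with tc L two
      where
      L : Fin N → List ℕ
      L x = toℕ (Vec.lookup l x) ∷ toℕ (Vec.lookup r x) ∷ []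
      two : ∀ {x} → x ∈ vertices H → TwoElement (L x)
      two x∈V = refl , ((λ eq → l≢r _ x∈V (Fin.toℕ-injective eq)) ∷ []) ∷ [] ∷ []
    ... | f , f∈L , good = b , All.zipWith step (edges⊆ H , good)
      where
      b : Subset N
      b = Vec.tabulate λ x → does (f x ℕ.≟ toℕ (Vec.lookup l x))
      pick : ∀ {u} (i j : Fin B) (d : Dec (u ≡ toℕ i)) →
             u List.∈ (toℕ i ∷ toℕ j ∷ []) → toℕ (if does d then i else j) ≡ u
      pick i j (yes eq) _                 = sym eq
      pick i j (no ¬eq) (here eq)         = contradiction eq ¬eq
      pick i j (no ¬eq) (there (here eq)) = sym eq
      agree : ∀ {x} → x ∈ vertices H → toℕ (choice (Vec.lookup l) (Vec.lookup r) b x) ≡ f x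
      agree {x} x∈V = trans
        (cong (λ t → toℕ (if t then Vec.lookup l x else Vec.lookup r x))
          (Vec.lookup∘tabulate (λ x → does (f x ℕ.≟ toℕ (Vec.lookup l x))) x))
        (pick (Vec.lookup l x) (Vec.lookup r x) (f x ℕ.≟ toℕ (Vec.lookup l x)) (f∈L x∈V))
      step : ∀ {e} → e ⊆ vertices H × ¬ Monochromatic f e →
             ¬ Monochromatic (choice (Vec.lookup l) (Vec.lookup r) b) e
      step (e⊆V , ¬mono) (c , h) = ¬mono (toℕ c , λ x∈e →
        trans (sym (agree (e⊆V x∈e))) (cong toℕ (h x∈e)))

    bounded⇒choosable : Bounded → TwoChoosable H
    bounded⇒choosable bd L two =
      let b , good = bd l r l≢r
      in choice (first ∘ L) (second ∘ L) b
       , (λ {x} x∈V → choice∈L b x (two x∈V))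
       , All.map (λ ¬mono (c , h) → ¬mono (index c , λ {x} x∈e →
           trans (relabel b x) (cong index (h x∈e)))) good
      where
      first second : List ℕ → ℕ
      first  (x ∷ _)     = x
      first  []          = 0
      second (_ ∷ y ∷ _) = y
      second _           = 0

      colour : Fin B → ℕ
      colour zero    = 0
      colour (suc i) = [ first ∘ L , second ∘ L ]′ (splitAt N i)

      index : ℕ → Fin B
      index c with Fin.any? (λ i → colour i ℕ.≟ c)
      ... | yes (i , _) = i
      ... | no _        = zero

      colour-index : ∀ c i → colour i ≡ c → colour (index c) ≡ c
      colour-index c i eq with Fin.any? (λ i → colour i ℕ.≟ c)
      ... | yes (_ , eq′) = eq′
      ... | no ¬∃         = contradiction (i , eq) ¬∃

      index-first : ∀ x → colour (index (first (L x))) ≡ first (L x)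
      index-first x = colour-index _ (suc (x ↑ˡ N))
        (cong [ first ∘ L , second ∘ L ]′ (Fin.splitAt-↑ˡ N x N))

      index-second : ∀ x → colour (index (second (L x))) ≡ second (L x)
      index-second x = colour-index _ (suc (N ↑ʳ x))
        (cong [ first ∘ L , second ∘ L ]′ (Fin.splitAt-↑ʳ N N x))

      l r : Vec (Fin B) N
      l = Vec.tabulate (index ∘ first ∘ L)
      r = Vec.tabulate (index ∘ second ∘ L)

      first≢second : ∀ {M} → TwoElement M → first M ≢ second M
      first≢second {_ ∷ _ ∷ []} (_ , (x≢y ∷ []) ∷ _) = x≢y

      l≢r : Distinct l r
      l≢r x x∈V eq = first≢second (two x∈V) (begin
        first (L x)                   ≡⟨ index-first x ⟨
        colour (index (first (L x)))  ≡⟨ cong colour (Vec.lookup∘tabulate (index ∘ first ∘ L) x) ⟨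
        colour (Vec.lookup l x)       ≡⟨ cong colour eq ⟩
        colour (Vec.lookup r x)       ≡⟨ cong colour (Vec.lookup∘tabulate (index ∘ second ∘ L) x) ⟩
        colour (index (second (L x))) ≡⟨ index-second x ⟩
        second (L x)                  ∎)
        where open ≡-Reasoning

      relabel : ∀ b x → choice (Vec.lookup l) (Vec.lookup r) b x ≡
                        index (choice (first ∘ L) (second ∘ L) b x)
      relabel b x with Vec.lookup b x
      ... | true  = Vec.lookup∘tabulate (index ∘ first ∘ L) x
      ... | false = Vec.lookup∘tabulate (index ∘ second ∘ L) x

      either∈ : ∀ {M} → TwoElement M → first M List.∈ M × second M List.∈ M
      either∈ {_ ∷ _ ∷ []} _ = here refl , there (here refl)

      choice∈L : ∀ b x → TwoElement (L x) → choice (first ∘ L) (second ∘ L) b x List.∈ L x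
      choice∈L b x t with Vec.lookup b x
      ... | true  = proj₁ (either∈ t)
      ... | false = proj₂ (either∈ t)

TwoChoosable? : (H : Hypergraph N) → Dec (TwoChoosable H)
TwoChoosable? H = map′ (bounded⇒choosable H) (choosable⇒bounded H) (bounded? H)

subsets : ∀ N → List (Subset N)
subsets zero    = [] ∷ []
subsets (suc N) = map (outside ∷_) (subsets N) ++ map (inside ∷_) (subsets N)

-- The probability that V_p = W, for W ⊆ V.
weight : ℝ → (V W : Subset N) → ℝ
weight p V W = p ^ℝ ∣ W ∣ *ℝ (1ℝ -ℝ p) ^ℝ ∣ V ─ W ∣

-- The probability that V_p satisfies E.
Pr : ℝ → (V : Subset N) {E : Pred (Subset N) ℓ} → Decidable E → ℝ
Pr {N} p V E? = sumℝ (map (weight p V) (filter E? (filter (_⊆? V) (subsets N))))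

{-# OPTIONS --safe #-}
module Submission where

-- If H [ W ] cannot be coloured from some lists of size two, then neither can an edge-minimal
-- subhypergraph G, and recolouring x ∈ e shows that every edge e of G has at each of its vertices x
-- a neighbour in G that meets e exactly in x.  Explore G from an edge: let U be the set of
-- discovered vertices.  If possible, add a closer, an edge f with |f ∩ U| ≥ 2 that is not contained
-- in U; otherwise take a tree step, adding an edge that meets U only in the next vertex of a queue.
-- After t tree steps, |U| = s + (s - 1) t + g, where the gain g counts the vertices found by closers.
--
-- A tree step costs a factor O(v p^(s-1)), which is small by the choice of c, and every unit of gain
-- costs a factor O(p log² v).  As there are O(v²) possible first edges, the expected number of
-- explorations inside V_p that reach t ≥ log₂ v or g ≥ s - 1 tends to 0.
--
-- Suppose that an exploration of G gets stuck before that.  The private neighbours of the edge of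
-- the last tree step force a gain of at least s - 2 after that step, hence no gain before it.
-- Starting from two edges with at least two common vertices would give a gain at the outset, so G is
-- linear, which forces s = 3.  Then the edges found last form a triangle on three vertices of degree
-- two, and a colouring of G minus one edge of the triangle can be repaired, a contradiction.

open import Defs

-- `explore` has to enumerate its outcomes without reference to G, which varies with the lists and
-- with W: it branches over the edges of H, and G merely selects the branch to follow. The expected
-- number of outcomes inside V_p is bounded by a potential. Dropping the head of the queue, a tree
-- step and a closer may each use a third of it, whence the factors 3.
--
-- A gain of s - 1 is the least target that the first moment allows: it leaves (v p^(s-1))² p up to
-- logarithms, whereas s - 2 would leave only (v p^(s-1))². A stuck exploration has gain exactly s -
-- 2, and this gap is why its last edges have to be analysed. The depth log₂ v is large enough for
-- the tree rate to beat the v² first edges and small enough for U, and hence the number of closers,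
-- to stay polylogarithmic.
--
-- Probabilities are estimated over ℚ, at each approximant of p. Such an approximant may lie outside
-- [0, 1]; it is moved into the interval, at a cost controlled by a Lipschitz bound in p for fixed
-- N.

module Rationals where

  open import Algebra.Bundles using (CommutativeRing)
  import Algebra.Properties.CommutativeSemiring.Exp as Exp
  import Algebra.Properties.Semiring.Mult as Mult
  open import Data.Bool.Base using (if_then_else_)
  open import Data.Fin.Subset using (Subset; _⊆_; ∣_∣; _─_; inside; outside)
  open import Data.Fin.Subset.Properties using (_⊆?_; drop-∷-⊆; out⊆; in⊆in)
  open import Data.List.Base using (List; []; _∷_; _++_; map; filter; foldr; concatMap; length)
  open import Data.List.Membership.Propositional using (_∈_)
  open import Data.List.Properties using (map-∘)
  open import Data.List.Relation.Unary.Any using (here; there)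
  open import Data.Nat.Base as ℕ using (ℕ; zero; suc)
  open import Data.Rational.Base renaming (∣_∣ to abs)
  open import Data.Rational.Properties
  import Data.Rational.Solver as Solver
  open import Data.Sum.Base using (inj₁; inj₂)
  open import Data.Vec.Base using ([]; _∷_; here)

  open import Function.Base using (_∘_)
  open import Level using (Level)
  open import Relation.Binary.PropositionalEquality hiding ([_])
  open import Relation.Nullary using (Dec; yes; no; does; ¬_; contradiction)
  open import Relation.Unary using (Pred; Decidable)

  private
    variable
      a ℓ : Level
      A B : Set a
      N : ℕ

  open Exp (CommutativeRing.commutativeSemiring +-*-commutativeRing) public
    using (_^_; ^-distrib-*; ^-homo-*; ^-assocʳ)
  open Mult (CommutativeRing.semiring +-*-commutativeRing) public
    using (×-homo-+; ×1-homo-*) renaming (_×_ to _·_)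

  -- Ordered-field arithmetic in ℚ

  ι : ℕ → ℚ
  ι n = n · 1ℚ

  0≤1 : 0ℚ ≤ 1ℚ
  0≤1 = nonNegative⁻¹ 1ℚ

  0≤+ : ∀ {x y} → 0ℚ ≤ x → 0ℚ ≤ y → 0ℚ ≤ x + y
  0≤+ = +-mono-≤ {0ℚ} {_} {0ℚ}

  *-mono-≤ : ∀ {w x y z} → 0ℚ ≤ w → w ≤ x → 0ℚ ≤ y → y ≤ z → w * y ≤ x * z
  *-mono-≤ {w} {x} {y} {z} 0≤w w≤x 0≤y y≤z = ≤-trans
    (*-monoʳ-≤-nonNeg y {{nonNegative 0≤y}} w≤x)
    (*-monoˡ-≤-nonNeg x {{nonNegative (≤-trans 0≤w w≤x)}} y≤z)

  *-monoˡ : ∀ {x y z} → 0ℚ ≤ x → y ≤ z → x * y ≤ x * z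
  *-monoˡ {x} 0≤x = *-monoˡ-≤-nonNeg x {{nonNegative 0≤x}}

  *-monoʳ : ∀ {x y z} → 0ℚ ≤ x → y ≤ z → y * x ≤ z * x
  *-monoʳ {x} 0≤x = *-monoʳ-≤-nonNeg x {{nonNegative 0≤x}}

  0≤* : ∀ {x y} → 0ℚ ≤ x → 0ℚ ≤ y → 0ℚ ≤ x * y
  0≤* {x} {y} 0≤x 0≤y = subst (_≤ x * y) (*-zeroʳ x) (*-monoˡ 0≤x 0≤y)

  *-≤ˡ : ∀ {x y} → 0ℚ ≤ y → x ≤ 1ℚ → x * y ≤ y
  *-≤ˡ {x} {y} 0≤y x≤1 = subst (x * y ≤_) (*-identityˡ y) (*-monoʳ 0≤y x≤1)

  0≤^ : ∀ {x} n → 0ℚ ≤ x → 0ℚ ≤ x ^ n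
  0≤^ zero    0≤x = 0≤1
  0≤^ (suc n) 0≤x = 0≤* 0≤x (0≤^ n 0≤x)

  ^-mono-≤ : ∀ {x y} n → 0ℚ ≤ x → x ≤ y → x ^ n ≤ y ^ n
  ^-mono-≤ zero    0≤x x≤y = ≤-refl
  ^-mono-≤ (suc n) 0≤x x≤y = *-mono-≤ 0≤x x≤y (0≤^ n 0≤x) (^-mono-≤ n 0≤x x≤y)

  1^ : ∀ n → 1ℚ ^ n ≡ 1ℚ
  1^ zero    = refl
  1^ (suc n) = trans (*-identityˡ _) (1^ n)

  ^-≤1 : ∀ {x} n → 0ℚ ≤ x → x ≤ 1ℚ → x ^ n ≤ 1ℚ
  ^-≤1 {x} n 0≤x x≤1 = subst (x ^ n ≤_) (1^ n) (^-mono-≤ n 0≤x x≤1)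

  -- A root of the inequality, taken without leaving ℚ: if 1 ≤ x, then x ≤ `x ^ suc n`.
  ^-cancel-≤1 : ∀ {x} n → 0ℚ ≤ x → x ^ suc n ≤ 1ℚ → x ≤ 1ℚ
  ^-cancel-≤1 {x} n 0≤x xⁿ≤1 with ≤-total x 1ℚ
  ... | inj₁ x≤1 = x≤1
  ... | inj₂ 1≤x = ≤-trans (subst (_≤ x * x ^ n) (*-identityʳ x)
    (*-monoˡ 0≤x (subst (_≤ x ^ n) (1^ n) (^-mono-≤ n 0≤1 1≤x)))) xⁿ≤1

  0≤ι : ∀ n → 0ℚ ≤ ι n
  0≤ι zero    = ≤-refl
  0≤ι (suc n) = 0≤+ 0≤1 (0≤ι n)

  ι-mono : ∀ {m n} → m ℕ.≤ n → ι m ≤ ι n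
  ι-mono {n = n} ℕ.z≤n = 0≤ι n
  ι-mono (ℕ.s≤s m≤n)   = +-monoʳ-≤ 1ℚ (ι-mono m≤n)

  ι-* : ∀ m n → ι (m ℕ.* n) ≡ ι m * ι n
  ι-* = ×1-homo-*

  ι-^ : ∀ m n → ι (m ℕ.^ n) ≡ ι m ^ n
  ι-^ m zero    = refl
  ι-^ m (suc n) = trans (ι-* m (m ℕ.^ n)) (cong (ι m *_) (ι-^ m n))

  -- Finite sums and indicators

  sumℚ : List ℚ → ℚ
  sumℚ = foldr _+_ 0ℚ

  ∑ : (A → ℚ) → List A → ℚ
  ∑ f xs = sumℚ (map f xs)

  ∑-++ : (f : A → ℚ) → ∀ xs ys → ∑ f (xs ++ ys) ≡ ∑ f xs + ∑ f ys
  ∑-++ f []       ys = sym (+-identityˡ _)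
  ∑-++ f (x ∷ xs) ys = trans (cong (f x +_) (∑-++ f xs ys)) (sym (+-assoc (f x) (∑ f xs) (∑ f ys)))

  ∑-map : (f : B → ℚ) (h : A → B) → ∀ xs → ∑ f (map h xs) ≡ ∑ (f ∘ h) xs
  ∑-map f h xs = cong sumℚ (sym (map-∘ xs))

  ∑-cong : {f g : A → ℚ} → (∀ x → f x ≡ g x) → ∀ xs → ∑ f xs ≡ ∑ g xs
  ∑-cong f≡g []       = refl
  ∑-cong f≡g (x ∷ xs) = cong₂ _+_ (f≡g x) (∑-cong f≡g xs)

  0≤∑ : {f : A → ℚ} → (∀ x → 0ℚ ≤ f x) → ∀ xs → 0ℚ ≤ ∑ f xs
  0≤∑ 0≤f []       = ≤-refl
  0≤∑ 0≤f (x ∷ xs) = 0≤+ (0≤f x) (0≤∑ 0≤f xs)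

  ∑-mono : {f g : A → ℚ} → (∀ x → f x ≤ g x) → ∀ xs → ∑ f xs ≤ ∑ g xs
  ∑-mono f≤g []       = ≤-refl
  ∑-mono f≤g (x ∷ xs) = +-mono-≤ (f≤g x) (∑-mono f≤g xs)

  ∈⇒≤∑ : {f : A → ℚ} → (∀ x → 0ℚ ≤ f x) → ∀ {x xs} → x ∈ xs → f x ≤ ∑ f xs
  ∈⇒≤∑ {f = f} 0≤f {x} {y ∷ xs} (here refl) = subst (_≤ f x + ∑ f xs) (+-identityʳ (f x)) (+-monoʳ-≤ (f x) (0≤∑ 0≤f xs))
  ∈⇒≤∑ {f = f} 0≤f {x} {y ∷ xs} (there x∈)  = subst (_≤ f y + ∑ f xs) (+-identityˡ (f x)) (+-mono-≤ (0≤f y) (∈⇒≤∑ 0≤f x∈))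

  ∑-zero : ∀ {f : A → ℚ} → (∀ x → f x ≡ 0ℚ) → ∀ xs → ∑ f xs ≡ 0ℚ
  ∑-zero f≡0 []       = refl
  ∑-zero f≡0 (x ∷ xs) = cong₂ _+_ (f≡0 x) (∑-zero f≡0 xs)

  *-∑ : ∀ c (f : A → ℚ) xs → ∑ (λ x → c * f x) xs ≡ c * ∑ f xs
  *-∑ c f []       = sym (*-zeroʳ c)
  *-∑ c f (x ∷ xs) = trans (cong (c * f x +_) (*-∑ c f xs)) (sym (*-distribˡ-+ c (f x) (∑ f xs)))

  ∑-concatMap-≤ : ∀ (f : B → ℚ) (h : A → List B) c xs → (∀ {x} → x ∈ xs → ∑ f (h x) ≤ c) →
    ∑ f (concatMap h xs) ≤ ι (length xs) * c
  ∑-concatMap-≤ f h c []       _  = ≤-reflexive (sym (*-zeroˡ c))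
  ∑-concatMap-≤ f h c (x ∷ xs) h≤ = begin
    ∑ f (h x ++ concatMap h xs)     ≡⟨ ∑-++ f (h x) (concatMap h xs) ⟩
    ∑ f (h x) + ∑ f (concatMap h xs) ≤⟨ +-mono-≤ (h≤ (here refl)) (∑-concatMap-≤ f h c xs (h≤ ∘ there)) ⟩
    c + ι (length xs) * c           ≡⟨ cong (_+ ι (length xs) * c) (*-identityˡ c) ⟨
    1ℚ * c + ι (length xs) * c      ≡⟨ *-distribʳ-+ c 1ℚ (ι (length xs)) ⟨
    (1ℚ + ι (length xs)) * c        ∎
    where open ≤-Reasoning

  𝟙 : {P : Set ℓ} → Dec P → ℚ
  𝟙 d = if does d then 1ℚ else 0ℚ

  0≤𝟙 : {P : Set ℓ} (d : Dec P) → 0ℚ ≤ 𝟙 d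
  0≤𝟙 (yes _) = 0≤1
  0≤𝟙 (no _)  = ≤-refl

  𝟙≤1 : {P : Set ℓ} (d : Dec P) → 𝟙 d ≤ 1ℚ
  𝟙≤1 (yes _) = ≤-refl
  𝟙≤1 (no _)  = 0≤1

  𝟙-yes : {P : Set ℓ} (d : Dec P) → P → 𝟙 d ≡ 1ℚ
  𝟙-yes (yes _) _ = refl
  𝟙-yes (no ¬p) p = contradiction p ¬p

  𝟙-no : {P : Set ℓ} (d : Dec P) → ¬ P → 𝟙 d ≡ 0ℚ
  𝟙-no (yes p) ¬p = contradiction p ¬p
  𝟙-no (no _)  _  = refl

  𝟙-cong : {P : Set ℓ} {Q : Set a} (d : Dec P) (e : Dec Q) → (P → Q) → (Q → P) → 𝟙 d ≡ 𝟙 e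
  𝟙-cong (yes p) e f g = sym (𝟙-yes e (f p))
  𝟙-cong (no ¬p) e f g = sym (𝟙-no e (¬p ∘ g))

  ∑-filter : {P : Pred A ℓ} (P? : Decidable P) (f : A → ℚ) →
    ∀ xs → ∑ f (filter P? xs) ≡ ∑ (λ x → 𝟙 (P? x) * f x) xs
  ∑-filter P? f []       = refl
  ∑-filter P? f (x ∷ xs) with P? x
  ... | yes _ = cong₂ _+_ (sym (*-identityˡ (f x))) (∑-filter P? f xs)
  ... | no _  = trans (∑-filter P? f xs)
    (sym (trans (cong (_+ _) (*-zeroˡ (f x))) (+-identityˡ _)))

  -- Expectations over the random subset

  in⊈out : ∀ {S W : Subset N} → ¬ ((inside ∷ S) ⊆ (outside ∷ W))
  in⊈out h with h here
  ... | ()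

  -- One approximant of `weight`: real arithmetic is termwise, so `weight p V W` is this expression
  -- at every approximant of p.
  weightℚ : ℚ → (V W : Subset N) → ℚ
  weightℚ p V W = p ^ ∣ W ∣ * (1ℚ - p) ^ ∣ V ─ W ∣

  Prℚ : ℚ → (V : Subset N) {E : Pred (Subset N) ℓ} → Decidable E → ℚ
  Prℚ {N} p V E? = ∑ (weightℚ p V) (filter E? (filter (_⊆? V) (subsets N)))

  -- The expectation of f (V_p), revealing the membership of one vertex at a time.
  𝔼 : ℚ → Subset N → (Subset N → ℚ) → ℚ
  𝔼 p []            f = f []
  𝔼 p (outside ∷ V) f = 𝔼 p V (f ∘ (outside ∷_))
  𝔼 p (inside ∷ V)  f = (1ℚ - p) * 𝔼 p V (f ∘ (outside ∷_)) + p * 𝔼 p V (f ∘ (inside ∷_))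

  -- `subsets` is split by its first coordinate, as `𝔼` is. The condition W ⊆ V is an indicator
  -- rather than a filter, so that both halves range over all subsets of the tail; a first vertex
  -- outside V kills the half that contains it.
  ∑-subsets : ∀ p (V : Subset N) f →
    ∑ (λ W → 𝟙 (W ⊆? V) * (f W * weightℚ p V W)) (subsets N) ≡ 𝔼 p V f
  ∑-subsets p []            f = trans (+-identityʳ _) (trans (*-identityˡ _) (*-identityʳ (f [])))
  ∑-subsets {suc N} p (outside ∷ V) f = begin
    ∑ g (map (outside ∷_) (subsets N) ++ map (inside ∷_) (subsets N))
      ≡⟨ ∑-++ g (map (outside ∷_) (subsets N)) (map (inside ∷_) (subsets N)) ⟩
    ∑ g (map (outside ∷_) (subsets N)) + ∑ g (map (inside ∷_) (subsets N))
      ≡⟨ cong₂ _+_ (∑-map g (outside ∷_) (subsets N)) (∑-map g (inside ∷_) (subsets N)) ⟩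
    ∑ (g ∘ (outside ∷_)) (subsets N) + ∑ (g ∘ (inside ∷_)) (subsets N)
      ≡⟨ cong₂ _+_ (∑-cong out (subsets N)) (∑-zero ins (subsets N)) ⟩
    ∑ (λ W → 𝟙 (W ⊆? V) * (f (outside ∷ W) * weightℚ p V W)) (subsets N) + 0ℚ
      ≡⟨ +-identityʳ _ ⟩
    ∑ (λ W → 𝟙 (W ⊆? V) * (f (outside ∷ W) * weightℚ p V W)) (subsets N)
      ≡⟨ ∑-subsets p V (f ∘ (outside ∷_)) ⟩
    𝔼 p V (f ∘ (outside ∷_)) ∎
    where
    open ≡-Reasoning
    g : Subset (suc N) → ℚ
    g W = 𝟙 (W ⊆? (outside ∷ V)) * (f W * weightℚ p (outside ∷ V) W)
    out : ∀ W → g (outside ∷ W) ≡ 𝟙 (W ⊆? V) * (f (outside ∷ W) * weightℚ p V W)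
    out W = cong (_* (f (outside ∷ W) * weightℚ p V W))
      (𝟙-cong ((outside ∷ W) ⊆? (outside ∷ V)) (W ⊆? V) drop-∷-⊆ out⊆)
    ins : ∀ W → g (inside ∷ W) ≡ 0ℚ
    ins W = trans (cong (_* (f (inside ∷ W) * weightℚ p (outside ∷ V) (inside ∷ W)))
      (𝟙-no ((inside ∷ W) ⊆? (outside ∷ V)) in⊈out))
      (*-zeroˡ (f (inside ∷ W) * weightℚ p (outside ∷ V) (inside ∷ W)))
  ∑-subsets {suc N} p (inside ∷ V) f = begin
    ∑ g (map (outside ∷_) (subsets N) ++ map (inside ∷_) (subsets N))
      ≡⟨ ∑-++ g (map (outside ∷_) (subsets N)) (map (inside ∷_) (subsets N)) ⟩
    ∑ g (map (outside ∷_) (subsets N)) + ∑ g (map (inside ∷_) (subsets N))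
      ≡⟨ cong₂ _+_ (∑-map g (outside ∷_) (subsets N)) (∑-map g (inside ∷_) (subsets N)) ⟩
    ∑ (g ∘ (outside ∷_)) (subsets N) + ∑ (g ∘ (inside ∷_)) (subsets N)
      ≡⟨ cong₂ _+_ (∑-cong out (subsets N)) (∑-cong ins (subsets N)) ⟩
    ∑ (λ W → (1ℚ - p) * h outside W) (subsets N) + ∑ (λ W → p * h inside W) (subsets N)
      ≡⟨ cong₂ _+_ (*-∑ (1ℚ - p) (h outside) (subsets N)) (*-∑ p (h inside) (subsets N)) ⟩
    (1ℚ - p) * ∑ (h outside) (subsets N) + p * ∑ (h inside) (subsets N)
      ≡⟨ cong₂ (λ x y → (1ℚ - p) * x + p * y) (∑-subsets p V (f ∘ (outside ∷_))) (∑-subsets p V (f ∘ (inside ∷_))) ⟩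
    (1ℚ - p) * 𝔼 p V (f ∘ (outside ∷_)) + p * 𝔼 p V (f ∘ (inside ∷_)) ∎
    where
    open ≡-Reasoning
    open Solver.+-*-Solver
    g : Subset (suc N) → ℚ
    g W = 𝟙 (W ⊆? (inside ∷ V)) * (f W * weightℚ p (inside ∷ V) W)
    h : _ → Subset N → ℚ
    h b W = 𝟙 (W ⊆? V) * (f (b ∷ W) * weightℚ p V W)
    out : ∀ W → g (outside ∷ W) ≡ (1ℚ - p) * h outside W
    out W = trans (cong (_* (f (outside ∷ W) * weightℚ p (inside ∷ V) (outside ∷ W)))
      (𝟙-cong ((outside ∷ W) ⊆? (inside ∷ V)) (W ⊆? V) drop-∷-⊆ out⊆))
      (solve 5 (λ i x w q r → i :* (x :* (w :* (q :* r))) := q :* (i :* (x :* (w :* r)))) refl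
        (𝟙 (W ⊆? V)) (f (outside ∷ W)) (p ^ ∣ W ∣) (1ℚ - p) ((1ℚ - p) ^ ∣ V ─ W ∣))
    ins : ∀ W → g (inside ∷ W) ≡ p * h inside W
    ins W = trans (cong (_* (f (inside ∷ W) * weightℚ p (inside ∷ V) (inside ∷ W)))
      (𝟙-cong ((inside ∷ W) ⊆? (inside ∷ V)) (W ⊆? V) drop-∷-⊆ in⊆in))
      (solve 5 (λ i x w q r → i :* (x :* ((q :* w) :* r)) := q :* (i :* (x :* (w :* r)))) refl
        (𝟙 (W ⊆? V)) (f (inside ∷ W)) (p ^ ∣ W ∣) p ((1ℚ - p) ^ ∣ V ─ W ∣))

  Pr-𝔼 : ∀ p (V : Subset N) {E : Pred (Subset N) ℓ} (E? : Decidable E) →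
    Prℚ p V E? ≡ 𝔼 p V (λ W → 𝟙 (E? W))
  Pr-𝔼 {N} p V E? = begin
    ∑ (weightℚ p V) (filter E? (filter (_⊆? V) (subsets N)))
      ≡⟨ ∑-filter E? (weightℚ p V) (filter (_⊆? V) (subsets N)) ⟩
    ∑ (λ W → 𝟙 (E? W) * weightℚ p V W) (filter (_⊆? V) (subsets N))
      ≡⟨ ∑-filter (_⊆? V) (λ W → 𝟙 (E? W) * weightℚ p V W) (subsets N) ⟩
    ∑ (λ W → 𝟙 (W ⊆? V) * (𝟙 (E? W) * weightℚ p V W)) (subsets N)
      ≡⟨ ∑-subsets p V (λ W → 𝟙 (E? W)) ⟩
    𝔼 p V (λ W → 𝟙 (E? W)) ∎
    where open ≡-Reasoning

  𝔼-const : ∀ p (V : Subset N) c → 𝔼 p V (λ _ → c) ≡ c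
  𝔼-const p []            c = refl
  𝔼-const p (outside ∷ V) c = 𝔼-const p V c
  𝔼-const p (inside ∷ V)  c = trans (cong (λ x → (1ℚ - p) * x + p * x) (𝔼-const p V c))
    (solve 2 (λ p c → (con 1ℚ :- p) :* c :+ p :* c := c) refl p c)
    where open Solver.+-*-Solver

  𝔼-+ : ∀ p (V : Subset N) f g → 𝔼 p V (λ W → f W + g W) ≡ 𝔼 p V f + 𝔼 p V g
  𝔼-+ p []            f g = refl
  𝔼-+ p (outside ∷ V) f g = 𝔼-+ p V _ _
  𝔼-+ p (inside ∷ V)  f g = trans
    (cong₂ (λ x y → (1ℚ - p) * x + p * y) (𝔼-+ p V _ _) (𝔼-+ p V _ _))
    (solve 6 (λ q p a b c d → q :* (a :+ b) :+ p :* (c :+ d) := (q :* a :+ p :* c) :+ (q :* b :+ p :* d)) refl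
      (1ℚ - p) p (𝔼 p V (f ∘ (outside ∷_))) (𝔼 p V (g ∘ (outside ∷_)))
      (𝔼 p V (f ∘ (inside ∷_))) (𝔼 p V (g ∘ (inside ∷_))))
    where open Solver.+-*-Solver

  𝔼-∑ : ∀ p (V : Subset N) (f : A → Subset N → ℚ) xs →
    𝔼 p V (λ W → ∑ (λ x → f x W) xs) ≡ ∑ (λ x → 𝔼 p V (f x)) xs
  𝔼-∑ p V f []       = 𝔼-const p V 0ℚ
  𝔼-∑ p V f (x ∷ xs) = trans (𝔼-+ p V (f x) _) (cong (𝔼 p V (f x) +_) (𝔼-∑ p V f xs))

  module _ {p} (0≤p : 0ℚ ≤ p) (p≤1 : p ≤ 1ℚ) where

    0≤1-p : 0ℚ ≤ 1ℚ - p
    0≤1-p = subst (_≤ 1ℚ - p) (+-inverseʳ p) (+-monoˡ-≤ (- p) p≤1)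

    𝔼-mono : ∀ (V : Subset N) {f g} → (∀ W → f W ≤ g W) → 𝔼 p V f ≤ 𝔼 p V g
    𝔼-mono []            f≤g = f≤g []
    𝔼-mono (outside ∷ V) f≤g = 𝔼-mono V (f≤g ∘ _)
    𝔼-mono (inside ∷ V)  f≤g = +-mono-≤
      (*-monoˡ 0≤1-p (𝔼-mono V (f≤g ∘ (outside ∷_)))) (*-monoˡ 0≤p (𝔼-mono V (f≤g ∘ (inside ∷_))))

    -- Memberships of distinct vertices are independent. There is equality for S ⊆ V; a vertex of S
    -- outside V makes the event impossible.
    𝔼-⊆ : ∀ (V S : Subset N) → 𝔼 p V (λ W → 𝟙 (S ⊆? W)) ≤ p ^ ∣ S ∣
    𝔼-⊆ []            []            = ≤-refl
    𝔼-⊆ (outside ∷ V) (outside ∷ S) = ≤-trans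
      (𝔼-mono V λ W → ≤-reflexive (𝟙-cong ((outside ∷ S) ⊆? (outside ∷ W)) (S ⊆? W) drop-∷-⊆ out⊆))
      (𝔼-⊆ V S)
    𝔼-⊆ (inside ∷ V)  (outside ∷ S) = begin
      (1ℚ - p) * 𝔼 p V _ + p * 𝔼 p V _
        ≤⟨ +-mono-≤ (*-monoˡ 0≤1-p (≤-trans (𝔼-mono V λ W → ≤-reflexive
                       (𝟙-cong ((outside ∷ S) ⊆? (outside ∷ W)) (S ⊆? W) drop-∷-⊆ out⊆)) (𝔼-⊆ V S)))
                    (*-monoˡ 0≤p (≤-trans (𝔼-mono V λ W → ≤-reflexive
                       (𝟙-cong ((outside ∷ S) ⊆? (inside ∷ W)) (S ⊆? W) drop-∷-⊆ out⊆)) (𝔼-⊆ V S))) ⟩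
      (1ℚ - p) * p ^ ∣ S ∣ + p * p ^ ∣ S ∣
        ≡⟨ solve 2 (λ p c → (con 1ℚ :- p) :* c :+ p :* c := c) refl p (p ^ ∣ S ∣) ⟩
      p ^ ∣ S ∣ ∎
      where
      open ≤-Reasoning
      open Solver.+-*-Solver
    𝔼-⊆ (outside ∷ V) (inside ∷ S) = ≤-trans
      (𝔼-mono V λ W → ≤-reflexive (𝟙-no ((inside ∷ S) ⊆? (outside ∷ W)) in⊈out))
      (subst (_≤ p * p ^ ∣ S ∣) (sym (𝔼-const p V 0ℚ)) (0≤^ (suc ∣ S ∣) 0≤p))
    𝔼-⊆ (inside ∷ V)  (inside ∷ S) = begin
      (1ℚ - p) * 𝔼 p V _ + p * 𝔼 p V _
        ≤⟨ +-mono-≤ (*-monoˡ 0≤1-p (𝔼-mono V λ W → ≤-reflexive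
                       (𝟙-no ((inside ∷ S) ⊆? (outside ∷ W)) in⊈out)))
                    (*-monoˡ 0≤p (≤-trans (𝔼-mono V λ W → ≤-reflexive
                       (𝟙-cong ((inside ∷ S) ⊆? (inside ∷ W)) (S ⊆? W) drop-∷-⊆ in⊆in)) (𝔼-⊆ V S))) ⟩
      (1ℚ - p) * 𝔼 p V (λ _ → 0ℚ) + p * p ^ ∣ S ∣
        ≡⟨ cong (λ x → (1ℚ - p) * x + p * p ^ ∣ S ∣) (𝔼-const p V 0ℚ) ⟩
      (1ℚ - p) * 0ℚ + p * p ^ ∣ S ∣
        ≡⟨ solve 2 (λ p c → (con 1ℚ :- p) :* con 0ℚ :+ c := c) refl p (p * p ^ ∣ S ∣) ⟩
      p * p ^ ∣ S ∣ ∎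
      where
      open ≤-Reasoning
      open Solver.+-*-Solver

    -- The first-moment method: the members of `Ss` contained in W are counted with multiplicity, at
    -- least one of them whenever E fails, and `pointwise` is then integrated.
    union-bound : ∀ (V : Subset N) {E : Pred (Subset N) ℓ} (E? : Decidable E) Ss →
      (∀ W → ¬ E W → ∑ (λ S → 𝟙 (S ⊆? W)) Ss ≥ 1ℚ) →
      1ℚ ≤ Prℚ p V E? + ∑ (λ S → p ^ ∣ S ∣) Ss
    union-bound V E? Ss cover = begin
      1ℚ                                                          ≡⟨ 𝔼-const p V 1ℚ ⟨
      𝔼 p V (λ _ → 1ℚ)                                            ≤⟨ 𝔼-mono V pointwise ⟩
      𝔼 p V (λ W → 𝟙 (E? W) + ∑ (λ S → 𝟙 (S ⊆? W)) Ss)            ≡⟨ 𝔼-+ p V _ _ ⟩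
      𝔼 p V (λ W → 𝟙 (E? W)) + 𝔼 p V (λ W → ∑ (λ S → 𝟙 (S ⊆? W)) Ss)
        ≡⟨ cong₂ _+_ (sym (Pr-𝔼 p V E?)) (𝔼-∑ p V (λ S W → 𝟙 (S ⊆? W)) Ss) ⟩
      Prℚ p V E? + ∑ (λ S → 𝔼 p V (λ W → 𝟙 (S ⊆? W))) Ss
        ≤⟨ +-monoʳ-≤ (Prℚ p V E?) (∑-mono (𝔼-⊆ V) Ss) ⟩
      Prℚ p V E? + ∑ (λ S → p ^ ∣ S ∣) Ss                         ∎
      where
      open ≤-Reasoning
      pointwise : ∀ W → 1ℚ ≤ 𝟙 (E? W) + ∑ (λ S → 𝟙 (S ⊆? W)) Ss
      pointwise W with E? W
      ... | yes _ = subst (_≤ 1ℚ + ∑ (λ S → 𝟙 (S ⊆? W)) Ss) (+-identityʳ 1ℚ) (+-monoʳ-≤ 1ℚ (0≤∑ (λ S → 0≤𝟙 (S ⊆? W)) Ss))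
      ... | no ¬e = subst (1ℚ ≤_) (sym (+-identityˡ _)) (cover W ¬e)

    Pr≤1 : ∀ (V : Subset N) {E : Pred (Subset N) ℓ} (E? : Decidable E) → Prℚ p V E? ≤ 1ℚ
    Pr≤1 V E? = subst₂ _≤_ (sym (Pr-𝔼 p V E?)) (𝔼-const p V 1ℚ) (𝔼-mono V (λ W → 𝟙≤1 (E? W)))

  -- A crude Lipschitz constant in p, depending on N only. Revealing one vertex keeps the old
  -- constant on the convex combination at y and adds the change of p times the two conditional
  -- expectations at x, each at most 1 + `lipschitz n` in absolute value.
  lipschitz : ℕ → ℚ
  lipschitz zero    = 0ℚ
  lipschitz (suc n) = lipschitz n + (1ℚ + 1ℚ) * (1ℚ + lipschitz n)

  0≤lipschitz : ∀ n → 0ℚ ≤ lipschitz n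
  0≤lipschitz zero    = ≤-refl
  0≤lipschitz (suc n) = 0≤+ (0≤lipschitz n) (0≤* (0≤+ 0≤1 0≤1) (0≤+ 0≤1 (0≤lipschitz n)))

  abs-*≤ : ∀ {x y a b} → abs x ≤ a → abs y ≤ b → abs (x * y) ≤ a * b
  abs-*≤ {x} {y} {a} {b} x≤a y≤b = subst (_≤ a * b) (sym (∣p*q∣≡∣p∣*∣q∣ x y))
    (*-mono-≤ (0≤∣p∣ x) x≤a (0≤∣p∣ y) y≤b)

  abs≤ : ∀ {x c} → 0ℚ ≤ x → x ≤ c → abs x ≤ c
  abs≤ {x} {c} 0≤x x≤c = subst (_≤ c) (sym (0≤p⇒∣p∣≡p 0≤x)) x≤c

  module _ {x y δ} (0≤y : 0ℚ ≤ y) (y≤1 : y ≤ 1ℚ) (close : abs (x - y) ≤ δ) (δ≤1 : δ ≤ 1ℚ) where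

    private
      0≤δ : 0ℚ ≤ δ
      0≤δ = ≤-trans (0≤∣p∣ (x - y)) close

    -- Only y is a probability; x is an approximant of one and may lie outside [0, 1], so its
    -- expectations are bounded by comparison with those at y (`size`).
    𝔼-lipschitz : ∀ (V : Subset N) {f} → (∀ W → 0ℚ ≤ f W) → (∀ W → f W ≤ 1ℚ) →
      abs (𝔼 x V f - 𝔼 y V f) ≤ lipschitz N * δ
    𝔼-lipschitz [] {f} 0≤f f≤1 = ≤-reflexive (trans (cong abs (+-inverseʳ (f []))) (sym (*-zeroˡ δ)))
    𝔼-lipschitz {suc N} (outside ∷ V) {f} 0≤f f≤1 = ≤-trans (𝔼-lipschitz V (0≤f ∘ _) (f≤1 ∘ _))
      (*-monoʳ 0≤δ (subst (_≤ lipschitz (suc N)) (+-identityʳ (lipschitz N))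
        (+-monoʳ-≤ (lipschitz N) (0≤* (0≤+ 0≤1 0≤1) (0≤+ 0≤1 (0≤lipschitz N))))))
    𝔼-lipschitz {suc N} (inside ∷ V) {f} 0≤f f≤1 = begin
      abs (((1ℚ - x) * Ax + x * Bx) - ((1ℚ - y) * Ay + y * By))
        ≡⟨ cong abs (solve 6 (λ x y a b c d →
             ((con 1ℚ :- x) :* a :+ x :* b) :- ((con 1ℚ :- y) :* c :+ y :* d)
             := ((con 1ℚ :- y) :* (a :- c) :+ y :* (b :- d)) :+ (x :- y) :* (b :- a)) refl x y Ax Bx Ay By) ⟩
      abs (((1ℚ - y) * (Ax - Ay) + y * (Bx - By)) + (x - y) * (Bx - Ax))
        ≤⟨ ∣p+q∣≤∣p∣+∣q∣ ((1ℚ - y) * (Ax - Ay) + y * (Bx - By)) ((x - y) * (Bx - Ax)) ⟩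
      abs ((1ℚ - y) * (Ax - Ay) + y * (Bx - By)) + abs ((x - y) * (Bx - Ax))
        ≤⟨ +-mono-≤
             (≤-trans (∣p+q∣≤∣p∣+∣q∣ ((1ℚ - y) * (Ax - Ay)) (y * (Bx - By)))
               (+-mono-≤ (abs-*≤ {1ℚ - y} {Ax - Ay} (abs≤ (0≤1-p 0≤y y≤1) ≤-refl) dA)
                         (abs-*≤ {y} {Bx - By} (abs≤ 0≤y ≤-refl) dB)))
             (abs-*≤ {x - y} {Bx - Ax} close
               (≤-trans (∣p-q∣≤∣p∣+∣q∣ Bx Ax) (+-mono-≤
                 (size {Bx} {By} dB (0≤𝔼 _ (0≤f ∘ (inside ∷_))) (𝔼≤1 _ (f≤1 ∘ (inside ∷_))))
                 (size {Ax} {Ay} dA (0≤𝔼 _ (0≤f ∘ (outside ∷_))) (𝔼≤1 _ (f≤1 ∘ (outside ∷_))))))) ⟩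
      ((1ℚ - y) * (L * δ) + y * (L * δ)) + δ * ((1ℚ + L) + (1ℚ + L))
        ≡⟨ solve 3 (λ y l d → ((con 1ℚ :- y) :* (l :* d) :+ y :* (l :* d)) :+ d :* ((con 1ℚ :+ l) :+ (con 1ℚ :+ l))
             := (l :+ (con 1ℚ :+ con 1ℚ) :* (con 1ℚ :+ l)) :* d) refl y L δ ⟩
      lipschitz (suc N) * δ ∎
      where
      open ≤-Reasoning
      open Solver.+-*-Solver
      L = lipschitz N
      Ax = 𝔼 x V (f ∘ (outside ∷_))
      Ay = 𝔼 y V (f ∘ (outside ∷_))
      Bx = 𝔼 x V (f ∘ (inside ∷_))
      By = 𝔼 y V (f ∘ (inside ∷_))
      dA : abs (Ax - Ay) ≤ L * δ
      dA = 𝔼-lipschitz V (0≤f ∘ _) (f≤1 ∘ _)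
      dB : abs (Bx - By) ≤ L * δ
      dB = 𝔼-lipschitz V (0≤f ∘ _) (f≤1 ∘ _)
      0≤𝔼 : ∀ g → (∀ W → 0ℚ ≤ g W) → 0ℚ ≤ 𝔼 y V g
      0≤𝔼 g 0≤g = subst (_≤ 𝔼 y V g) (𝔼-const y V 0ℚ) (𝔼-mono 0≤y y≤1 V 0≤g)
      𝔼≤1 : ∀ g → (∀ W → g W ≤ 1ℚ) → 𝔼 y V g ≤ 1ℚ
      𝔼≤1 g g≤1 = subst (𝔼 y V g ≤_) (𝔼-const y V 1ℚ) (𝔼-mono 0≤y y≤1 V g≤1)
      size : ∀ {u w} → abs (u - w) ≤ L * δ → 0ℚ ≤ w → w ≤ 1ℚ → abs u ≤ 1ℚ + L
      size {u} {w} d 0≤w w≤1 = begin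
        abs u                ≡⟨ cong abs (solve 2 (λ u w → u := w :+ (u :- w)) refl u w) ⟩
        abs (w + (u - w))    ≤⟨ ∣p+q∣≤∣p∣+∣q∣ w (u - w) ⟩
        abs w + abs (u - w)  ≤⟨ +-mono-≤ (abs≤ 0≤w w≤1) (≤-trans d
                                  (subst (L * δ ≤_) (*-identityʳ L) (*-monoˡ (0≤lipschitz N) δ≤1))) ⟩
        1ℚ + L               ∎

    Pr-lipschitz : ∀ (V : Subset N) {E : Pred (Subset N) ℓ} (E? : Decidable E) →
      abs (Prℚ x V E? - Prℚ y V E?) ≤ lipschitz N * δ
    Pr-lipschitz {N} V E? = subst₂ (λ u w → abs (u - w) ≤ lipschitz N * δ) (sym (Pr-𝔼 x V E?)) (sym (Pr-𝔼 y V E?))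
      (𝔼-lipschitz V (λ W → 0≤𝟙 (E? W)) (λ W → 𝟙≤1 (E? W)))

-- Cardinalities and counting in finite sets

module Subsets where

  open import Data.Fin.Base using (Fin; zero; suc)
  import Data.Fin.Properties as Fin
  open import Data.Fin.Subset using (Subset; _∈_; _∉_; _⊆_; ∣_∣; _∩_; _∪_; _─_; inside; outside; ⁅_⁆)
  open import Data.Fin.Subset.Properties hiding (⊆-refl; ⊆-trans)
  open import Data.List.Base using (List; []; _∷_; map; filter; length; allFin)
  open import Data.List.Extrema.Nat using (xs≤max)
  import Data.List.Membership.Propositional as List
  import Data.List.Membership.Propositional.Properties as List
  open import Data.List.Properties using (length-map; filter-none; filter-all)
  open import Data.List.Relation.Unary.All as All using (All; []; _∷_)
  open import Data.List.Relation.Unary.Any using (here; there)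
  open import Data.Nat.Base
  open import Data.Nat.Properties
  open import Data.Product.Base using (∃-syntax; _×_; _,_; proj₁; proj₂)
  open import Data.Sum.Base using (_⊎_; inj₁; inj₂)
  open import Data.Unit.Base using (⊤; tt)
  open import Data.Vec.Base using ([]; _∷_; here; there)
  open import Function.Base using (_∘_)
  open import Level using (Level)
  open import Relation.Binary.PropositionalEquality hiding ([_])
  open import Relation.Nullary using (yes; no; ¬_; contradiction)
  open import Relation.Nullary.Decidable using (¬?; _×-dec_)
  open import Relation.Unary using (Pred; Decidable)

  private
    variable
      a ℓ : Level
      A B : Set a
      N : ℕ

  ∣∪∣ : ∀ (p q : Subset N) → ∣ p ∪ q ∣ ≡ ∣ p ∣ + ∣ q ─ p ∣
  ∣∪∣ []            []            = refl
  ∣∪∣ (inside ∷ p)  (inside ∷ q)  = cong suc (∣∪∣ p q)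
  ∣∪∣ (inside ∷ p)  (outside ∷ q) = cong suc (∣∪∣ p q)
  ∣∪∣ (outside ∷ p) (inside ∷ q)  = trans (cong suc (∣∪∣ p q)) (sym (+-suc ∣ p ∣ ∣ q ─ p ∣))
  ∣∪∣ (outside ∷ p) (outside ∷ q) = ∣∪∣ p q

  ∣─∣+∣∩∣ : ∀ (p q : Subset N) → ∣ p ─ q ∣ + ∣ p ∩ q ∣ ≡ ∣ p ∣
  ∣─∣+∣∩∣ []            []            = refl
  ∣─∣+∣∩∣ (inside ∷ p)  (inside ∷ q)  = trans (+-suc ∣ p ─ q ∣ ∣ p ∩ q ∣) (cong suc (∣─∣+∣∩∣ p q))
  ∣─∣+∣∩∣ (inside ∷ p)  (outside ∷ q) = cong suc (∣─∣+∣∩∣ p q)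
  ∣─∣+∣∩∣ (outside ∷ p) (inside ∷ q)  = ∣─∣+∣∩∣ p q
  ∣─∣+∣∩∣ (outside ∷ p) (outside ∷ q) = ∣─∣+∣∩∣ p q

  ∣p∣≥1⇒∃ : ∀ (p : Subset N) → 1 ≤ ∣ p ∣ → ∃[ x ] x ∈ p
  ∣p∣≥1⇒∃ (inside ∷ p)  _   = zero , here
  ∣p∣≥1⇒∃ (outside ∷ p) 1≤ with ∣p∣≥1⇒∃ p 1≤
  ... | x , x∈ = suc x , there x∈

  ∣p∣≥2⇒∃₂ : ∀ (p : Subset N) → 2 ≤ ∣ p ∣ → ∃[ x ] ∃[ y ] x ≢ y × x ∈ p × y ∈ p
  ∣p∣≥2⇒∃₂ (inside ∷ p)  (s≤s 1≤) with ∣p∣≥1⇒∃ p 1≤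
  ... | y , y∈ = zero , suc y , (λ ()) , here , there y∈
  ∣p∣≥2⇒∃₂ (outside ∷ p) 2≤ with ∣p∣≥2⇒∃₂ p 2≤
  ... | x , y , x≢y , x∈ , y∈ = suc x , suc y , x≢y ∘ Fin.suc-injective , there x∈ , there y∈

  another : ∀ (p : Subset N) x → 2 ≤ ∣ p ∣ → ∃[ y ] y ∈ p × x ≢ y
  another p x 2≤p with ∣p∣≥2⇒∃₂ p 2≤p
  ... | y , z , y≢z , y∈ , z∈ with x Fin.≟ y
  ...   | yes refl = z , z∈ , y≢z
  ...   | no x≢y   = y , y∈ , x≢y

  ∈─⇒∉ : ∀ {p q : Subset N} {x} → x ∈ p ─ q → x ∉ q
  ∈─⇒∉ {p = inside ∷ p}  {inside ∷ q} () here
  ∈─⇒∉ {p = outside ∷ p} {inside ∷ q} () here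
  ∈─⇒∉ {p = _ ∷ p} {_ ∷ q} (there x∈) (there x∈q) = ∈─⇒∉ x∈ x∈q

  ∈⇒1≤∣p∣ : ∀ {p : Subset N} {x} → x ∈ p → 1 ≤ ∣ p ∣
  ∈⇒1≤∣p∣ {p = p} {x} x∈p = subst (_≤ ∣ p ∣) (∣⁅x⁆∣≡1 x)
    (p⊆q⇒∣p∣≤∣q∣ λ z∈ → subst (_∈ p) (sym (x∈⁅y⁆⇒x≡y x z∈)) x∈p)

  ∣p∪⁅x⁆∣ : ∀ {p : Subset N} {x} → x ∉ p → ∣ p ∪ ⁅ x ⁆ ∣ ≡ suc ∣ p ∣
  ∣p∪⁅x⁆∣ {p = p} {x} x∉p = begin
    ∣ p ∪ ⁅ x ⁆ ∣          ≡⟨ ∣∪∣ p ⁅ x ⁆ ⟩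
    ∣ p ∣ + ∣ ⁅ x ⁆ ─ p ∣  ≡⟨ cong (∣ p ∣ +_) (≤-antisym
      (subst (∣ ⁅ x ⁆ ─ p ∣ ≤_) (∣⁅x⁆∣≡1 x) (∣p─q∣≤∣p∣ ⁅ x ⁆ p))
      (∈⇒1≤∣p∣ (x∈p∧x∉q⇒x∈p─q (x∈⁅x⁆ x) x∉p))) ⟩
    ∣ p ∣ + 1              ≡⟨ +-comm ∣ p ∣ 1 ⟩
    suc ∣ p ∣              ∎
    where open ≡-Reasoning

  ∪-least : ∀ {p q r : Subset N} → p ⊆ r → q ⊆ r → p ∪ q ⊆ r
  ∪-least {p = p} {q} p⊆r q⊆r x∈ with x∈p∪q⁻ p q x∈
  ... | inj₁ x∈p = p⊆r x∈p
  ... | inj₂ x∈q = q⊆r x∈q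

  ≢∈⇒2≤∣p∣ : ∀ {p : Subset N} {x y} → x ≢ y → x ∈ p → y ∈ p → 2 ≤ ∣ p ∣
  ≢∈⇒2≤∣p∣ {p = p} {x} {y} x≢y x∈p y∈p = begin
    2                     ≡⟨ cong suc (∣⁅x⁆∣≡1 x) ⟨
    suc ∣ ⁅ x ⁆ ∣         ≡⟨ ∣p∪⁅x⁆∣ (λ y∈ → x≢y (sym (x∈⁅y⁆⇒x≡y x y∈))) ⟨
    ∣ ⁅ x ⁆ ∪ ⁅ y ⁆ ∣     ≤⟨ p⊆q⇒∣p∣≤∣q∣ (∪-least
        (λ z∈ → subst (_∈ p) (sym (x∈⁅y⁆⇒x≡y x z∈)) x∈p)
        (λ z∈ → subst (_∈ p) (sym (x∈⁅y⁆⇒x≡y y z∈)) y∈p)) ⟩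
    ∣ p ∣                 ∎
    where open ≤-Reasoning

  ⊆∧∣∣≤⇒⊇ : ∀ {p q : Subset N} → p ⊆ q → ∣ q ∣ ≤ ∣ p ∣ → q ⊆ p
  ⊆∧∣∣≤⇒⊇ {p = p} p⊆q q≤p {x} x∈q with x ∈? p
  ... | yes x∈p = x∈p
  ... | no x∉p  = contradiction q≤p (<⇒≱ (p⊂q⇒∣p∣<∣q∣ (p⊆q , x , x∈q , x∉p)))

  elements : Subset N → List (Fin N)
  elements []            = []
  elements (inside ∷ p)  = zero ∷ map suc (elements p)
  elements (outside ∷ p) = map suc (elements p)

  length-elements : (p : Subset N) → length (elements p) ≡ ∣ p ∣
  length-elements []            = refl
  length-elements (inside ∷ p)  = cong suc (trans (length-map suc (elements p)) (length-elements p))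
  length-elements (outside ∷ p) = trans (length-map suc (elements p)) (length-elements p)

  ∈-elements⁺ : ∀ {p : Subset N} {x} → x ∈ p → x List.∈ elements p
  ∈-elements⁺ {p = inside ∷ p}  here       = here refl
  ∈-elements⁺ {p = inside ∷ p}  (there x∈) = there (List.∈-map⁺ suc (∈-elements⁺ x∈))
  ∈-elements⁺ {p = outside ∷ p} (there x∈) = List.∈-map⁺ suc (∈-elements⁺ x∈)

  ∈-elements⁻ : ∀ (p : Subset N) {x} → x List.∈ elements p → x ∈ p
  ∈-elements⁻ (inside ∷ p)  (here refl) = here
  ∈-elements⁻ (inside ∷ p)  (there x∈) with List.∈-map⁻ suc x∈
  ... | y , y∈ , refl = there (∈-elements⁻ p y∈)
  ∈-elements⁻ (outside ∷ p) x∈ with List.∈-map⁻ suc x∈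
  ... | y , y∈ , refl = there (∈-elements⁻ p y∈)

  count-split : {P Q R : Pred A ℓ} (P? : Decidable P) (Q? : Decidable Q) (R? : Decidable R) →
    ∀ xs → (∀ {x} → x List.∈ xs → P x → Q x ⊎ R x) →
    length (filter P? xs) ≤ length (filter Q? xs) + length (filter R? xs)
  count-split P? Q? R? []       split = z≤n
  count-split P? Q? R? (x ∷ xs) split with P? x | Q? x | R? x | count-split P? Q? R? xs (split ∘ there)
  ... | no _  | yes _ | yes _ | ih = m≤n⇒m≤1+n (≤-trans ih (+-monoʳ-≤ (length (filter Q? xs)) (n≤1+n _)))
  ... | no _  | yes _ | no _  | ih = m≤n⇒m≤1+n ih
  ... | no _  | no _  | yes _ | ih = ≤-trans ih (+-monoʳ-≤ (length (filter Q? xs)) (n≤1+n _))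
  ... | no _  | no _  | no _  | ih = ih
  ... | yes _ | yes _ | yes _ | ih = s≤s (≤-trans ih (+-monoʳ-≤ (length (filter Q? xs)) (n≤1+n _)))
  ... | yes _ | yes _ | no _  | ih = s≤s ih
  ... | yes _ | no _  | yes _ | ih = subst (suc (length (filter P? xs)) ≤_) (sym (+-suc _ _)) (s≤s ih)
  ... | yes p | no ¬q | no ¬r | ih with split (here refl) p
  ...   | inj₁ q = contradiction q ¬q
  ...   | inj₂ r = contradiction r ¬r

  count-none : {P : Pred A ℓ} (P? : Decidable P) → ∀ xs → (∀ {x} → x List.∈ xs → ¬ P x) → ∀ {c} →
    length (filter P? xs) ≤ c
  count-none P? xs none = subst (_≤ _) (sym (cong length (filter-none P? {xs = xs} (All.tabulate none)))) z≤n

  -- Classes may overlap: what the class of `y` covers is removed before the remaining classes are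
  -- considered.
  count-union : {P : Pred A ℓ} (P? : Decidable P) {Q : B → Pred A ℓ} (Q? : ∀ y → Decidable (Q y)) →
    ∀ ys c xs → (∀ {x} → x List.∈ xs → P x → ∃[ y ] y List.∈ ys × Q y x) →
    (∀ y → length (filter (Q? y) xs) ≤ c) → length (filter P? xs) ≤ length ys * c
  count-union P? Q? []       c xs cover bound = count-none P? xs λ x∈ p → ∉[] (proj₁ (proj₂ (cover x∈ p)))
    where
    ∉[] : ∀ {y} → ¬ (y List.∈ [])
    ∉[] ()
  count-union {P = P} P? {Q} Q? (y ∷ ys) c xs cover bound = ≤-trans
    (count-split P? (Q? y) (λ x → P? x ×-dec ¬? (Q? y x)) xs (λ _ → split))
    (+-mono-≤ (bound y) (count-union (λ x → P? x ×-dec ¬? (Q? y x)) Q? ys c xs cover′ bound))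
    where
    split : ∀ {x} → P x → Q y x ⊎ (P x × ¬ Q y x)
    split {x} p with Q? y x
    ... | yes q = inj₁ q
    ... | no ¬q = inj₂ (p , ¬q)
    cover′ : ∀ {x} → x List.∈ xs → P x × ¬ Q y x → ∃[ z ] z List.∈ ys × Q z x
    cover′ x∈ (p , ¬q) with cover x∈ p
    ... | z , here refl , q = contradiction q ¬q
    ... | z , there z∈  , q = z , z∈ , q

  count-mono : {P Q : Pred A ℓ} (P? : Decidable P) (Q? : Decidable Q) → (∀ {x} → P x → Q x) →
    ∀ xs → length (filter P? xs) ≤ length (filter Q? xs)
  count-mono P? Q? P⇒Q xs = subst (length (filter P? xs) ≤_)
    (trans (cong (length (filter Q? xs) +_) (cong length (filter-none (λ x → P? x ×-dec ¬? (P? x)) {xs = xs}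
      (All.tabulate λ _ (p , ¬p) → ¬p p)))) (+-identityʳ _))
    (count-split P? Q? (λ x → P? x ×-dec ¬? (P? x)) xs (λ _ p → inj₁ (P⇒Q p)))

  -- Degree counts from the codegree bound

  module _ (H : Hypergraph N) where

    -- `Δ₂` ranges over pairs of vertices of H only; a pair with a member outside the vertex set
    -- lies in no edge.
    codegree≤Δ₂ : ∀ {x y} → x ≢ y → codegree H x y ≤ Δ₂ H
    codegree≤Δ₂ {x} {y} x≢y with x ∈? vertices H | y ∈? vertices H
    ... | yes x∈V | yes y∈V = All.lookup (xs≤max 0 _) (List.∈-map⁺ _
      (List.∈-filter⁺ _ (List.∈-cartesianProduct⁺ (vertex x∈V) (vertex y∈V)) x≢y))
      where
      vertex : ∀ {z} → z ∈ vertices H → z List.∈ filter (_∈? vertices H) (allFin N)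
      vertex {z} = List.∈-filter⁺ (_∈? vertices H) (List.∈-allFin z)
    ... | no x∉V | _ = count-none (λ e → x ∈? e ×-dec y ∈? e) (edges H)
      λ e∈ (x∈e , _) → x∉V (All.lookup (edges⊆ H) e∈ x∈e)
    ... | yes _ | no y∉V = count-none (λ e → x ∈? e ×-dec y ∈? e) (edges H)
      λ e∈ (_ , y∈e) → y∉V (All.lookup (edges⊆ H) e∈ y∈e)

    private
      -- Distinctness belongs to the predicate so that the bound `D` is uniform in x and y: for x ≡
      -- y there is nothing to count.
      pair? : ∀ (x y : Fin N) → Decidable (λ (e : Subset N) → x ≢ y × x ∈ e × y ∈ e)
      pair? x y e = ¬? (x Fin.≟ y) ×-dec (x ∈? e ×-dec y ∈? e)

      pair≤ : ∀ {D} → Δ₂ H ≤ D → ∀ x y → length (filter (pair? x y) (edges H)) ≤ D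
      pair≤ {D} Δ≤D x y with x Fin.≟ y
      ... | yes x≡y = count-none (λ e → no (λ h → h x≡y) ×-dec (x ∈? e ×-dec y ∈? e)) (edges H) λ _ (x≢y , _) → x≢y x≡y
      ... | no x≢y  = ≤-trans (count-mono (λ e → yes x≢y ×-dec (x ∈? e ×-dec y ∈? e)) (λ e → x ∈? e ×-dec y ∈? e) proj₂ (edges H))
        (≤-trans (codegree≤Δ₂ x≢y) Δ≤D)

    -- Each edge at x contains another vertex, which leaves at most `∣V∣ H` choices for it and `D`
    -- edges through both.
    degree≤ : ∀ {D s} → Δ₂ H ≤ D → Uniform s H → 2 ≤ s → ∀ x →
      length (filter (x ∈?_) (edges H)) ≤ ∣V∣ H * D
    degree≤ {D} {s} Δ≤D uni 2≤s x =
      subst (λ v → length (filter (x ∈?_) (edges H)) ≤ v * D) (length-elements (vertices H))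
        (count-union (x ∈?_) (pair? x) (elements (vertices H)) D (edges H)
          (λ {e} e∈ x∈e → let y , y∈e , x≢y = another e x (subst (2 ≤_) (sym (All.lookup uni e∈)) 2≤s)
                          in y , ∈-elements⁺ (All.lookup (edges⊆ H) e∈ y∈e) , x≢y , x∈e , y∈e)
          (pair≤ Δ≤D x))

    -- Two vertices of e ∩ U determine e up to `D` choices. This is what makes closers rare: the
    -- bound on their number depends on the size of U and not on v.
    meeting≤ : ∀ {D} → Δ₂ H ≤ D → ∀ U {P : Pred (Subset N) _} (P? : Decidable P) →
      (∀ {e} → e List.∈ edges H → P e → 2 ≤ ∣ e ∩ U ∣) →
      length (filter P? (edges H)) ≤ ∣ U ∣ * (∣ U ∣ * D)
    meeting≤ {D} Δ≤D U {P} P? two = subst (λ u → length (filter P? (edges H)) ≤ u * (u * D)) (length-elements U)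
      (count-union P? through? (elements U) (length (elements U) * D) (edges H)
        (λ {e} e∈ p → let x , y , x≢y , x∈ , y∈ = ∣p∣≥2⇒∃₂ (e ∩ U) (two e∈ p)
                          x∈e , x∈U = x∈p∩q⁻ e U x∈
                      in x , ∈-elements⁺ x∈U , two e∈ p , x∈e)
        λ x → count-union (through? x) (pair? x) (elements U) D (edges H)
          (λ {e} _ (2≤ , x∈e) → let y , y∈ , x≢y = another (e ∩ U) x 2≤
                                    y∈e , y∈U = x∈p∩q⁻ e U y∈
                                in y , ∈-elements⁺ y∈U , x≢y , x∈e , y∈e)
          (pair≤ Δ≤D x))
      where
      through? : ∀ (x : Fin N) → Decidable (λ (e : Subset N) → 2 ≤ ∣ e ∩ U ∣ × x ∈ e)
      through? x e = (2 ≤? ∣ e ∩ U ∣) ×-dec (x ∈? e)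

    -- `meeting≤` with U the whole vertex set.
    ∣edges∣≤ : ∀ {D s} → Δ₂ H ≤ D → Uniform s H → 2 ≤ s → length (edges H) ≤ ∣V∣ H * (∣V∣ H * D)
    ∣edges∣≤ {D} {s} Δ≤D uni 2≤s = subst (λ es → length es ≤ ∣V∣ H * (∣V∣ H * D))
      (filter-all all? {xs = edges H} (All.tabulate λ _ → tt))
      (meeting≤ Δ≤D (vertices H) all? λ e∈ _ → ≤-trans 2≤s (subst (_≤ _) (All.lookup uni e∈)
        (p⊆q⇒∣p∣≤∣q∣ λ x∈ → x∈p∩q⁺ (x∈ , All.lookup (edges⊆ H) e∈ x∈))))
      where
      all? : Decidable (λ (_ : Subset N) → ⊤)
      all? _ = yes tt

-- Enumeration of explorations

module Exploring where

  open Rationals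
  open Subsets
  open import Data.Fin.Base using (Fin)
  open import Data.Fin.Subset using (Subset; _∈_; ∣_∣; _∩_; _∪_; _─_)
  open import Data.Fin.Subset.Properties using (_∈?_)
  open import Data.List.Base using (List; []; _∷_; _++_; filter; length; concatMap)
  import Data.List.Membership.Propositional as List
  import Data.List.Membership.Propositional.Properties as List
  open import Data.List.Properties using (length-++)
  open import Data.List.Relation.Unary.All as All using (All)
  open import Data.Nat.Base as ℕ using (ℕ; zero; suc; _∸_)
  import Data.Nat.Properties as ℕ
  import Data.Nat.Solver as ℕ
  open import Data.Product.Base using (_×_; _,_; proj₁; proj₂)
  open import Data.Rational.Base renaming (∣_∣ to abs)
  open import Data.Rational.Properties
  import Data.Rational.Solver as Solver
  open import Data.Sum.Base using (_⊎_; inj₁; inj₂)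
  open import Function.Base using (_∘_)
  open import Relation.Binary.PropositionalEquality hiding ([_])
  open import Relation.Nullary using (Dec; yes; no; does; ¬_)
  open import Relation.Nullary.Decidable using (_×-dec_; _⊎-dec_)
  open import Relation.Unary using (Decidable)
  open import Data.Bool.Base using (if_then_else_)

  private
    variable
      N : ℕ

  module Exploration (E : List (Subset N)) (s M : ℕ) where

    Explorer : Set
    Explorer = (U : Subset N) (queue : List (Fin N)) (t g : ℕ) → List (Subset N)

    Success : (t g : ℕ) → Set
    Success t g = M ℕ.≤ t ⊎ s ℕ.≤ suc g

    success? : ∀ t g → Dec (Success t g)
    success? t g = (M ℕ.≤? t) ⊎-dec (s ℕ.≤? suc g)

    -- For x ∈ U and an edge f of size s, the equation says that f meets U in x alone.
    Tree : Subset N → Fin N → Subset N → Set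
    Tree U x f = x ∈ f × s ≡ suc ∣ f ─ U ∣

    Closer : Subset N → Subset N → Set
    Closer U f = 2 ℕ.≤ ∣ f ∩ U ∣ × 1 ℕ.≤ ∣ f ─ U ∣

    tree? : ∀ U x → Decidable (Tree U x)
    tree? U x f = x ∈? f ×-dec (s ℕ.≟ suc ∣ f ─ U ∣)

    closer? : ∀ U → Decidable (Closer U)
    closer? U f = (2 ℕ.≤? ∣ f ∩ U ∣) ×-dec (1 ℕ.≤? ∣ f ─ U ∣)

    -- All three continuations are offered at every stage; the precedence of closers is imposed only
    -- on the branch that is followed later. A tree step keeps x at the head of the queue, since
    -- several edges may be grown from it.
    pop treeStep closerStep : Explorer → Explorer
    pop r U []      t g = []
    pop r U (_ ∷ q) t g = r U q t g
    treeStep r U []        t g = []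
    treeStep r U q@(x ∷ _) t g =
      concatMap (λ f → r (U ∪ f) (q ++ elements (f ─ U)) (suc t) g) (filter (tree? U x) E)
    closerStep r U q t g =
      concatMap (λ f → r (U ∪ f) (q ++ elements (f ─ U)) t (g ℕ.+ ∣ f ─ U ∣)) (filter (closer? U) E)

    -- All outcomes, within the given number of moves, of an exploration that has
    -- discovered U by t tree steps and a gain of g, with queue still to be processed.
    explore : ℕ → Explorer
    explore zero    U q t g = []
    explore (suc k) U q t g = if does (success? t g) then U ∷ []
      else pop (explore k) U q t g ++ (treeStep (explore k) U q t g ++ closerStep (explore k) U q t g)

    starts : ℕ → List (Subset N)
    starts k = concatMap (λ e → explore k e (elements e) 0 0) E

  -- Potential bound for the expected number of outcomes

  module Weight (H : Hypergraph N) (s-2 M D : ℕ) (uniform : Uniform (suc (suc s-2)) H) (Δ≤D : Δ₂ H ℕ.≤ D)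
    (p ρ θ : ℚ) (0≤p : 0ℚ ≤ p) (0≤θ : 0ℚ ≤ θ) (p≤ρ : p ≤ ρ) where

    private
      s-1 s B v : ℕ
      s-1 = suc s-2
      s = suc s-1
      B = s ℕ.+ s-1 ℕ.* M ℕ.+ s-1
      v = ∣V∣ H
      3ℚ : ℚ
      3ℚ = ι 3

    open Exploration (edges H) s M

    -- The two rates give a tree step and a closer, summed over all choices of the edge, a third of
    -- the potential each; `3ρ≤1` disposes of the further vertices of a closer. The last two
    -- conditions make `θ` large enough for either kind of success.
    module _ (tree-rate : ι (v ℕ.* D) * (ι 8 * p ^ s-1 * 3ℚ ^ s) ≤ 1ℚ)
             (closer-rate : ι (B ℕ.* (B ℕ.* D)) * (3ℚ * (3ℚ * ρ)) ≤ 1ℚ)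
             (3ρ≤1 : 3ℚ * ρ ≤ 1ℚ)
             (many-steps : 1ℚ ≤ θ * ι 8 ^ M)
             (high-gain : p ^ s-1 ≤ θ * ρ ^ s-1) where

      private
        wt : Subset N → ℚ
        wt S = p ^ ∣ S ∣

        0≤ρ : 0ℚ ≤ ρ
        0≤ρ = ≤-trans 0≤p p≤ρ

        0≤3 : 0ℚ ≤ 3ℚ
        0≤3 = 0≤ι 3

        -- A new vertex costs p if it comes from a tree step, but only ρ if it comes from a
        -- closer; a tree step is rewarded by 8, and each vertex in the queue by 3.
        Φ : ℕ → ℕ → ℕ → ℚ
        Φ ℓ t g = θ * (p ^ s * (ι 8 * p ^ s-1) ^ t * ρ ^ g * 3ℚ ^ ℓ)

        0≤Φ : ∀ ℓ t g → 0ℚ ≤ Φ ℓ t g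
        0≤Φ ℓ t g = 0≤* 0≤θ (0≤* (0≤* (0≤* (0≤^ s 0≤p) (0≤^ t (0≤* (0≤ι 8) (0≤^ s-1 0≤p)))) (0≤^ g 0≤ρ)) (0≤^ ℓ 0≤3))

        1≤ι : ∀ n → 1ℚ ≤ ι (suc n)
        1≤ι n = subst (_≤ ι (suc n)) (+-identityʳ 1ℚ) (+-monoʳ-≤ 1ℚ (0≤ι n))

        1≤^ : ∀ {x} n → 1ℚ ≤ x → 1ℚ ≤ x ^ n
        1≤^ {x} n 1≤x = subst (_≤ x ^ n) (1^ n) (^-mono-≤ n 0≤1 1≤x)

        ^-monoʳ : ∀ {x m n} → 1ℚ ≤ x → m ℕ.≤ n → x ^ m ≤ x ^ n
        ^-monoʳ {n = n} 1≤x ℕ.z≤n     = 1≤^ n 1≤x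
        ^-monoʳ         1≤x (ℕ.s≤s m≤n) = *-monoˡ (≤-trans 0≤1 1≤x) (^-monoʳ 1≤x m≤n)

        -- Success has to earn the small factor θ, even though gained vertices are priced at ρ
        -- instead of p. With t ≥ M the reward 8^t makes up for θ; with g ≥ s - 1 the first s - 1
        -- gained vertices do, through `high-gain`.
        p^g≤ : ∀ t g → Success t g → p ^ g ≤ (θ * ι 8 ^ t) * ρ ^ g
        p^g≤ t g (inj₁ M≤t) = begin
          p ^ g                   ≡⟨ *-identityˡ (p ^ g) ⟨
          1ℚ * p ^ g              ≤⟨ *-mono-≤ 0≤1 (≤-trans many-steps (*-monoˡ 0≤θ (^-monoʳ (1≤ι 7) M≤t)))
                                       (0≤^ g 0≤p) (^-mono-≤ g 0≤p p≤ρ) ⟩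
          (θ * ι 8 ^ t) * ρ ^ g   ∎
          where open ≤-Reasoning
        p^g≤ t g (inj₂ (ℕ.s≤s s-1≤g)) = begin
          p ^ g                                  ≡⟨ cong (p ^_) (ℕ.m+[n∸m]≡n s-1≤g) ⟨
          p ^ (s-1 ℕ.+ (g ∸ s-1))                ≡⟨ ^-homo-* p s-1 (g ∸ s-1) ⟩
          p ^ s-1 * p ^ (g ∸ s-1)                ≤⟨ *-mono-≤ (0≤^ s-1 0≤p) high-gain (0≤^ (g ∸ s-1) 0≤p)
                                                      (^-mono-≤ (g ∸ s-1) 0≤p p≤ρ) ⟩
          (θ * ρ ^ s-1) * ρ ^ (g ∸ s-1)          ≡⟨ *-assoc θ (ρ ^ s-1) _ ⟩
          θ * (ρ ^ s-1 * ρ ^ (g ∸ s-1))          ≡⟨ cong (θ *_) (^-homo-* ρ s-1 (g ∸ s-1)) ⟨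
          θ * ρ ^ (s-1 ℕ.+ (g ∸ s-1))            ≡⟨ cong (λ n → θ * ρ ^ n) (ℕ.m+[n∸m]≡n s-1≤g) ⟩
          θ * ρ ^ g                              ≡⟨ cong (_* ρ ^ g) (*-identityʳ θ) ⟨
          θ * 1ℚ * ρ ^ g                         ≤⟨ *-monoʳ (0≤^ g 0≤ρ) (*-monoˡ 0≤θ (1≤^ t (1≤ι 7))) ⟩
          (θ * ι 8 ^ t) * ρ ^ g                  ∎
          where open ≤-Reasoning

        one-more : ∀ t g → s ℕ.+ s-1 ℕ.* t ℕ.+ g ℕ.+ s-1 ≡ s ℕ.+ s-1 ℕ.* suc t ℕ.+ g
        one-more = solve 4 (λ s k t g → s :+ k :* t :+ g :+ k := s :+ k :* (con 1 :+ t) :+ g) refl s s-1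
          where open ℕ.+-*-Solver

        success-≤ : ∀ (U : Subset N) ℓ t g → ∣ U ∣ ≡ s ℕ.+ s-1 ℕ.* t ℕ.+ g → Success t g → p ^ ∣ U ∣ ≤ Φ ℓ t g
        success-≤ U ℓ t g ∣U∣ ok = begin
          p ^ ∣ U ∣                              ≡⟨ cong (p ^_) ∣U∣ ⟩
          p ^ (s ℕ.+ s-1 ℕ.* t ℕ.+ g)            ≡⟨ ^-homo-* p (s ℕ.+ s-1 ℕ.* t) g ⟩
          p ^ (s ℕ.+ s-1 ℕ.* t) * p ^ g          ≡⟨ cong (_* p ^ g) (^-homo-* p s (s-1 ℕ.* t)) ⟩
          p ^ s * p ^ (s-1 ℕ.* t) * p ^ g        ≡⟨ cong (λ x → p ^ s * x * p ^ g) (^-assocʳ p s-1 t) ⟨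
          p ^ s * (p ^ s-1) ^ t * p ^ g
            ≤⟨ *-monoˡ (0≤* (0≤^ s 0≤p) (0≤^ t (0≤^ s-1 0≤p))) (p^g≤ t g ok) ⟩
          p ^ s * (p ^ s-1) ^ t * ((θ * ι 8 ^ t) * ρ ^ g)
            ≡⟨ solve 5 (λ a b h e r → a :* b :* ((h :* e) :* r) := h :* (a :* (e :* b) :* r :* con 1ℚ)) refl
                 (p ^ s) ((p ^ s-1) ^ t) θ (ι 8 ^ t) (ρ ^ g) ⟩
          θ * (p ^ s * (ι 8 ^ t * (p ^ s-1) ^ t) * ρ ^ g * 1ℚ)
            ≡⟨ cong (λ x → θ * (p ^ s * x * ρ ^ g * 1ℚ)) (^-distrib-* (ι 8) (p ^ s-1) t) ⟨
          θ * (p ^ s * (ι 8 * p ^ s-1) ^ t * ρ ^ g * 1ℚ)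
            ≤⟨ *-monoˡ 0≤θ (*-monoˡ (0≤* (0≤* (0≤^ s 0≤p) (0≤^ t (0≤* (0≤ι 8) (0≤^ s-1 0≤p)))) (0≤^ g 0≤ρ))
                 (1≤^ ℓ (1≤ι 2))) ⟩
          Φ ℓ t g ∎
          where
          open ≤-Reasoning
          open Solver.+-*-Solver

        Bounded : Explorer → Set
        Bounded r = ∀ U q t g → ∣ U ∣ ≡ s ℕ.+ s-1 ℕ.* t ℕ.+ g → ∑ wt (r U q t g) ≤ Φ (length q) t g

        length-queue : ∀ q (f U : Subset N) → length (q ++ elements (f ─ U)) ≡ length q ℕ.+ ∣ f ─ U ∣
        length-queue q f U = trans (length-++ q) (cong (length q ℕ.+_) (length-elements (f ─ U)))

        -- One queued vertex less divides the potential by 3, which is exactly the third allotted to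
        -- this continuation.
        pop-≤ : ∀ r → Bounded r → ∀ U q t g → ∣ U ∣ ≡ s ℕ.+ s-1 ℕ.* t ℕ.+ g →
          3ℚ * ∑ wt (pop r U q t g) ≤ Φ (length q) t g
        pop-≤ r bd U []      t g ∣U∣ = subst (_≤ Φ 0 t g) (sym (*-zeroʳ 3ℚ)) (0≤Φ 0 t g)
        pop-≤ r bd U (_ ∷ q) t g ∣U∣ = ≤-trans (*-monoˡ 0≤3 (bd U q t g ∣U∣)) (≤-reflexive
          (solve 4 (λ c h a b → c :* (h :* (a :* b)) := h :* (a :* (c :* b))) refl
            3ℚ θ (p ^ s * (ι 8 * p ^ s-1) ^ t * ρ ^ g) (3ℚ ^ length q)))
          where open Solver.+-*-Solver

        share : ∀ n b X → 0ℚ ≤ X → ι n * (3ℚ * b) ≤ 1ℚ → 3ℚ * (ι n * (b * X)) ≤ X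
        share n b X 0≤X h = subst (_≤ X)
          (solve 4 (λ c m b X → m :* (c :* b) :* X := c :* (m :* (b :* X))) refl 3ℚ (ι n) b X)
          (*-≤ˡ 0≤X h)
          where open Solver.+-*-Solver

        -- An edge multiplies the potential by 8 p^(s-1) for the step and by 3^(s-1) for the
        -- vertices that join the queue; `degree≤` bounds the number of edges at x.
        treeStep-≤ : ∀ r → Bounded r → ∀ U q t g → ∣ U ∣ ≡ s ℕ.+ s-1 ℕ.* t ℕ.+ g →
          3ℚ * ∑ wt (treeStep r U q t g) ≤ Φ (length q) t g
        treeStep-≤ r bd U []        t g ∣U∣ = subst (_≤ Φ 0 t g) (sym (*-zeroʳ 3ℚ)) (0≤Φ 0 t g)
        treeStep-≤ r bd U q@(x ∷ _) t g ∣U∣ = begin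
          3ℚ * ∑ wt (concatMap h fs)
            ≤⟨ *-monoˡ 0≤3 (∑-concatMap-≤ wt h (b * X) fs child) ⟩
          3ℚ * (ι (length fs) * (b * X))
            ≤⟨ *-monoˡ 0≤3 (*-monoʳ (0≤* 0≤b (0≤Φ (length q) t g)) (ι-mono few)) ⟩
          3ℚ * (ι (v ℕ.* D) * (b * X))
            ≤⟨ share (v ℕ.* D) b X (0≤Φ (length q) t g) (≤-trans (≤-reflexive (cong (ι (v ℕ.* D) *_)
                 (solve 3 (λ c a d → c :* (a :* d) := a :* (c :* d)) refl 3ℚ (ι 8 * p ^ s-1) (3ℚ ^ s-1)))) tree-rate) ⟩
          X ∎
          where
          open ≤-Reasoning
          open Solver.+-*-Solver
          X b : ℚ
          X = Φ (length q) t g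
          b = ι 8 * p ^ s-1 * 3ℚ ^ s-1
          0≤b : 0ℚ ≤ b
          0≤b = 0≤* (0≤* (0≤ι 8) (0≤^ s-1 0≤p)) (0≤^ s-1 0≤3)
          h : Subset N → List (Subset N)
          h f = r (U ∪ f) (q ++ elements (f ─ U)) (suc t) g
          fs = filter (tree? U x) (edges H)
          few : length fs ℕ.≤ v ℕ.* D
          few = ℕ.≤-trans (count-mono (tree? U x) (x ∈?_) proj₁ (edges H))
            (degree≤ H Δ≤D uniform (ℕ.s≤s (ℕ.s≤s ℕ.z≤n)) x)
          child : ∀ {f} → f List.∈ fs → ∑ wt (h f) ≤ b * X
          child {f} f∈ = begin
            ∑ wt (h f)
              ≤⟨ bd (U ∪ f) (q ++ elements (f ─ U)) (suc t) g
                   (trans (∣∪∣ U f) (trans (cong₂ ℕ._+_ ∣U∣ new)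
                     (one-more t g))) ⟩
            Φ (length (q ++ elements (f ─ U))) (suc t) g
              ≡⟨ cong (λ ℓ → Φ ℓ (suc t) g) (trans (length-queue q f U) (cong (length q ℕ.+_) new)) ⟩
            θ * (p ^ s * (ι 8 * p ^ s-1) ^ suc t * ρ ^ g * 3ℚ ^ (length q ℕ.+ s-1))
              ≡⟨ cong (λ x → θ * (p ^ s * (ι 8 * p ^ s-1) ^ suc t * ρ ^ g * x)) (^-homo-* 3ℚ (length q) s-1) ⟩
            θ * (p ^ s * (ι 8 * p ^ s-1) ^ suc t * ρ ^ g * (3ℚ ^ length q * 3ℚ ^ s-1))
              ≡⟨ solve 7 (λ h a k b c d e → h :* (a :* (k :* b) :* c :* (d :* e)) := (k :* e) :* (h :* (a :* b :* c :* d))) refl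
                   θ (p ^ s) (ι 8 * p ^ s-1) ((ι 8 * p ^ s-1) ^ t) (ρ ^ g) (3ℚ ^ length q) (3ℚ ^ s-1) ⟩
            b * X ∎
            where
            new : ∣ f ─ U ∣ ≡ s-1
            new = sym (ℕ.suc-injective (proj₂ (proj₂ (List.∈-filter⁻ (tree? U x) {xs = edges H} f∈))))

        -- Failure bounds the size of U by `B`, and hence the number of closers. One with γ new
        -- vertices multiplies the potential by (3 ρ)^γ, at most 3 ρ since γ is positive.
        closerStep-≤ : ∀ r → Bounded r → ∀ U q t g → ∣ U ∣ ≡ s ℕ.+ s-1 ℕ.* t ℕ.+ g → ¬ Success t g →
          3ℚ * ∑ wt (closerStep r U q t g) ≤ Φ (length q) t g
        closerStep-≤ r bd U q t g ∣U∣ fail = begin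
          3ℚ * ∑ wt (concatMap h fs)
            ≤⟨ *-monoˡ 0≤3 (∑-concatMap-≤ wt h (3ℚ * ρ * X) fs child) ⟩
          3ℚ * (ι (length fs) * (3ℚ * ρ * X))
            ≤⟨ *-monoˡ 0≤3 (*-monoʳ (0≤* (0≤* 0≤3 0≤ρ) (0≤Φ (length q) t g)) (ι-mono few)) ⟩
          3ℚ * (ι (B ℕ.* (B ℕ.* D)) * (3ℚ * ρ * X))
            ≤⟨ share (B ℕ.* (B ℕ.* D)) (3ℚ * ρ) X (0≤Φ (length q) t g) closer-rate ⟩
          X ∎
          where
          open ≤-Reasoning
          X : ℚ
          X = Φ (length q) t g
          h : Subset N → List (Subset N)
          h f = r (U ∪ f) (q ++ elements (f ─ U)) t (g ℕ.+ ∣ f ─ U ∣)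
          fs = filter (closer? U) (edges H)
          ∣U∣≤B : ∣ U ∣ ℕ.≤ B
          ∣U∣≤B = subst (ℕ._≤ B) (sym ∣U∣) (ℕ.+-mono-≤
            (ℕ.+-monoʳ-≤ s (ℕ.*-monoʳ-≤ s-1 (ℕ.<⇒≤ (ℕ.≰⇒> (fail ∘ inj₁)))))
            (ℕ.<⇒≤ (ℕ.s≤s⁻¹ (ℕ.≰⇒> (fail ∘ inj₂)))))
          few : length fs ℕ.≤ B ℕ.* (B ℕ.* D)
          few = ℕ.≤-trans (meeting≤ H Δ≤D U (closer? U) λ _ → proj₁)
            (ℕ.*-mono-≤ ∣U∣≤B (ℕ.*-monoˡ-≤ D ∣U∣≤B))
          child : ∀ {f} → f List.∈ fs → ∑ wt (h f) ≤ 3ℚ * ρ * X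
          child {f} f∈ with ∣ f ─ U ∣ in new | proj₂ (proj₂ f-closer)
            where f-closer = List.∈-filter⁻ (closer? U) {xs = edges H} f∈
          ... | zero  | ()
          ... | suc γ | _ = begin
            ∑ wt (r (U ∪ f) (q ++ elements (f ─ U)) t (g ℕ.+ suc γ))
              ≤⟨ bd (U ∪ f) (q ++ elements (f ─ U)) t (g ℕ.+ suc γ)
                   (trans (∣∪∣ U f) (trans (cong₂ ℕ._+_ ∣U∣ new) (ℕ.+-assoc (s ℕ.+ s-1 ℕ.* t) g (suc γ)))) ⟩
            Φ (length (q ++ elements (f ─ U))) t (g ℕ.+ suc γ)
              ≡⟨ cong (λ ℓ → Φ ℓ t (g ℕ.+ suc γ)) (trans (length-queue q f U) (cong (length q ℕ.+_) new)) ⟩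
            θ * (P * ρ ^ (g ℕ.+ suc γ) * 3ℚ ^ (length q ℕ.+ suc γ))
              ≡⟨ cong₂ (λ x y → θ * (P * x * y)) (^-homo-* ρ g (suc γ)) (^-homo-* 3ℚ (length q) (suc γ)) ⟩
            θ * (P * (ρ ^ g * (ρ * ρ ^ γ)) * (3ℚ ^ length q * (3ℚ * 3ℚ ^ γ)))
              ≡⟨ solve 8 (λ h a b r r′ d e e′ → h :* (a :* (b :* (r :* r′)) :* (d :* (e :* e′)))
                   := (e′ :* r′) :* (e :* r :* (h :* (a :* b :* d)))) refl
                   θ P (ρ ^ g) ρ (ρ ^ γ) (3ℚ ^ length q) 3ℚ (3ℚ ^ γ) ⟩
            (3ℚ ^ γ * ρ ^ γ) * (3ℚ * ρ * X)
              ≡⟨ cong (_* (3ℚ * ρ * X)) (^-distrib-* 3ℚ ρ γ) ⟨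
            (3ℚ * ρ) ^ γ * (3ℚ * ρ * X)
              ≤⟨ *-≤ˡ (0≤* (0≤* 0≤3 0≤ρ) (0≤Φ (length q) t g)) (^-≤1 γ (0≤* 0≤3 0≤ρ) 3ρ≤1) ⟩
            3ℚ * ρ * X ∎
            where
            open Solver.+-*-Solver
            P : ℚ
            P = p ^ s * (ι 8 * p ^ s-1) ^ t

        third : ∀ x y z {X} → 3ℚ * x ≤ X → 3ℚ * y ≤ X → 3ℚ * z ≤ X → x + (y + z) ≤ X
        third x y z {X} hx hy hz = *-cancelˡ-≤-pos 3ℚ (begin
          3ℚ * (x + (y + z))
            ≡⟨ solve 4 (λ c x y z → c :* (x :+ (y :+ z)) := c :* x :+ (c :* y :+ c :* z)) refl 3ℚ x y z ⟩
          3ℚ * x + (3ℚ * y + 3ℚ * z)     ≤⟨ +-mono-≤ hx (+-mono-≤ hy hz) ⟩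
          X + (X + X)
            ≡⟨ solve 1 (λ X → X :+ (X :+ X) := (con 1ℚ :+ (con 1ℚ :+ (con 1ℚ :+ con 0ℚ))) :* X) refl X ⟩
          3ℚ * X                         ∎)
          where
          open ≤-Reasoning
          open Solver.+-*-Solver

      explore-≤ : ∀ k → Bounded (explore k)
      explore-≤ zero    U q t g ∣U∣ = 0≤Φ (length q) t g
      explore-≤ (suc k) U q t g ∣U∣ = outcome (success? t g)
        where
        continued : List (Subset N)
        continued = pop (explore k) U q t g ++ (treeStep (explore k) U q t g ++ closerStep (explore k) U q t g)
        outcome : (ok? : Dec (Success t g)) → ∑ wt (if does ok? then U ∷ [] else continued) ≤ Φ (length q) t g
        outcome (yes ok)  = subst (_≤ Φ (length q) t g) (sym (+-identityʳ (wt U))) (success-≤ U (length q) t g ∣U∣ ok)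
        outcome (no fail) = subst (_≤ Φ (length q) t g)
          (sym (trans (∑-++ wt (pop (explore k) U q t g) _)
            (cong (∑ wt (pop (explore k) U q t g) +_) (∑-++ wt (treeStep (explore k) U q t g) _))))
          (third (∑ wt (pop (explore k) U q t g)) (∑ wt (treeStep (explore k) U q t g)) (∑ wt (closerStep (explore k) U q t g))
                 (pop-≤ (explore k) (explore-≤ k) U q t g ∣U∣) (treeStep-≤ (explore k) (explore-≤ k) U q t g ∣U∣)
                 (closerStep-≤ (explore k) (explore-≤ k) U q t g ∣U∣ fail))

      starts-≤ : ∀ k → ∑ wt (starts k) ≤ ι (v ℕ.* (v ℕ.* D)) * (θ * (p ^ s * 3ℚ ^ s))
      starts-≤ k = ≤-trans
        (∑-concatMap-≤ wt (λ e → explore k e (elements e) 0 0) (θ * (p ^ s * 3ℚ ^ s)) (edges H) start)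
        (*-monoʳ (0≤* 0≤θ (0≤* (0≤^ s 0≤p) (0≤^ s 0≤3)))
          (ι-mono (∣edges∣≤ H Δ≤D uniform (ℕ.s≤s (ℕ.s≤s ℕ.z≤n)))))
        where
        start : ∀ {e} → e List.∈ edges H → ∑ wt (explore k e (elements e) 0 0) ≤ θ * (p ^ s * 3ℚ ^ s)
        start {e} e∈ = ≤-trans
          (explore-≤ k e (elements e) 0 0 (trans ∣e∣ (sym (trans (ℕ.+-identityʳ _)
            (trans (cong (s ℕ.+_) (ℕ.*-zeroʳ s-1)) (ℕ.+-identityʳ s))))))
          (≤-reflexive (trans (cong (λ ℓ → Φ ℓ 0 0) (trans (length-elements e) ∣e∣))
            (cong (θ *_) (cong (_* 3ℚ ^ s) (trans (*-identityʳ (p ^ s * 1ℚ)) (*-identityʳ (p ^ s)))))))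
          where
          ∣e∣ : ∣ e ∣ ≡ s
          ∣e∣ = All.lookup uniform e∈

-- Edge-critical hypergraphs for fixed lists

module Critical where

  open Subsets
  open import Data.Bool.Base using (Bool; true; false; not; if_then_else_)
  open import Data.Fin.Base using (Fin)
  import Data.Fin.Properties as Fin
  open import Data.Fin.Subset using (Subset; _∈_; _∉_; ∣_∣; _∪_; _─_; ⁅_⁆)
  open import Data.Fin.Subset.Properties hiding (⊆-refl; ⊆-trans)
  open import Data.List.Base using (List; []; filter; length)
  open import Data.List.Membership.Propositional as List using (find; lose)
  import Data.List.Membership.Propositional.Properties as List
  open import Data.List.Properties using (filter-notAll)
  open import Data.List.Relation.Unary.All as All using (All; [])
  import Data.List.Relation.Unary.All.Properties as All
  import Data.List.Relation.Unary.Any as Any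
  open import Data.Nat.Base
  open import Data.Nat.Properties
  open import Data.Product.Base using (∃-syntax; _×_; _,_; proj₁; proj₂)
  open import Data.Sum.Base using (_⊎_; inj₁; inj₂; [_,_]′)
  open import Data.Vec.Base using (lookup; updateAt; tabulate)
  open import Data.Vec.Properties using (lookup∘updateAt; lookup∘updateAt′; ≡-dec)
  import Data.Bool.Properties as Bool
  open import Function.Base using (_∘_)
  open import Relation.Binary.PropositionalEquality hiding ([_])
  open import Relation.Nullary using (Dec; yes; no; ¬_; contradiction)
  open import Relation.Nullary.Decidable using (¬?; _×-dec_; decidable-stable)
  open import Relation.Unary using (Decidable)

  private
    variable
      N : ℕ

  _≟ₛ_ : (p q : Subset N) → Dec (p ≡ q)
  _≟ₛ_ = ≡-dec Bool._≟_

  -- A positive form of not being monochromatic: it supplies two witnesses and is decided by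
  -- searching pairs.
  Bichromatic : (Fin N → ℕ) → Subset N → Set
  Bichromatic f e = ∃[ x ] ∃[ y ] (x ∈ e × y ∈ e) × f x ≢ f y

  bichromatic? : (f : Fin N → ℕ) → Decidable (Bichromatic f)
  bichromatic? f e = Fin.any? λ x → Fin.any? λ y → (x ∈? e ×-dec y ∈? e) ×-dec ¬? (f x ≟ f y)

  bichromatic-cong : ∀ {f g : Fin N → ℕ} {e} → (∀ {x} → x ∈ e → f x ≡ g x) → Bichromatic f e → Bichromatic g e
  bichromatic-cong f≡g (x , y , (x∈ , y∈) , fx≢fy) = x , y , (x∈ , y∈) ,
    λ gx≡gy → fx≢fy (trans (f≡g x∈) (trans gx≡gy (sym (f≡g y∈))))

  ¬bichromatic : ∀ {f : Fin N → ℕ} {e} → ¬ Bichromatic f e → ∀ {x y} → x ∈ e → y ∈ e → f x ≡ f y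
  ¬bichromatic {f = f} ¬bi {x} {y} x∈ y∈ = decidable-stable (f x ≟ f y) λ fx≢fy → ¬bi (x , y , (x∈ , y∈) , fx≢fy)

  record MeetsAt (f e : Subset N) (x : Fin N) : Set where
    constructor meets
    field
      here∈ : x ∈ f
      only  : ∀ {z} → z ∈ f → z ∈ e → z ≡ x

  open MeetsAt public

  module _ (l r : Fin N → ℕ) (l≢r : ∀ x → l x ≢ r x) where

    -- With two colours per vertex a colouring is a single bit at each vertex, so that recolouring a
    -- vertex is `flip`.
    pick : Subset N → Fin N → ℕ
    pick b x = if lookup b x then l x else r x

    Colourable : List (Subset N) → Set
    Colourable G = ∃[ b ] All (Bichromatic (pick b)) G

    colourable? : Decidable Colourable
    colourable? G = anySubset? λ b → All.all? (bichromatic? (pick b)) G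

    flip : Fin N → Subset N → Subset N
    flip x b = updateAt b x not

    flip-≢ : ∀ b x → pick (flip x b) x ≢ pick b x
    flip-≢ b x eq with lookup b x | lookup (updateAt b x not) x | lookup∘updateAt x {f = not} b
    ... | true  | .false | refl = l≢r x (sym eq)
    ... | false | .true  | refl = l≢r x eq

    flip-≡ : ∀ b {x y} → y ≢ x → pick (flip x b) y ≡ pick b y
    flip-≡ b {x} {y} y≢x = cong (λ c → if c then l y else r y) (lookup∘updateAt′ y x y≢x b)

    infixl 6 _∖_
    _∖_ : List (Subset N) → Subset N → List (Subset N)
    G ∖ e = filter (λ f → ¬? (f ≟ₛ e)) G

    record Critical (G : List (Subset N)) : Set where
      field
        ¬colourable : ¬ Colourable G
        removal     : ∀ {e} → e List.∈ G → Colourable (G ∖ e)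

    critical : ∀ G → ¬ Colourable G → ∃[ K ] (∀ {e} → e List.∈ K → e List.∈ G) × Critical K
    critical G = go (length G) G ≤-refl
      where
      go : ∀ n G → length G ≤ n → ¬ Colourable G → ∃[ K ] (∀ {e} → e List.∈ K → e List.∈ G) × Critical K
      go n G ∣G∣≤n ¬col with Any.any? (λ e → ¬? (colourable? (G ∖ e))) G
      ... | no all = G , (λ e∈ → e∈) , record
        { ¬colourable = ¬col
        ; removal     = λ {e} e∈ → decidable-stable (colourable? (G ∖ e)) λ ¬c → all (lose e∈ ¬c)
        }
      go zero    []      _     ¬col | yes ()
      go (suc n) G       ∣G∣≤n ¬col | yes some with find some
      ... | e , e∈ , ¬col′ with go n (G ∖ e) (s≤s⁻¹ (<-≤-trans
              (filter-notAll (λ f → ¬? (f ≟ₛ e)) G (lose e∈ λ e≢e → e≢e refl)) ∣G∣≤n)) ¬col′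
      ...   | K , K⊆ , crit = K , (λ f∈ → proj₁ (List.∈-filter⁻ (λ f → ¬? (f ≟ₛ e)) {xs = G} (K⊆ f∈))) , crit

    module _ {G : List (Subset N)} (crit : Critical G) where

      open Critical crit

      monochromatic : ∀ b → ∃[ e ] e List.∈ G × ¬ Bichromatic (pick b) e
      monochromatic b = find (All.¬All⇒Any¬ (bichromatic? (pick b)) G λ all → ¬colourable (b , all))

      module Colouring {e} (e∈ : e List.∈ G) where

        b : Subset N
        b = proj₁ (removal e∈)

        others : ∀ {f} → f List.∈ G → f ≢ e → Bichromatic (pick b) f
        others f∈ f≢e = All.lookup (proj₂ (removal e∈)) (List.∈-filter⁺ (λ f → ¬? (f ≟ₛ e)) f∈ f≢e)

        mono : ∀ {x y} → x ∈ e → y ∈ e → pick b x ≡ pick b y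
        mono = ¬bichromatic λ bi → ¬colourable (b , All.tabulate λ {f} f∈ → all bi f f∈)
          where
          all : Bichromatic (pick b) e → ∀ f → f List.∈ G → Bichromatic (pick b) f
          all bi f f∈ with f ≟ₛ e
          ... | yes refl = bi
          ... | no f≢e   = others f∈ f≢e

        -- Recolouring x ∈ e makes e bichromatic, hence some other edge at x monochromatic.
        recolour : ∀ {x y} → x ∈ e → y ∈ e → x ≢ y →
          ∃[ f ] f List.∈ G × x ∈ f × f ≢ e × ¬ Bichromatic (pick (flip x b)) f
        recolour {x} {y} x∈e y∈e x≢y with monochromatic (flip x b)
        ... | f , f∈ , ¬bi with f ≟ₛ e
        ...   | yes refl = contradiction (x , y , (x∈e , y∈e) , λ eq → flip-≢ b x (begin
          pick (flip x b) x ≡⟨ eq ⟩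
          pick (flip x b) y ≡⟨ flip-≡ b (x≢y ∘ sym) ⟩
          pick b y          ≡⟨ mono y∈e x∈e ⟩
          pick b x          ∎)) ¬bi
          where open ≡-Reasoning
        ...   | no f≢e with x ∈? f
        ...     | yes x∈f = f , f∈ , x∈f , f≢e , ¬bi
        ...     | no x∉f  = contradiction
          (bichromatic-cong (λ z∈f → sym (flip-≡ b λ z≡x → x∉f (subst (_∈ f) z≡x z∈f))) (others f∈ f≢e)) ¬bi

      -- The edge f spoiled by flipping x has the new colour of x throughout, while the other
      -- vertices of e keep the colour that x had before; so f contains none of them.
      private-neighbour : ∀ {e x} → e List.∈ G → x ∈ e → 2 ≤ ∣ e ∣ → ∃[ f ] f List.∈ G × MeetsAt f e x
      private-neighbour {e} {x} e∈ x∈e 2≤e with another e x 2≤e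
      ... | y , y∈e , x≢y with recolour x∈e y∈e x≢y
        where open Colouring e∈
      ...   | f , f∈ , x∈f , _ , ¬bi = f , f∈ , meets x∈f λ {z} z∈f z∈e →
        decidable-stable (z Fin.≟ x) λ z≢x → flip-≢ b x (begin
          pick (flip x b) x ≡⟨ ¬bichromatic ¬bi x∈f z∈f ⟩
          pick (flip x b) z ≡⟨ flip-≡ b z≢x ⟩
          pick b z          ≡⟨ mono z∈e x∈e ⟩
          pick b x          ∎)
        where
        open ≡-Reasoning
        open Colouring e∈

      -- In a triangle whose three corners have degree two, the colouring that makes only f
      -- monochromatic forces z to have the new colours of y and y′; hence y and z can be
      -- recoloured simultaneously.
      no-pendant-triangle : ∀ {f g h y y′ z} → f List.∈ G → y ≢ y′ →
        y ∈ f → y′ ∈ f → y ∈ g → z ∈ g → y′ ∈ h → z ∈ h → y ∉ h → z ∉ f → 3 ≤ ∣ h ∣ →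
        (∀ {e} → e List.∈ G → y ∈ e → e ≡ f ⊎ e ≡ g) →
        (∀ {e} → e List.∈ G → y′ ∈ e → e ≡ f ⊎ e ≡ h) →
        ¬ (∀ {e} → e List.∈ G → z ∈ e → e ≡ g ⊎ e ≡ h)
      no-pendant-triangle {f} {g} {h} {y} {y′} {z} f∈ y≢y′ y∈f y′∈f y∈g z∈g y′∈h z∈h y∉h z∉f 3≤h at-y at-y′ at-z =
        ¬colourable (b₃ , All.tabulate λ {e} → good e)
        where
        open Colouring f∈
        open ≡-Reasoning
        z≢y : z ≢ y
        z≢y refl = z∉f y∈f
        z≢y′ : z ≢ y′
        z≢y′ refl = z∉f y′∈f
        -- Recolouring w ∈ f must spoil some edge other than f, and k is the only candidate; after
        -- the flip, k has the new colour of w throughout.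
        forced : ∀ {w w′ k} → w ∈ f → w′ ∈ f → w ≢ w′ → w ∈ k → (∀ {e} → e List.∈ G → w ∈ e → e ≡ f ⊎ e ≡ k) →
          ∀ {u} → u ∈ k → u ≢ w → pick b u ≡ pick (flip w b) w
        forced {w} w∈f w′∈f w≢w′ w∈k at-w {u} u∈k u≢w with recolour w∈f w′∈f w≢w′
        ... | e , e∈ , w∈e , e≢f , ¬bi with at-w e∈ w∈e
        ...   | inj₁ e≡f = contradiction e≡f e≢f
        ...   | inj₂ refl = trans (sym (flip-≡ b u≢w)) (¬bichromatic ¬bi u∈k w∈k)
        z-forced : pick b z ≡ pick (flip y b) y
        z-forced = forced y∈f y′∈f y≢y′ y∈g at-y z∈g z≢y
        z-forced′ : ∀ {u} → u ∈ h → u ≢ y′ → pick b u ≡ pick (flip y′ b) y′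
        z-forced′ = forced y′∈f y∈f (y≢y′ ∘ sym) y′∈h at-y′
        -- Flipping y repairs f but gives g a single colour; flipping z as well repairs g, and h is
        -- saved by its third vertex.
        b₃ : Subset N
        b₃ = flip z (flip y b)
        b₃-y : pick b₃ y ≡ pick b z
        b₃-y = trans (flip-≡ (flip y b) (z≢y ∘ sym)) (sym z-forced)
        b₃-z : pick b₃ z ≢ pick b z
        b₃-z eq = flip-≢ (flip y b) z (trans eq (sym (flip-≡ b z≢y)))
        b₃-≡ : ∀ {w} → w ≢ y → w ≢ z → pick b₃ w ≡ pick b w
        b₃-≡ w≢y w≢z = trans (flip-≡ (flip y b) w≢z) (flip-≡ b w≢y)
        b₃-y′ : pick b₃ y′ ≡ pick b y
        b₃-y′ = trans (b₃-≡ (y≢y′ ∘ sym) (z≢y′ ∘ sym)) (mono y′∈f y∈f)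
        z≢ : pick b z ≢ pick b y
        z≢ eq = flip-≢ b y (trans (sym z-forced) eq)
        -- Neither flip touches this vertex of h: it still has the old colour of z, which differs
        -- from the colour of y′.
        third : ∃[ u ] u ∈ h × u ≢ y′ × u ≢ z
        third with ∣p∣≥1⇒∃ (h ─ (⁅ y′ ⁆ ∪ ⁅ z ⁆)) (+-cancelʳ-≤ 2 1 _ (≤-trans 3≤h
          (≤-trans (≤-reflexive (sym (∣─∣+∣∩∣ h (⁅ y′ ⁆ ∪ ⁅ z ⁆)))) (+-monoʳ-≤ ∣ h ─ (⁅ y′ ⁆ ∪ ⁅ z ⁆) ∣ (≤-trans
            (∣p∩q∣≤∣q∣ h (⁅ y′ ⁆ ∪ ⁅ z ⁆)) (≤-trans (≤-reflexive (∣∪∣ ⁅ y′ ⁆ ⁅ z ⁆))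
              (+-mono-≤ (≤-reflexive (∣⁅x⁆∣≡1 y′)) (≤-trans (∣p─q∣≤∣p∣ ⁅ z ⁆ ⁅ y′ ⁆) (≤-reflexive (∣⁅x⁆∣≡1 z))))))))))
        ... | u , u∈ = u , p─q⊆p h _ u∈ ,
          (λ { refl → ∈─⇒∉ u∈ (x∈p∪q⁺ (inj₁ (x∈⁅x⁆ u))) }) , (λ { refl → ∈─⇒∉ u∈ (x∈p∪q⁺ (inj₂ (x∈⁅x⁆ u))) })
        good : ∀ e → e List.∈ G → Bichromatic (pick b₃) e
        good e e∈ with z ∈? e
        ... | yes z∈e with at-z e∈ z∈e
        ...   | inj₁ refl = z , y , (z∈g , y∈g) , λ eq → b₃-z (trans eq b₃-y)
        ...   | inj₂ refl = let u , u∈h , u≢y′ , u≢z = third in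
          u , y′ , (u∈h , y′∈h) , λ eq → z≢ (begin
            pick b z          ≡⟨ z-forced′ z∈h z≢y′ ⟩
            pick (flip y′ b) y′ ≡⟨ z-forced′ u∈h u≢y′ ⟨
            pick b u          ≡⟨ b₃-≡ (λ { refl → y∉h u∈h }) u≢z ⟨
            pick b₃ u         ≡⟨ eq ⟩
            pick b₃ y′        ≡⟨ b₃-y′ ⟩
            pick b y          ∎)
        good e e∈ | no z∉e with y ∈? e
        ...   | no y∉e = bichromatic-cong
          (λ {w} w∈e → sym (b₃-≡ {w} (λ { refl → y∉e w∈e }) (λ { refl → z∉e w∈e })))
          (others e∈ λ { refl → y∉e y∈f })
        ...   | yes y∈e with at-y e∈ y∈e
        ...     | inj₁ refl = y , y′ , (y∈f , y′∈f) , λ eq → z≢ (trans (sym b₃-y) (trans eq b₃-y′))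
        ...     | inj₂ refl = contradiction z∈g z∉e

-- Following one branch of the enumeration inside G

module Running where

  open Subsets
  open Exploring
  open import Data.Bool.Base using (if_then_else_)
  open import Data.Fin.Base using (Fin)
  open import Data.Fin.Subset using (Subset; _∈_; _⊆_; ∣_∣; _∩_; _∪_; _─_)
  open import Data.Fin.Subset.Properties hiding (⊆-refl; ⊆-trans)
  open import Data.List.Base using (List; []; _∷_; _++_; length)
  open import Data.List.Membership.Propositional as List using (find; lose)
  import Data.List.Membership.Propositional.Properties as List
  open import Data.List.Properties using (length-++)
  open import Data.List.Relation.Unary.Any as Any using (here; there)
  open import Data.Nat.Base
  open import Data.Nat.Properties
  open import Data.Nat.Solver using (module +-*-Solver)
  open import Data.Product.Base using (∃-syntax; _×_; _,_)
  open import Data.Sum.Base using (_⊎_; inj₁; inj₂; [_,_]′)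
  open import Function.Base using (_∘_)
  open import Relation.Binary.PropositionalEquality hiding ([_])
  open import Relation.Nullary using (Dec; yes; no; does; ¬_; contradiction)

  private
    variable
      N : ℕ

  module Moves (E : List (Subset N)) (s M : ℕ) where

    open Exploration E s M public

    private
      stop : ∀ {P : Set} (d : Dec P) {U : Subset N} {Ss} → P → U List.∈ (if does d then U ∷ [] else Ss)
      stop (yes _) _ = here refl
      stop (no ¬p) p = contradiction p ¬p

      continue : ∀ {P : Set} (d : Dec P) {S U : Subset N} {Ss} → ¬ P → S List.∈ Ss → S List.∈ (if does d then U ∷ [] else Ss)
      continue (yes p) ¬p _  = contradiction p ¬p
      continue (no _)  _  S∈ = S∈

    explore-stop : ∀ k {U q t g} → Success t g → U List.∈ explore (suc k) U q t g
    explore-stop k {t = t} {g} ok = stop (success? t g) ok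

    explore-pop : ∀ k {S U x q t g} → ¬ Success t g →
      S List.∈ explore k U q t g → S List.∈ explore (suc k) U (x ∷ q) t g
    explore-pop k {t = t} {g} fail S∈ = continue (success? t g) fail (List.∈-++⁺ˡ S∈)

    explore-tree : ∀ k {S U x q t g f} → ¬ Success t g → f List.∈ E → Tree U x f →
      S List.∈ explore k (U ∪ f) ((x ∷ q) ++ elements (f ─ U)) (suc t) g →
      S List.∈ explore (suc k) U (x ∷ q) t g
    explore-tree k {U = U} {x} {q} {t} {g} fail f∈ tree S∈ = continue (success? t g) fail
      (List.∈-++⁺ʳ (pop (explore k) U (x ∷ q) t g) (List.∈-++⁺ˡ (List.∈-concatMap⁺ _
        (lose (List.∈-filter⁺ (tree? U x) f∈ tree) S∈))))

    explore-closer : ∀ k {S U q t g f} → ¬ Success t g → f List.∈ E → Closer U f →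
      S List.∈ explore k (U ∪ f) (q ++ elements (f ─ U)) t (g + ∣ f ─ U ∣) →
      S List.∈ explore (suc k) U q t g
    explore-closer k {U = U} {q} {t} {g} fail f∈ closer S∈ = continue (success? t g) fail
      (List.∈-++⁺ʳ (pop (explore k) U q t g) (List.∈-++⁺ʳ (treeStep (explore k) U q t g) (List.∈-concatMap⁺ _
        (lose (List.∈-filter⁺ (closer? U) f∈ closer) S∈))))

  module Run (E : List (Subset N)) (s-1 M : ℕ) (G : List (Subset N)) (W : Subset N)
    (G⊆E : ∀ {f} → f List.∈ G → f List.∈ E) (G⊆W : ∀ {f} → f List.∈ G → f ⊆ W)
    (uniform : ∀ {f} → f List.∈ G → ∣ f ∣ ≡ suc s-1) where

    private
      s : ℕ
      s = suc s-1

    open Moves E s M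

    -- `StronglyClosed` says that G has no closer for `U`. `Closed` also excludes edges that meet
    -- `U` only once, and is thus the stronger of the two.
    StronglyClosed Closed : Subset N → Set
    StronglyClosed U = ∀ {f} → f List.∈ G → 2 ≤ ∣ f ∩ U ∣ → f ⊆ U
    Closed U = ∀ {f x} → f List.∈ G → x ∈ f → x ∈ U → f ⊆ U

    Done : Subset N → Fin N → Set
    Done U x = ∀ h → h List.∈ G → x ∈ h → h ⊆ U

    Hit : ℕ → Subset N → List (Fin N) → ℕ → ℕ → Set
    Hit k U q t g = ∃[ S ] S List.∈ explore k U q t g × S ⊆ W

    -- `I` is contained in the initial U (it will be an edge of G) and `gᴵ` is the gain made at the
    -- outset; both are carried along for the analysis of a stuck run.
    module _ (I : Subset N) (gᴵ : ℕ) where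

      -- The situation at the last tree step, in which the edge added to core was joint.
      record LastTree (U : Subset N) (g : ℕ) : Set where
        field
          core         : Subset N
          joint        : Subset N
          gain         : ℕ
          core-closed  : StronglyClosed core
          joint∈       : joint List.∈ G
          ∣joint─core∣ : ∣ joint ─ core ∣ ≡ s-1
          core⊆        : core ⊆ U
          joint⊆       : joint ⊆ U
          -- Since that step only closers have added vertices, and each such vertex counts in g -
          -- `gain`; stated without subtraction.
          size         : ∣ U ∣ + gain ≤ ∣ core ∣ + s-1 + g
          gᴵ≤gain      : gᴵ ≤ gain

      -- The first alternative covers the time before any tree step, when every vertex beyond the
      -- first edge comes from a closer.
      History : Subset N → ℕ → Set
      History U g = ∣ U ∣ ≤ s + g ⊎ LastTree U g

      record Stuck : Set where
        field
          U       : Subset N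
          g       : ℕ
          closed  : Closed U
          I⊆U     : I ⊆ U
          g<s-1   : suc g < s
          history : History U g

      private
        via : ∀ {Ss Ts : List (Subset N)} → (∀ {S} → S List.∈ Ss → S List.∈ Ts) →
          (∃[ S ] S List.∈ Ss × S ⊆ W) ⊎ Stuck → (∃[ S ] S List.∈ Ts × S ⊆ W) ⊎ Stuck
        via f (inj₁ (S , S∈ , S⊆W)) = inj₁ (S , f S∈ , S⊆W)
        via f (inj₂ stuck)          = inj₂ stuck

        ⊆-of : ∀ {f U : Subset N} → ∣ f ─ U ∣ ≡ 0 → f ⊆ U
        ⊆-of {f} {U} ∣f─U∣ {x} x∈f with x ∈? U
        ... | yes x∈U = x∈U
        ... | no x∉U  = contradiction (subst (1 ≤_) ∣f─U∣ (∈⇒1≤∣p∣ (x∈p∧x∉q⇒x∈p─q x∈f x∉U))) λ ()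

        grow : ∀ {U q f} → (∀ {x} → x ∈ U → x List.∈ q ⊎ Done U x) →
          ∀ {x} → x ∈ U ∪ f → x List.∈ q ++ elements (f ─ U) ⊎ Done (U ∪ f) x
        grow {U} {q} {f} pending {x} x∈ with x ∈? U
        ... | yes x∈U with pending x∈U
        ...   | inj₁ x∈q  = inj₁ (List.∈-++⁺ˡ x∈q)
        ...   | inj₂ done = inj₂ λ h h∈ x∈h z∈h → p⊆p∪q f (done h h∈ x∈h z∈h)
        grow {U} {q} {f} pending {x} x∈ | no x∉U with x∈p∪q⁻ U f x∈
        ...   | inj₁ x∈U = contradiction x∈U x∉U
        ...   | inj₂ x∈f = inj₁ (List.∈-++⁺ʳ q (∈-elements⁺ (x∈p∧x∉q⇒x∈p─q x∈f x∉U)))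

        grow-q : ∀ {U q} {f : Subset N} → (∀ {x} → x List.∈ q → x ∈ U) →
          ∀ {x} → x List.∈ q ++ elements (f ─ U) → x ∈ U ∪ f
        grow-q {U} {q} {f} q⊆U x∈ with List.∈-++⁻ q x∈
        ... | inj₁ x∈q = p⊆p∪q f (q⊆U x∈q)
        ... | inj₂ x∈e = q⊆p∪q U f (p─q⊆p f U (∈-elements⁻ (f ─ U) x∈e))

        ∣queue∣ : ∀ q (f U : Subset N) → length (q ++ elements (f ─ U)) ≡ length q + ∣ f ─ U ∣
        ∣queue∣ q f U = trans (length-++ q) (cong (length q +_) (length-elements (f ─ U)))

      -- At most a tree steps and a further gain of b can still occur.
      run : ∀ k U q t g a b → M ≤ t + a → s + s ≤ g + b → length q + s * a + (b + b) < k →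
        (∀ {x} → x List.∈ q → x ∈ U) →
        (∀ {x} → x ∈ U → x List.∈ q ⊎ Done U x) →
        U ⊆ W → I ⊆ U → gᴵ ≤ g → History U g → Hit k U q t g ⊎ Stuck
      run (suc k) U q t g a b M≤ s≤ fuel q⊆U pending U⊆W I⊆U gᴵ≤g hist with success? t g
      ... | yes ok = inj₁ (U , explore-stop k {U} {q} ok , U⊆W)
      -- Closers take precedence, so that U is strongly closed whenever a tree step is made.
      ... | no fail with Any.any? (closer? U) G
      ...   | yes some = closer (find some)
        where
        closer : ∃[ f ] f List.∈ G × Closer U f → Hit (suc k) U q t g ⊎ Stuck
        closer (f , f∈ , 2≤ , 1≤γ) = via (explore-closer k {q = q} fail (G⊆E f∈) (2≤ , 1≤γ))
          (run k (U ∪ f) (q ++ elements (f ─ U)) t (g + γ) a (b ∸ γ) M≤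
            (subst (s + s ≤_) (trans (cong (g +_) (sym (m+[n∸m]≡n γ≤b))) (sym (+-assoc g γ (b ∸ γ)))) s≤)
            fuel′ (grow-q q⊆U) (grow pending) (∪-least U⊆W (G⊆W f∈)) (p⊆p∪q f ∘ I⊆U) (≤-trans gᴵ≤g (m≤m+n g γ)) (hist′ hist))
          where
          γ = ∣ f ─ U ∣
          g≤s : g ≤ s
          g≤s = <⇒≤ (s≤s⁻¹ (≤-trans (≰⇒> (fail ∘ inj₂)) (n≤1+n s)))
          γ≤s : γ ≤ s
          γ≤s = subst (γ ≤_) (uniform f∈) (∣p─q∣≤∣p∣ f U)
          -- Before success g is at most s, and a closer adds at most s; hence the budget of s + s
          -- for the gain.
          γ≤b : γ ≤ b
          γ≤b = +-cancelˡ-≤ g γ b (≤-trans (+-mono-≤ g≤s γ≤s) s≤)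
          -- The queue grows by γ and one move is spent, while b + b drops by 2 γ; this is why b
          -- counts twice.
          fuel′ : length (q ++ elements (f ─ U)) + s * a + (b ∸ γ + (b ∸ γ)) < k
          fuel′ = begin-strict
            length (q ++ elements (f ─ U)) + s * a + (c + c)
              ≡⟨ cong (λ ℓ → ℓ + s * a + (c + c)) (∣queue∣ q f U) ⟩
            length q + γ + s * a + (c + c)
              <⟨ ≤-reflexive refl ⟩
            suc (length q + γ + s * a + (c + c))
              ≤⟨ +-monoˡ-≤ _ 1≤γ ⟩
            γ + (length q + γ + s * a + (c + c))
              ≡⟨ solve 4 (λ l g x c → g :+ (l :+ g :+ x :+ (c :+ c)) := l :+ x :+ ((g :+ c) :+ (g :+ c))) refl
                   (length q) γ (s * a) c ⟩
            length q + s * a + ((γ + c) + (γ + c))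
              ≡⟨ cong (λ b → length q + s * a + (b + b)) (m+[n∸m]≡n γ≤b) ⟩
            length q + s * a + (b + b)
              ≤⟨ s≤s⁻¹ fuel ⟩
            k ∎
            where
            open ≤-Reasoning
            open +-*-Solver
            c = b ∸ γ
          hist′ : History U g → History (U ∪ f) (g + γ)
          hist′ (inj₁ small) = inj₁ (begin
            ∣ U ∪ f ∣     ≡⟨ ∣∪∣ U f ⟩
            ∣ U ∣ + γ     ≤⟨ +-monoˡ-≤ γ small ⟩
            s + g + γ     ≡⟨ +-assoc s g γ ⟩
            s + (g + γ)   ∎)
            where open ≤-Reasoning
          hist′ (inj₂ last) = inj₂ record
            { core         = core
            ; joint        = joint
            ; gain         = gain
            ; core-closed  = core-closed
            ; joint∈       = joint∈
            ; ∣joint─core∣ = ∣joint─core∣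
            ; core⊆        = p⊆p∪q f ∘ core⊆
            ; joint⊆       = p⊆p∪q f ∘ joint⊆
            ; gᴵ≤gain      = gᴵ≤gain
            ; size         = begin
                ∣ U ∪ f ∣ + gain            ≡⟨ cong (_+ gain) (∣∪∣ U f) ⟩
                ∣ U ∣ + γ + gain
                  ≡⟨ solve 3 (λ u c g → u :+ c :+ g := u :+ g :+ c) refl ∣ U ∣ γ gain ⟩
                ∣ U ∣ + gain + γ            ≤⟨ +-monoˡ-≤ γ size ⟩
                ∣ core ∣ + s-1 + g + γ      ≡⟨ +-assoc (∣ core ∣ + s-1) g γ ⟩
                ∣ core ∣ + s-1 + (g + γ)    ∎
            }
            where
            open LastTree last
            open ≤-Reasoning
            open +-*-Solver
      ...   | no none = advance q fuel q⊆U pending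
        where
        strong : StronglyClosed U
        strong {f} f∈ 2≤ with ∣ f ─ U ∣ in eq
        ... | zero  = ⊆-of eq
        ... | suc _ = contradiction (lose f∈ (2≤ , subst (1 ≤_) (sym eq) (s≤s z≤n))) none
        advance : ∀ q → length q + s * a + (b + b) < suc k → (∀ {x} → x List.∈ q → x ∈ U) →
          (∀ {x} → x ∈ U → x List.∈ q ⊎ Done U x) → Hit (suc k) U q t g ⊎ Stuck
        advance [] fuel q⊆U pending = inj₂ record
          { closed  = closed
          ; I⊆U     = I⊆U
          ; g<s-1   = ≰⇒> (fail ∘ inj₂)
          ; history = hist
          }
          where
          closed : Closed U
          closed {f} f∈ x∈f x∈U with pending x∈U
          ... | inj₂ done = done f f∈ x∈f
        advance (x ∷ q) fuel q⊆U pending with Any.any? (tree? U x) G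
        ... | yes some = tree (find some)
          where
          tree : ∃[ f ] f List.∈ G × Tree U x f → Hit (suc k) U (x ∷ q) t g ⊎ Stuck
          tree (f , f∈ , x∈f , s≡) = step a M≤ fuel
            where
            new : ∣ f ─ U ∣ ≡ s-1
            new = sym (suc-injective s≡)
            step : ∀ a → M ≤ t + a → length (x ∷ q) + s * a + (b + b) < suc k → Hit (suc k) U (x ∷ q) t g ⊎ Stuck
            step zero    M≤ _ = contradiction (inj₁ (subst (M ≤_) (+-identityʳ t) M≤)) fail
            step (suc a) M≤ fuel = via (explore-tree k fail (G⊆E f∈) (x∈f , s≡))
              (run k (U ∪ f) ((x ∷ q) ++ elements (f ─ U)) (suc t) g a b (subst (M ≤_) (+-suc t a) M≤) s≤
                (subst (_≤ k) (sym fuel′) (s≤s⁻¹ fuel)) (grow-q q⊆U) (grow pending) (∪-least U⊆W (G⊆W f∈))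
                (p⊆p∪q f ∘ I⊆U) gᴵ≤g (inj₂ record
                  { core         = U
                  ; joint        = f
                  ; gain         = g
                  ; core-closed  = strong
                  ; joint∈       = f∈
                  ; ∣joint─core∣ = new
                  ; core⊆        = p⊆p∪q f
                  ; joint⊆       = q⊆p∪q U f
                  ; size         = ≤-reflexive (cong (_+ g) (trans (∣∪∣ U f) (cong (∣ U ∣ +_) new)))
                  ; gᴵ≤gain      = gᴵ≤g
                  }))
              where
              open +-*-Solver
              -- The queue grows by s - 1 and one move is spent: together the s by which the budget
              -- for tree steps shrinks.
              fuel′ : suc (length ((x ∷ q) ++ elements (f ─ U)) + s * a + (b + b)) ≡ length (x ∷ q) + s * suc a + (b + b)
              fuel′ = trans (cong (λ ℓ → suc (ℓ + s * a + (b + b))) (trans (∣queue∣ (x ∷ q) f U) (cong (length (x ∷ q) +_) new)))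
                (solve 4 (λ l r a b → con 1 :+ (con 1 :+ l :+ r :+ (con 1 :+ r) :* a :+ (b :+ b))
                     := con 1 :+ l :+ (con 1 :+ r) :* (con 1 :+ a) :+ (b :+ b)) refl (length q) s-1 a b)
        ... | no none′ = via (explore-pop k fail)
          (run k U q t g a b M≤ s≤ (s≤s⁻¹ fuel) (q⊆U ∘ there) pending′ U⊆W I⊆U gᴵ≤g hist)
          where
          -- No closer is left, so an edge at x lies inside U or meets it in x alone; the latter
          -- would be a tree edge.
          done : Done U x
          done h h∈ x∈h with 2 ≤? ∣ h ∩ U ∣
          ... | yes 2≤ = strong h∈ 2≤
          ... | no 2≰  = contradiction (lose h∈ (x∈h , sym (begin
            suc ∣ h ─ U ∣           ≡⟨ +-comm 1 ∣ h ─ U ∣ ⟩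
            ∣ h ─ U ∣ + 1
              ≡⟨ cong (∣ h ─ U ∣ +_) (≤-antisym (∈⇒1≤∣p∣ (x∈p∩q⁺ (x∈h , q⊆U (here refl)))) (s≤s⁻¹ (≰⇒> 2≰))) ⟩
            ∣ h ─ U ∣ + ∣ h ∩ U ∣   ≡⟨ ∣─∣+∣∩∣ h U ⟩
            ∣ h ∣                   ≡⟨ uniform h∈ ⟩
            s                       ∎))) none′
            where open ≡-Reasoning
          pending′ : ∀ {y} → y ∈ U → y List.∈ q ⊎ Done U y
          pending′ y∈U with pending y∈U
          ... | inj₁ (here refl) = inj₂ done
          ... | inj₁ (there y∈q) = inj₁ y∈q
          ... | inj₂ finished    = inj₂ finished

-- Explorations of a critical hypergraph do not get stuck

module Covering where

  open Subsets
  open Critical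
  open Running
  open import Data.Fin.Base using (Fin)
  open import Data.Fin.Subset using (Subset; _∈_; _∉_; _⊆_; ∣_∣; _∩_; _∪_; _─_; ⁅_⁆)
  open import Data.Fin.Subset.Properties hiding (⊆-refl; ⊆-trans)
  open import Data.List.Base using (List; _++_; length)
  open import Data.List.Membership.Propositional as List using (find; lose)
  import Data.List.Membership.Propositional.Properties as List
  open import Data.List.Properties using (length-++)
  import Data.List.Relation.Unary.Any as Any
  open import Data.Nat.Base
  open import Data.Nat.Properties
  open import Data.Product.Base using (∃-syntax; _×_; _,_; proj₁; proj₂)
  open import Data.Sum.Base using (_⊎_; inj₁; inj₂; [_,_]′)
  open import Data.Empty using (⊥)
  open import Function.Base using (_∘_)
  open import Relation.Binary.PropositionalEquality hiding ([_])
  open import Relation.Nullary using (yes; no; ¬_; contradiction)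
  open import Relation.Nullary.Decidable using (decidable-stable; ¬?; _×-dec_)

  private
    variable
      N : ℕ

  ∣∪∣≤ : ∀ (p q : Subset N) → ∣ p ∪ q ∣ ≤ ∣ p ∣ + ∣ q ∣
  ∣∪∣≤ p q = ≤-trans (≤-reflexive (∣∪∣ p q)) (+-monoʳ-≤ ∣ p ∣ (∣p─q∣≤∣p∣ q p))

  ∣p∣≤∣─∪∣+2 : ∀ (p q r : Subset N) → ∣ p ∩ q ∣ ≤ 1 → ∣ p ∩ r ∣ ≤ 1 → ∣ p ∣ ≤ ∣ p ─ (q ∪ r) ∣ + 2
  ∣p∣≤∣─∪∣+2 p q r pq pr = begin
    ∣ p ∣                                         ≡⟨ ∣─∣+∣∩∣ p (q ∪ r) ⟨
    ∣ p ─ (q ∪ r) ∣ + ∣ p ∩ (q ∪ r) ∣             ≤⟨ +-monoʳ-≤ ∣ p ─ (q ∪ r) ∣ (p⊆q⇒∣p∣≤∣q∣ distrib) ⟩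
    ∣ p ─ (q ∪ r) ∣ + ∣ (p ∩ q) ∪ (p ∩ r) ∣
      ≤⟨ +-monoʳ-≤ ∣ p ─ (q ∪ r) ∣ (≤-trans (∣∪∣≤ (p ∩ q) (p ∩ r)) (+-mono-≤ pq pr)) ⟩
    ∣ p ─ (q ∪ r) ∣ + 2                           ∎
    where
    open ≤-Reasoning
    distrib : p ∩ (q ∪ r) ⊆ (p ∩ q) ∪ (p ∩ r)
    distrib x∈ with x∈p∩q⁻ p (q ∪ r) x∈
    ... | x∈p , x∈q∪r with x∈p∪q⁻ q r x∈q∪r
    ...   | inj₁ x∈q = x∈p∪q⁺ (inj₁ (x∈p∩q⁺ (x∈p , x∈q)))
    ...   | inj₂ x∈r = x∈p∪q⁺ (inj₂ (x∈p∩q⁺ (x∈p , x∈r)))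

  meets⇒∣∩∣≤1 : ∀ {f e : Subset N} {x} → MeetsAt f e x → ∣ f ∩ e ∣ ≤ 1
  meets⇒∣∩∣≤1 {f = f} {e} {x} m = subst (∣ f ∩ e ∣ ≤_) (∣⁅x⁆∣≡1 x) (p⊆q⇒∣p∣≤∣q∣ λ z∈ →
    let z∈f , z∈e = x∈p∩q⁻ f e z∈ in subst (_∈ ⁅ x ⁆) (sym (only m z∈f z∈e)) (x∈⁅x⁆ x))

  module _ (l r : Fin N → ℕ) (l≢r : ∀ x → l x ≢ r x) {G : List (Subset N)} (crit : Critical l r l≢r G)
    (E : List (Subset N)) (s-3 M : ℕ) (W : Subset N)
    (G⊆E : ∀ {f} → f List.∈ G → f List.∈ E) (G⊆W : ∀ {f} → f List.∈ G → f ⊆ W)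
    (uniform : ∀ {f} → f List.∈ G → ∣ f ∣ ≡ suc (suc (suc s-3))) where

    private
      s-1 s : ℕ
      s-1 = suc (suc s-3)
      s = suc s-1

      2≤∣_∣ : ∀ {e} → e List.∈ G → 2 ≤ ∣ e ∣
      2≤∣ e∈ ∣ = subst (2 ≤_) (sym (uniform e∈)) (s≤s (s≤s z≤n))

      neighbour : ∀ {e x} → e List.∈ G → x ∈ e → ∃[ f ] f List.∈ G × MeetsAt f e x
      neighbour e∈ x∈e = private-neighbour l r l≢r crit e∈ x∈e 2≤∣ e∈ ∣

    open Moves E s M
    open Run E s-1 M G W G⊆E G⊆W uniform

    -- A private neighbour of e also lies in U, so U has at least 2 s - 1 vertices. This excludes
    -- getting stuck before the first tree step.
    closed-large : ∀ {U g e} → Closed U → e List.∈ G → e ⊆ U → ∣ U ∣ ≤ s + g → ¬ suc g < s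
    closed-large {U} {g} {e} closed e∈ e⊆U small g<s-1 with ∣p∣≥1⇒∃ e (≤-trans (s≤s z≤n) 2≤∣ e∈ ∣)
    ... | x , x∈e with neighbour e∈ x∈e
    ...   | f , f∈ , m = <⇒≱ g<s-1 (+-cancelˡ-≤ s s (suc g) (begin
      s + s                              ≡⟨ cong₂ _+_ (uniform e∈) (uniform f∈) ⟨
      ∣ e ∣ + ∣ f ∣                      ≡⟨ cong (∣ e ∣ +_) (∣─∣+∣∩∣ f e) ⟨
      ∣ e ∣ + (∣ f ─ e ∣ + ∣ f ∩ e ∣)    ≤⟨ +-monoʳ-≤ ∣ e ∣ (+-monoʳ-≤ ∣ f ─ e ∣ (meets⇒∣∩∣≤1 m)) ⟩
      ∣ e ∣ + (∣ f ─ e ∣ + 1)            ≡⟨ +-assoc ∣ e ∣ ∣ f ─ e ∣ 1 ⟨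
      ∣ e ∣ + ∣ f ─ e ∣ + 1              ≡⟨ cong (_+ 1) (∣∪∣ e f) ⟨
      ∣ e ∪ f ∣ + 1
        ≤⟨ +-monoˡ-≤ 1 (≤-trans (p⊆q⇒∣p∣≤∣q∣ (∪-least e⊆U (closed f∈ (here∈ m) (e⊆U x∈e)))) small) ⟩
      s + g + 1                          ≡⟨ trans (+-assoc s g 1) (cong (s +_) (+-comm g 1)) ⟩
      s + suc g                          ∎))
      where open ≤-Reasoning

    module _ {I : Subset N} {gᴵ : ℕ} {U : Subset N} {g : ℕ} 
      (closed : Closed U) (g<s-1 : suc g < s) (last : LastTree I gᴵ U g) where

      open LastTree last

      private
        boundary : ∀ {f} → f List.∈ G → ∀ {x} → x ∈ f → x ∉ core → ∣ f ∩ core ∣ ≤ 1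
        boundary {f} f∈ x∈f x∉core with 2 ≤? ∣ f ∩ core ∣
        ... | yes 2≤ = contradiction (core-closed f∈ 2≤ x∈f) x∉core
        ... | no 2≰  = s≤s⁻¹ (≰⇒> 2≰)

      record Corner (y : Fin N) : Set where
        field
          nb         : Subset N
          nb∈        : nb List.∈ G
          meets-at-y : MeetsAt nb joint y
          nb⊆U       : nb ⊆ U
          3≤new      : s ≤ ∣ nb ─ (core ∪ joint) ∣ + 2
          gain≡0     : gain ≡ 0
          new≡g      : ∣ nb ─ (core ∪ joint) ∣ ≡ g
          U⊆         : U ⊆ (core ∪ joint) ∪ nb

      -- A private neighbour meets `core` and `joint` at most once each, so it brings at least s - 2
      -- further vertices. Those found after the last tree step number at most g - `gain`, and g ≤ s
      -- - 2; so nothing is left over: `gain` is 0, and the neighbour contains every vertex found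
      -- after `joint`.
      corner : ∀ {y} → y ∈ joint ─ core → Corner y
      corner {y} y∈ with neighbour joint∈ (p─q⊆p joint core y∈)
      ... | f , f∈ , m = record
        { nb         = f
        ; nb∈        = f∈
        ; meets-at-y = m
        ; nb⊆U       = f⊆U
        ; 3≤new      = s≤d+2
        ; gain≡0     = n≤0⇒n≡0 (+-cancelˡ-≤ d gain 0 (≤-trans d+gain≤g (subst (g ≤_) (sym (+-identityʳ d)) g≤d)))
        ; new≡g      = ≤-antisym (≤-trans (m≤m+n d gain) d+gain≤g) g≤d
        ; U⊆         = ⊆∧∣∣≤⇒⊇ big⊆U (begin
            ∣ U ∣                          ≤⟨ m≤m+n ∣ U ∣ gain ⟩
            ∣ U ∣ + gain                   ≤⟨ size ⟩
            ∣ core ∣ + s-1 + g             ≤⟨ +-monoʳ-≤ (∣ core ∣ + s-1) g≤d ⟩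
            ∣ core ∣ + s-1 + d             ≡⟨ ∣big∣ ⟨
            ∣ (core ∪ joint) ∪ f ∣         ∎)
        }
        where
        open ≤-Reasoning
        d = ∣ f ─ (core ∪ joint) ∣
        f⊆U : f ⊆ U
        f⊆U = closed f∈ (here∈ m) (joint⊆ (p─q⊆p joint core y∈))
        big⊆U : (core ∪ joint) ∪ f ⊆ U
        big⊆U = ∪-least (∪-least core⊆ joint⊆) f⊆U
        ∣big∣ : ∣ (core ∪ joint) ∪ f ∣ ≡ ∣ core ∣ + s-1 + d
        ∣big∣ = trans (∣∪∣ (core ∪ joint) f) (cong (_+ d) (trans (∣∪∣ core joint) (cong (∣ core ∣ +_) ∣joint─core∣)))
        s≤d+2 : s ≤ d + 2
        s≤d+2 = subst (_≤ d + 2) (uniform f∈)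
          (∣p∣≤∣─∪∣+2 f core joint (boundary f∈ (here∈ m) (∈─⇒∉ y∈)) (meets⇒∣∩∣≤1 m))
        d+gain≤g : d + gain ≤ g
        d+gain≤g = +-cancelˡ-≤ (∣ core ∣ + s-1) (d + gain) g (begin
          ∣ core ∣ + s-1 + (d + gain)      ≡⟨ +-assoc (∣ core ∣ + s-1) d gain ⟨
          ∣ core ∣ + s-1 + d + gain        ≡⟨ cong (_+ gain) ∣big∣ ⟨
          ∣ (core ∪ joint) ∪ f ∣ + gain    ≤⟨ +-monoˡ-≤ gain (p⊆q⇒∣p∣≤∣q∣ big⊆U) ⟩
          ∣ U ∣ + gain                     ≤⟨ size ⟩
          ∣ core ∣ + s-1 + g               ∎)
        g≤d : g ≤ d
        g≤d = s≤s⁻¹ (s≤s⁻¹ (begin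
          suc (suc g)  ≤⟨ g<s-1 ⟩
          s            ≤⟨ s≤d+2 ⟩
          d + 2        ≡⟨ +-comm d 2 ⟩
          2 + d        ∎))

      private
        two-corners : ∃[ y ] ∃[ y′ ] y ≢ y′ × y ∈ joint ─ core × y′ ∈ joint ─ core
        two-corners = ∣p∣≥2⇒∃₂ (joint ─ core) (subst (2 ≤_) (sym ∣joint─core∣) (s≤s (s≤s z≤n)))

      no-initial-gain : gᴵ ≡ 0
      no-initial-gain = let _ , _ , _ , y∈ , _ = two-corners
                        in n≤0⇒n≡0 (subst (gᴵ ≤_) (Corner.gain≡0 (corner y∈)) gᴵ≤gain)

      -- The vertices found after `joint` lie in both neighbours f and h, and distinct edges of a
      -- linear G share at most one vertex z; so s = 3 and U is `core` with y, y′ and z. An edge at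
      -- one of these three meets `core` at most once, hence contains another of the three, and
      -- linearity identifies it. This gives the degrees required by `no-pendant-triangle`.
      pendant-triangle : (∀ {e f} → e List.∈ G → f List.∈ G → 2 ≤ ∣ f ∩ e ∣ → e ≡ f) →
        ∀ {y y′} → y ≢ y′ → y ∈ joint ─ core → y′ ∈ joint ─ core → Corner y → Corner y′ → ⊥
      pendant-triangle linear {y} {y′} y≢y′ y∈ y′∈ c c′ = refute (∣p∣≥1⇒∃ (h ─ (core ∪ joint)) 1≤new)
        where
        f = Corner.nb c
        h = Corner.nb c′
        f∈ = Corner.nb∈ c
        h∈ = Corner.nb∈ c′
        y∈f = here∈ (Corner.meets-at-y c)
        y′∈h = here∈ (Corner.meets-at-y c′)
        y∈joint = p─q⊆p joint core y∈
        y′∈joint = p─q⊆p joint core y′∈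
        y∉h : y ∉ h
        y∉h y∈h = y≢y′ (only (Corner.meets-at-y c′) y∈h y∈joint)
        1≤new : 1 ≤ ∣ h ─ (core ∪ joint) ∣
        1≤new = +-cancelʳ-≤ 2 1 _ (≤-trans (s≤s (s≤s (s≤s z≤n))) (Corner.3≤new c′))
        new⊆ : h ─ (core ∪ joint) ⊆ f ∩ h
        new⊆ z∈ with p─q⊆p h (core ∪ joint) z∈
        ... | z∈h with x∈p∪q⁻ (core ∪ joint) f (Corner.U⊆ c (Corner.nb⊆U c′ z∈h))
        ...   | inj₁ z∈old = contradiction z∈old (∈─⇒∉ z∈)
        ...   | inj₂ z∈f   = x∈p∩q⁺ (z∈f , z∈h)
        same : ∀ {e k a b} → e List.∈ G → k List.∈ G → a ≢ b → a ∈ e → b ∈ e → a ∈ k → b ∈ k → e ≡ k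
        same {e} {k} e∈ k∈ a≢b a∈e b∈e a∈k b∈k = linear e∈ k∈ (≢∈⇒2≤∣p∣ a≢b (x∈p∩q⁺ (a∈k , a∈e)) (x∈p∩q⁺ (b∈k , b∈e)))
        -- f and h are different edges, because y lies in f but not in h.
        new≤1 : ∣ h ─ (core ∪ joint) ∣ ≤ 1
        new≤1 with 2 ≤? ∣ f ∩ h ∣
        ... | yes 2≤ = contradiction (subst (y ∈_) (sym (linear h∈ f∈ 2≤)) y∈f) y∉h
        ... | no 2≰  = ≤-trans (p⊆q⇒∣p∣≤∣q∣ new⊆) (s≤s⁻¹ (≰⇒> 2≰))
        s≤3 : s ≤ 3
        s≤3 = ≤-trans (Corner.3≤new c′) (+-monoˡ-≤ 2 new≤1)
        refute : ∃[ z ] z ∈ h ─ (core ∪ joint) → ⊥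
        refute (z , z∈) = no-pendant-triangle l r l≢r crit joint∈ y≢y′ y∈joint y′∈joint y∈f z∈f y′∈h z∈h y∉h z∉joint
          (subst (3 ≤_) (sym (uniform h∈)) (s≤s (s≤s (s≤s z≤n)))) at-y at-y′ at-z
          where
          z∈h = p─q⊆p h (core ∪ joint) z∈
          z∈f = proj₁ (x∈p∩q⁻ f h (new⊆ z∈))
          z∉core : z ∉ core
          z∉core = ∈─⇒∉ z∈ ∘ x∈p∪q⁺ ∘ inj₁
          z∉joint : z ∉ joint
          z∉joint = ∈─⇒∉ z∈ ∘ x∈p∪q⁺ ∘ inj₂
          z≢y : z ≢ y
          z≢y refl = z∉joint y∈joint
          z≢y′ : z ≢ y′
          z≢y′ refl = z∉joint y′∈joint
          T₁ = core ∪ ⁅ y ⁆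
          T₂ = T₁ ∪ ⁅ y′ ⁆
          T = T₂ ∪ ⁅ z ⁆
          ∈-insert⁻ : ∀ {p : Subset N} {x w} → w ∈ p ∪ ⁅ x ⁆ → w ∈ p ⊎ w ≡ x
          ∈-insert⁻ {p} {x} w∈ with x∈p∪q⁻ p ⁅ x ⁆ w∈
          ... | inj₁ w∈p = inj₁ w∈p
          ... | inj₂ w∈x = inj₂ (x∈⁅y⁆⇒x≡y x w∈x)
          y′∉T₁ : y′ ∉ T₁
          y′∉T₁ y′∈T₁ = [ ∈─⇒∉ y′∈ , y≢y′ ∘ sym ]′ (∈-insert⁻ y′∈T₁)
          z∉T₂ : z ∉ T₂
          z∉T₂ z∈T₂ = [ (λ z∈T₁ → [ z∉core , z≢y ]′ (∈-insert⁻ z∈T₁)) , z≢y′ ]′ (∈-insert⁻ z∈T₂)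
          ∣T∣ : ∣ T ∣ ≡ 3 + ∣ core ∣
          ∣T∣ = trans (∣p∪⁅x⁆∣ z∉T₂) (cong suc (trans (∣p∪⁅x⁆∣ y′∉T₁) (cong suc (∣p∪⁅x⁆∣ (∈─⇒∉ y∈)))))
          singleton⊆ : ∀ {w} → w ∈ U → ⁅ w ⁆ ⊆ U
          singleton⊆ {w} w∈U v∈ = subst (_∈ U) (sym (x∈⁅y⁆⇒x≡y w v∈)) w∈U
          U⊆T : U ⊆ T
          U⊆T = ⊆∧∣∣≤⇒⊇ (∪-least (∪-least (∪-least core⊆ (singleton⊆ (joint⊆ y∈joint))) (singleton⊆ (joint⊆ y′∈joint)))
                          (singleton⊆ (Corner.nb⊆U c z∈f))) (begin
            ∣ U ∣                  ≤⟨ m≤m+n ∣ U ∣ gain ⟩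
            ∣ U ∣ + gain           ≤⟨ size ⟩
            ∣ core ∣ + s-1 + g
              ≤⟨ +-mono-≤ (+-monoʳ-≤ ∣ core ∣ (s≤s⁻¹ s≤3)) (subst (_≤ 1) (Corner.new≡g c′) new≤1) ⟩
            ∣ core ∣ + 2 + 1       ≡⟨ trans (+-assoc ∣ core ∣ 2 1) (+-comm ∣ core ∣ 3) ⟩
            3 + ∣ core ∣           ≡⟨ ∣T∣ ⟨
            ∣ T ∣                  ∎)
            where open ≤-Reasoning
          second : ∀ {e w} → e List.∈ G → w ∈ e → w ∈ U → w ∉ core → ∃[ w′ ] w′ ∈ e × w ≢ w′ × ((w′ ≡ y ⊎ w′ ≡ y′) ⊎ w′ ≡ z)
          second {e} {w} e∈ w∈e w∈U w∉core with another (e ─ core) w (+-cancelʳ-≤ 1 2 _ (begin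
              3                               ≤⟨ s≤s (s≤s (s≤s z≤n)) ⟩
              s                               ≡⟨ uniform e∈ ⟨
              ∣ e ∣                           ≡⟨ ∣─∣+∣∩∣ e core ⟨
              ∣ e ─ core ∣ + ∣ e ∩ core ∣     ≤⟨ +-monoʳ-≤ ∣ e ─ core ∣ (boundary e∈ w∈e w∉core) ⟩
              ∣ e ─ core ∣ + 1                ∎))
            where open ≤-Reasoning
          ... | w′ , w′∈ , w≢w′ with p─q⊆p e core w′∈
          ...   | w′∈e with ∈-insert⁻ (U⊆T (closed e∈ w∈e w∈U w′∈e))
          ...     | inj₂ w′≡z = w′ , w′∈e , w≢w′ , inj₂ w′≡z
          ...     | inj₁ w′∈T₂ with ∈-insert⁻ w′∈T₂
          ...       | inj₂ w′≡y′ = w′ , w′∈e , w≢w′ , inj₁ (inj₂ w′≡y′)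
          ...       | inj₁ w′∈T₁ with ∈-insert⁻ w′∈T₁
          ...         | inj₂ w′≡y    = w′ , w′∈e , w≢w′ , inj₁ (inj₁ w′≡y)
          ...         | inj₁ w′∈core = contradiction w′∈core (∈─⇒∉ w′∈)
          at-y : ∀ {e} → e List.∈ G → y ∈ e → e ≡ joint ⊎ e ≡ f
          at-y e∈ y∈e with second e∈ y∈e (joint⊆ y∈joint) (∈─⇒∉ y∈)
          ... | _ , w∈e , y≢w , inj₁ (inj₁ refl) = contradiction refl y≢w
          ... | _ , w∈e , y≢w , inj₁ (inj₂ refl) = inj₁ (same e∈ joint∈ y≢w y∈e w∈e y∈joint y′∈joint)
          ... | _ , w∈e , y≢w , inj₂ refl        = inj₂ (same e∈ f∈ y≢w y∈e w∈e y∈f z∈f)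
          at-y′ : ∀ {e} → e List.∈ G → y′ ∈ e → e ≡ joint ⊎ e ≡ h
          at-y′ e∈ y′∈e with second e∈ y′∈e (joint⊆ y′∈joint) (∈─⇒∉ y′∈)
          ... | _ , w∈e , y′≢w , inj₁ (inj₁ refl) = inj₁ (same e∈ joint∈ y′≢w y′∈e w∈e y′∈joint y∈joint)
          ... | _ , w∈e , y′≢w , inj₁ (inj₂ refl) = contradiction refl y′≢w
          ... | _ , w∈e , y′≢w , inj₂ refl        = inj₂ (same e∈ h∈ y′≢w y′∈e w∈e y′∈h z∈h)
          at-z : ∀ {e} → e List.∈ G → z ∈ e → e ≡ f ⊎ e ≡ h
          at-z e∈ z∈e with second e∈ z∈e (Corner.nb⊆U c z∈f) z∉core
          ... | _ , w∈e , z≢w , inj₁ (inj₁ refl) = inj₁ (same e∈ f∈ z≢w z∈e w∈e z∈f y∈f)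
          ... | _ , w∈e , z≢w , inj₁ (inj₂ refl) = inj₂ (same e∈ h∈ z≢w z∈e w∈e z∈h y′∈h)
          ... | _ , w∈e , z≢w , inj₂ refl        = contradiction refl z≢w

      nonlinear : ¬ (∀ {e f} → e List.∈ G → f List.∈ G → 2 ≤ ∣ f ∩ e ∣ → e ≡ f)
      nonlinear linear with two-corners
      ... | _ , _ , y≢y′ , y∈ , y′∈ = pendant-triangle linear y≢y′ y∈ y′∈ (corner y∈) (corner y′∈)

    private
      queue-pending : ∀ {U : Subset N} {q} → (∀ {x} → x ∈ U → x List.∈ q) → ∀ {x} → x ∈ U → x List.∈ q ⊎ Done U x
      queue-pending q x∈U = inj₁ (q x∈U)

    -- The bound on k is the fuel of `run` for a queue of at most 2 s vertices, M tree steps and a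
    -- budget of 2 s for the gain. The extra move in `suc k` allows f to be taken as a closer at
    -- once if two edges e and f of G share two vertices.
    found : ∀ k → s + s + s * M + (s + s + (s + s)) < k → ∃[ S ] S List.∈ starts (suc k) × S ⊆ W
    found k enough with Any.any? (λ e → Any.any? (λ f → (2 ≤? ∣ f ∩ e ∣) ×-dec ¬? (e ≟ₛ f)) G) G
    -- `⊥` is an arbitrary colouring: an edge that it leaves monochromatic serves as the first edge.
    ... | no none = from (monochromatic l r l≢r crit Data.Fin.Subset.⊥)
      where
      linear : ∀ {e f} → e List.∈ G → f List.∈ G → 2 ≤ ∣ f ∩ e ∣ → e ≡ f
      linear {e} {f} e∈ f∈ 2≤ = decidable-stable (e ≟ₛ f) λ e≢f → none (lose e∈ (lose f∈ (2≤ , e≢f)))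
      outcome : ∀ {e A} → e List.∈ G → A ⊎ Stuck e 0 → A
      outcome e∈ (inj₁ hit)   = hit
      outcome {e} e∈ (inj₂ stuck) with Stuck.history stuck
      ... | inj₁ small = contradiction (Stuck.g<s-1 stuck) (closed-large (Stuck.closed stuck) e∈ (Stuck.I⊆U stuck) small)
      ... | inj₂ last  = contradiction (λ {e} {f} → linear {e} {f}) (nonlinear (Stuck.closed stuck) (Stuck.g<s-1 stuck) last)
      from : (∃[ e ] e List.∈ G × _) → ∃[ S ] S List.∈ starts (suc k) × S ⊆ W
      from (e , e∈ , _) = let S , S∈ , S⊆W = hit in S , List.∈-concatMap⁺ _ (lose (G⊆E e∈) S∈) , S⊆W
        where
        ∣queue∣ : length (elements e) ≤ s + s
        ∣queue∣ = subst (_≤ s + s) (sym (trans (length-elements e) (uniform e∈))) (m≤m+n s s)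
        hit : Hit (suc k) e (elements e) 0 0
        hit = outcome e∈ (run e 0 (suc k) e (elements e) 0 0 M (s + s) ≤-refl ≤-refl
          (m≤n⇒m≤1+n (≤-<-trans (+-monoˡ-≤ (s + s + (s + s)) (+-monoˡ-≤ (s * M) ∣queue∣)) enough))
          (∈-elements⁻ e) (queue-pending ∈-elements⁺) (G⊆W e∈) (λ x∈ → x∈) z≤n
          (inj₁ (≤-trans (≤-reflexive (uniform e∈)) (m≤m+n s 0))))
    ... | yes some with find some
    ...   | e , e∈ , some′ with find some′
    ...     | f , f∈ , 2≤ , e≢f = S , List.∈-concatMap⁺ _ (lose (G⊆E e∈) S∈) , S⊆W
      where
      γ = ∣ f ─ e ∣
      1≤γ : 1 ≤ γ
      1≤γ with γ in eq
      ... | suc _ = s≤s z≤n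
      ... | zero  = contradiction (⊆-antisym e⊆f f⊆e) e≢f
        where
        f⊆e : f ⊆ e
        f⊆e {x} x∈f with x ∈? e
        ... | yes x∈e = x∈e
        ... | no x∉e  = contradiction (subst (1 ≤_) eq (∈⇒1≤∣p∣ (x∈p∧x∉q⇒x∈p─q x∈f x∉e))) λ ()
        e⊆f : e ⊆ f
        e⊆f = ⊆∧∣∣≤⇒⊇ f⊆e (≤-reflexive (trans (uniform e∈) (sym (uniform f∈))))
      outcome : ∀ {A} → A ⊎ Stuck e γ → A
      outcome (inj₁ hit)   = hit
      outcome (inj₂ stuck) with Stuck.history stuck
      ... | inj₁ small = contradiction (Stuck.g<s-1 stuck) (closed-large (Stuck.closed stuck) e∈ (Stuck.I⊆U stuck) small)
      ... | inj₂ last  = contradiction 1≤γ (subst (λ n → ¬ 1 ≤ n)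
        (sym (no-initial-gain (Stuck.closed stuck) (Stuck.g<s-1 stuck) last)) λ ())
      ∣queue∣ : length (elements e ++ elements (f ─ e)) ≤ s + s
      ∣queue∣ = ≤-trans (≤-reflexive (trans (length-++ (elements e)) (cong₂ _+_ (length-elements e) (length-elements (f ─ e)))))
        (+-mono-≤ (≤-reflexive (uniform e∈)) (subst (γ ≤_) (uniform f∈) (∣p─q∣≤∣p∣ f e)))
      hit : Hit (suc k) e (elements e) 0 0
      hit with success? 0 0
      -- Success at the outset means M = 0.
      ... | yes ok  = e , explore-stop k {q = elements e} ok , G⊆W e∈
      ... | no fail =
        let S , S∈ , S⊆W = outcome (run e γ k (e ∪ f) (elements e ++ elements (f ─ e)) 0 γ M (s + s)
              ≤-refl (m≤n+m (s + s) γ) (≤-<-trans (+-monoˡ-≤ (s + s + (s + s)) (+-monoˡ-≤ (s * M) ∣queue∣)) enough)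
              queue⊆ (queue-pending queue⊇) (∪-least (G⊆W e∈) (G⊆W f∈)) (p⊆p∪q f) ≤-refl
              (inj₁ (≤-reflexive (trans (∣∪∣ e f) (cong (_+ γ) (uniform e∈))))))
        in S , explore-closer k {q = elements e} fail (G⊆E f∈) (2≤ , 1≤γ) S∈ , S⊆W
        where
        queue⊆ : ∀ {x} → x List.∈ elements e ++ elements (f ─ e) → x ∈ e ∪ f
        queue⊆ x∈ with List.∈-++⁻ (elements e) x∈
        ... | inj₁ x∈e = p⊆p∪q f (∈-elements⁻ e x∈e)
        ... | inj₂ x∈f = q⊆p∪q e f (p─q⊆p f e (∈-elements⁻ (f ─ e) x∈f))
        queue⊇ : ∀ {x} → x ∈ e ∪ f → x List.∈ elements e ++ elements (f ─ e)
        queue⊇ {x} x∈ with x ∈? e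
        ... | yes x∈e = List.∈-++⁺ˡ (∈-elements⁺ x∈e)
        ... | no x∉e with x∈p∪q⁻ e f x∈
        ...   | inj₁ x∈e = contradiction x∈e x∉e
        ...   | inj₂ x∈f = List.∈-++⁺ʳ (elements e) (∈-elements⁺ (x∈p∧x∉q⇒x∈p─q x∈f x∉e))
      S = proj₁ hit
      S∈ = proj₁ (proj₂ hit)
      S⊆W = proj₂ (proj₂ hit)

-- From list assignments to outcomes inside W

module Choosing where

  open Rationals using (∑; 𝟙; 0≤𝟙; 𝟙-yes; ∈⇒≤∑)
  open Exploring
  open Critical
  open Covering
  open import Data.Bool.Base using (true; false)
  open import Data.Fin.Base using (Fin)
  open import Data.Fin.Subset using (_∈_; _⊆_)
  open import Data.Fin.Subset.Properties using (_⊆?_)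
  open import Data.List.Base using (List; []; _∷_)
  open import Data.List.Membership.Propositional as List using (find; lose)
  import Data.List.Membership.Propositional.Properties as List
  open import Data.List.Relation.Unary.All as All using (All; []; _∷_)
  open import Data.List.Relation.Unary.AllPairs using ([]; _∷_)
  open import Data.List.Relation.Unary.Any as Any using (here; there)
  open import Data.Nat.Base
  open import Data.Nat.Properties using (_≟_)
  open import Data.Product.Base using (∃-syntax; _×_; _,_; proj₁; proj₂)
  open import Data.Vec.Base using (lookup)
  open import Data.Rational.Base as ℚ using (ℚ; 1ℚ)
  open import Function.Base using (_∘_)
  open import Relation.Binary.PropositionalEquality hiding ([_])
  open import Relation.Nullary using (Dec; yes; no; ¬_; contradiction)

  private
    variable
      N : ℕ

  -- A list that is not a TwoElement list is read as 0, 1.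
  colours : List ℕ → ℕ × ℕ
  colours (a ∷ b ∷ []) with a ≟ b
  ... | yes _ = 0 , 1
  ... | no _  = a , b
  colours _ = 0 , 1

  colours-≢ : ∀ L → proj₁ (colours L) ≢ proj₂ (colours L)
  colours-≢ []                ()
  colours-≢ (_ ∷ [])          ()
  colours-≢ (_ ∷ _ ∷ _ ∷ _)   ()
  colours-≢ (a ∷ b ∷ []) eq with a ≟ b
  colours-≢ (a ∷ b ∷ []) () | yes _
  ... | no a≢b = a≢b eq

  colours-∈ : ∀ {L} → TwoElement L → proj₁ (colours L) List.∈ L × proj₂ (colours L) List.∈ L
  colours-∈ {a ∷ b ∷ []} (_ , (a≢b ∷ _) ∷ _) with a ≟ b
  ... | yes a≡b = contradiction a≡b a≢b
  ... | no _    = here refl , there (here refl)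

  module _ (H : Hypergraph N) (s-3 M k : ℕ) (uniform : Uniform (suc (suc (suc s-3))) H) where

    private
      s : ℕ
      s = suc (suc (suc s-3))

    open Exploration (edges H) s M using (starts)

    module _ (enough : s + s + s * M + (s + s + (s + s)) < k) where

      choosable : ∀ W → ¬ (∃[ S ] S List.∈ starts (suc k) × S ⊆ W) → TwoChoosable (H [ W ])
      choosable W avoid L two = decide (colourable? l r l≢r (edges (H [ W ])))
        where
        l r : Fin _ → ℕ
        l = proj₁ ∘ colours ∘ L
        r = proj₂ ∘ colours ∘ L
        -- `L` is constrained only on the vertices of H [ W ]; owing to the default in `colours` the
        -- two colours differ elsewhere too.
        l≢r : ∀ x → l x ≢ r x
        l≢r = colours-≢ ∘ L
        picked : ∀ b x → l x List.∈ L x × r x List.∈ L x → pick l r l≢r b x List.∈ L x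
        picked b x (l∈ , r∈) with lookup b x
        ... | true  = l∈
        ... | false = r∈
        edge : ∀ {f} → f List.∈ edges (H [ W ]) → f List.∈ edges H × f ⊆ W
        edge f∈ with List.∈-filter⁻ (_⊆? W) {xs = edges H} f∈
        ... | f∈H , f⊆W = f∈H , λ {x} → f⊆W {x}
        bad : (∃[ K ] (∀ {e} → e List.∈ K → e List.∈ edges (H [ W ])) × Critical l r l≢r K) →
          ∃[ S ] S List.∈ starts (suc k) × S ⊆ W
        bad (K , K⊆ , crit) = found l r l≢r crit (edges H) s-3 M W
          (λ f∈ → proj₁ (edge (K⊆ f∈))) (λ {f} f∈ → proj₂ (edge {f} (K⊆ f∈)))
          (λ f∈ → All.lookup uniform (proj₁ (edge (K⊆ f∈)))) k enough
        decide : Dec (Colourable l r l≢r (edges (H [ W ]))) →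
          ∃[ f ] (∀ {x} → x ∈ vertices (H [ W ]) → f x List.∈ L x) ×
                 All (λ e → ¬ Monochromatic f e) (edges (H [ W ]))
        decide (yes (b , good)) = pick l r l≢r b , (λ {x} x∈ → picked b x (colours-∈ (two x∈))) ,
          All.map (λ (x , y , (x∈ , y∈) , ≢) (c , mono) → ≢ (trans (mono x∈) (sym (mono y∈)))) good
        decide (no ¬col) = contradiction (bad (critical l r l≢r (edges (H [ W ])) ¬col)) avoid

      -- The pointwise hypothesis of `union-bound`.
      cover : ∀ W → ¬ TwoChoosable (H [ W ]) → 1ℚ ℚ.≤ ∑ (λ S → 𝟙 (S ⊆? W)) (starts (suc k))
      cover W bad with Any.any? (_⊆? W) (starts (suc k))
      ... | no none  = contradiction (choosable W λ (S , S∈ , S⊆W) → none (lose S∈ S⊆W)) bad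
      ... | yes some with find some
      ...   | S , S∈ , S⊆W = subst (ℚ._≤ ∑ (λ S → 𝟙 (S ⊆? W)) (starts (suc k))) (𝟙-yes (S ⊆? W) S⊆W)
        (∈⇒≤∑ {f = λ S → 𝟙 (S ⊆? W)} (λ S → 0≤𝟙 (S ⊆? W)) S∈)

-- Archimedean property and growth estimates

module Estimates where

  open Rationals
  open import Data.Integer.Base as ℤ using (+_; -[1+_])
  import Data.Integer.Properties as ℤ
  open import Data.Nat.Base as ℕ using (ℕ; zero; suc; z≤n; s≤s)
  import Data.Nat.Properties as ℕ
  import Data.Nat.Solver as ℕ
  open import Data.Product.Base using (∃-syntax; _×_; _,_)
  open import Data.Rational.Base renaming (∣_∣ to abs)
  open import Data.Rational.Properties
  open import Data.Rational.Unnormalised.Base as ℚᵘ using (ℚᵘ; mkℚᵘ; *≡*)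
  import Data.Rational.Unnormalised.Properties as ℚᵘ
  open import Relation.Binary.PropositionalEquality hiding ([_])
  open import Relation.Nullary using (yes; no; contradiction)

  private
    variable
      N : ℕ

  toℚᵘ-ι : ∀ n → toℚᵘ (ι n) ℚᵘ.≃ mkℚᵘ (+ n) 0
  toℚᵘ-ι zero    = ℚᵘ.≃-refl
  toℚᵘ-ι (suc n) = ℚᵘ.≃-trans (toℚᵘ-homo-+ 1ℚ (ι n)) (ℚᵘ.≃-trans
    (ℚᵘ.+-cong {ℚᵘ.1ℚᵘ} {ℚᵘ.1ℚᵘ} {toℚᵘ (ι n)} {mkℚᵘ (+ n) 0} ℚᵘ.≃-refl (toℚᵘ-ι n))
    (*≡* (cong (λ i → i ℤ.* + 1) (cong (λ i → + 1 ℤ.+ i) (ℤ.*-identityʳ (+ n))))))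

  /-*ι : ∀ a d → (+ a / suc d) * ι (suc d) ≡ ι a
  /-*ι a d = toℚᵘ-injective (ℚᵘ.≃-trans (toℚᵘ-homo-* (+ a / suc d) (ι (suc d)))
    (ℚᵘ.≃-trans (ℚᵘ.*-cong {toℚᵘ (+ a / suc d)} {mkℚᵘ (+ a) d} {toℚᵘ (ι (suc d))} {mkℚᵘ (+ suc d) 0}
      (toℚᵘ-fromℚᵘ (mkℚᵘ (+ a) d)) (toℚᵘ-ι (suc d)))
    (ℚᵘ.≃-trans (*≡* (trans (ℤ.*-identityʳ (+ a ℤ.* + suc d))
       (cong (+ a ℤ.*_) (cong (λ n → + suc n) (sym (ℕ.*-identityʳ d)))))) (ℚᵘ.≃-sym (toℚᵘ-ι a)))))

  1≤ι : ∀ {n} → 1 ℕ.≤ n → 1ℚ ≤ ι n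
  1≤ι 1≤n = ≤-trans (≤-reflexive (sym (+-identityʳ 1ℚ))) (ι-mono 1≤n)

  ι-pos : ∀ n → Positive (ι (suc n))
  ι-pos n = positive {ι (suc n)} (<-≤-trans {0ℚ} {1ℚ} {ι (suc n)} (positive⁻¹ 1ℚ) (1≤ι {suc n} (s≤s z≤n)))

  reciprocal : ∀ n → 1 ℕ.≤ n → ∃[ r ] 0ℚ ≤ r × r * ι n ≡ 1ℚ
  reciprocal (suc d) _ = + 1 / suc d , nonNegative⁻¹ (+ 1 / suc d) {{normalize-nonNeg 1 (suc d)}} ,
    trans (/-*ι 1 d) (+-identityʳ 1ℚ)

  archimedean : ∀ η → 0ℚ < η → ∃[ Q ] 1ℚ ≤ ι (suc Q) * η
  archimedean (mkℚ (+ zero) _ _)  (*<* (ℤ.+<+ ()))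
  archimedean (mkℚ -[1+ _ ] _ _)  (*<* ())
  archimedean η@(mkℚ (+ suc a) d _) _ = d , (begin
    1ℚ                        ≤⟨ 1≤ι {suc a} (s≤s z≤n) ⟩
    ι (suc a)                 ≡⟨ /-*ι (suc a) d ⟨
    (+ suc a / suc d) * ι (suc d) ≡⟨ cong (_* ι (suc d)) (↥p/↧p≡p η) ⟩
    η * ι (suc d)             ≡⟨ *-comm η (ι (suc d)) ⟩
    ι (suc d) * η             ∎)
    where open ≤-Reasoning

  n<2^n : ∀ n → n ℕ.< 2 ℕ.^ n
  n<2^n zero    = s≤s z≤n
  n<2^n (suc n) = ℕ.+-mono-≤ (ℕ.≤-trans (s≤s z≤n) (n<2^n n)) (ℕ.≤-trans (n<2^n n) (ℕ.≤-reflexive (sym (ℕ.+-identityʳ _))))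

  half : ∀ n → ∃[ m ] m ℕ.+ m ℕ.≤ n × n ℕ.≤ suc (m ℕ.+ m)
  half zero          = 0 , z≤n , z≤n
  half (suc zero)    = 0 , z≤n , s≤s z≤n
  half (suc (suc n)) with half n
  ... | m , 2m≤n , n≤2m+1 = suc m , subst (λ k → suc k ℕ.≤ suc (suc n)) (sym (ℕ.+-suc m m)) (s≤s (s≤s 2m≤n)) ,
    subst (λ k → suc (suc n) ℕ.≤ suc (suc k)) (sym (ℕ.+-suc m m)) (s≤s (s≤s n≤2m+1))

  ^-distribʳ-*ℕ : ∀ a b k → (a ℕ.* b) ℕ.^ k ≡ a ℕ.^ k ℕ.* b ℕ.^ k
  ^-distribʳ-*ℕ a b zero    = refl
  ^-distribʳ-*ℕ a b (suc k) = trans (cong (a ℕ.* b ℕ.*_) (^-distribʳ-*ℕ a b k))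
    (solve 4 (λ a b c d → a :* b :* (c :* d) := a :* c :* (b :* d)) refl a b (a ℕ.^ k) (b ℕ.^ k))
    where open ℕ.+-*-Solver

  -- The exponent is lowered by splitting 2 ^ n into two halves, one of which absorbs a factor n.
  poly≤2^ : ∀ k C → ∃[ n₀ ] ∀ n → n₀ ℕ.≤ n → C ℕ.* suc n ℕ.^ k ℕ.≤ 2 ℕ.^ n
  poly≤2^ zero    C = C , λ n C≤n → ℕ.≤-trans (ℕ.≤-reflexive (ℕ.*-identityʳ C)) (ℕ.≤-trans C≤n (ℕ.<⇒≤ (n<2^n n)))
  poly≤2^ (suc k) C with poly≤2^ k (C ℕ.* 2 ℕ.^ suc k)
  ... | n₀ , ih = suc (n₀ ℕ.+ n₀) , λ n n₀≤n → bound n n₀≤n (half n)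
    where
    open ℕ.≤-Reasoning
    open ℕ.+-*-Solver
    bound : ∀ n → suc (n₀ ℕ.+ n₀) ℕ.≤ n → (∃[ m ] m ℕ.+ m ℕ.≤ n × n ℕ.≤ suc (m ℕ.+ m)) → C ℕ.* suc n ℕ.^ suc k ℕ.≤ 2 ℕ.^ n
    bound n n₀≤n (m , 2m≤n , n≤) = begin
      C ℕ.* suc n ℕ.^ suc k
        ≤⟨ ℕ.*-monoʳ-≤ C (ℕ.^-monoˡ-≤ (suc k) (ℕ.≤-trans (s≤s n≤)
             (ℕ.≤-reflexive (solve 1 (λ m → con 2 :+ (m :+ m) := con 2 :* (con 1 :+ m)) refl m)))) ⟩
      C ℕ.* (2 ℕ.* suc m) ℕ.^ suc k
        ≡⟨ cong (C ℕ.*_) (^-distribʳ-*ℕ 2 (suc m) (suc k)) ⟩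
      C ℕ.* (2 ℕ.^ suc k ℕ.* (suc m ℕ.* suc m ℕ.^ k))
        ≡⟨ solve 4 (λ c t x y → c :* (t :* (x :* y)) := c :* t :* y :* x) refl C (2 ℕ.^ suc k) (suc m) (suc m ℕ.^ k) ⟩
      C ℕ.* 2 ℕ.^ suc k ℕ.* suc m ℕ.^ k ℕ.* suc m
        ≤⟨ ℕ.*-mono-≤ (ih m n₀≤m) (n<2^n m) ⟩
      2 ℕ.^ m ℕ.* 2 ℕ.^ m
        ≡⟨ ℕ.^-distribˡ-+-* 2 m m ⟨
      2 ℕ.^ (m ℕ.+ m)
        ≤⟨ ℕ.^-monoʳ-≤ 2 2m≤n ⟩
      2 ℕ.^ n ∎
      where
      n₀≤m : n₀ ℕ.≤ m
      n₀≤m with n₀ ℕ.≤? m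
      ... | yes le = le
      ... | no gt  = contradiction (ℕ.≤-trans n₀≤n n≤)
        (ℕ.<⇒≱ (s≤s (ℕ.+-mono-< (ℕ.≰⇒> gt) (ℕ.≰⇒> gt))))

  log₂ : ∀ v → 1 ℕ.≤ v → ∃[ M ] v ℕ.≤ 2 ℕ.^ M × 2 ℕ.^ M ℕ.≤ 2 ℕ.* v
  log₂ (suc zero)    _ = 0 , s≤s z≤n , s≤s z≤n
  log₂ (suc (suc v)) _ with log₂ (suc v) (s≤s z≤n)
  ... | M , v≤ , ≤2v with suc (suc v) ℕ.≤? 2 ℕ.^ M
  ...   | yes sv≤ = M , sv≤ , ℕ.≤-trans ≤2v (ℕ.*-monoʳ-≤ 2 (ℕ.n≤1+n (suc v)))
  ...   | no sv≰  = suc M , ℕ.+-mono-≤ (ℕ.≤-trans (s≤s z≤n) v≤) (ℕ.≤-trans v≤ (ℕ.≤-reflexive (sym (ℕ.+-identityʳ _)))) ,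
    ℕ.*-monoʳ-≤ 2 (ℕ.<⇒≤ (ℕ.≰⇒> sv≰))

  module _ (k : ℕ) .{{_ : ℕ.NonZero k}} (K c : ℕ) (1≤K : 1 ℕ.≤ K) (R : ℕ → ℕ) (1≤R : ∀ M → 1 ℕ.≤ R M)
    (R≤ : ∀ M → R M ℕ.≤ c ℕ.* suc M ℕ.^ 2) where

    private
      X : ℕ → ℕ
      X M = K ℕ.* R M ℕ.^ k

      1≤R^ : ∀ M → 1 ℕ.≤ R M ℕ.^ k
      1≤R^ M = ℕ.m^n>0 (R M) {{ℕ.>-nonZero (1≤R M)}} k

    -- As `R` is at most quadratic, `X M ^ k` is bounded by a polynomial of degree 2 k² in M + 1.
    -- The factor 2 is the rounding loss in `log₂`.
    subexponential : ∃[ M₀ ] ∀ M → M₀ ℕ.≤ M → 2 ℕ.* X M ℕ.^ k ℕ.≤ 2 ℕ.^ M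
    subexponential with poly≤2^ (2 ℕ.* k ℕ.* k) (2 ℕ.* (K ℕ.* c ℕ.^ k) ℕ.^ k)
    ... | M₀ , h = M₀ , λ M M₀≤M → ℕ.≤-trans (bound M) (h M M₀≤M)
      where
      open ℕ.≤-Reasoning
      bound : ∀ M → 2 ℕ.* X M ℕ.^ k ℕ.≤ 2 ℕ.* (K ℕ.* c ℕ.^ k) ℕ.^ k ℕ.* suc M ℕ.^ (2 ℕ.* k ℕ.* k)
      bound M = begin
        2 ℕ.* X M ℕ.^ k
          ≤⟨ ℕ.*-monoʳ-≤ 2 (ℕ.^-monoˡ-≤ k (ℕ.*-monoʳ-≤ K (ℕ.^-monoˡ-≤ k (R≤ M)))) ⟩
        2 ℕ.* (K ℕ.* (c ℕ.* suc M ℕ.^ 2) ℕ.^ k) ℕ.^ k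
          ≡⟨ cong (λ x → 2 ℕ.* (K ℕ.* x) ℕ.^ k) (trans (^-distribʳ-*ℕ c (suc M ℕ.^ 2) k)
               (cong (c ℕ.^ k ℕ.*_) (ℕ.^-*-assoc (suc M) 2 k))) ⟩
        2 ℕ.* (K ℕ.* (c ℕ.^ k ℕ.* suc M ℕ.^ (2 ℕ.* k))) ℕ.^ k
          ≡⟨ cong (λ x → 2 ℕ.* x ℕ.^ k) (ℕ.*-assoc K (c ℕ.^ k) (suc M ℕ.^ (2 ℕ.* k))) ⟨
        2 ℕ.* (K ℕ.* c ℕ.^ k ℕ.* suc M ℕ.^ (2 ℕ.* k)) ℕ.^ k
          ≡⟨ cong (2 ℕ.*_) (^-distribʳ-*ℕ (K ℕ.* c ℕ.^ k) (suc M ℕ.^ (2 ℕ.* k)) k) ⟩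
        2 ℕ.* ((K ℕ.* c ℕ.^ k) ℕ.^ k ℕ.* (suc M ℕ.^ (2 ℕ.* k)) ℕ.^ k)
          ≡⟨ cong (λ x → 2 ℕ.* ((K ℕ.* c ℕ.^ k) ℕ.^ k ℕ.* x)) (ℕ.^-*-assoc (suc M) (2 ℕ.* k) k) ⟩
        2 ℕ.* ((K ℕ.* c ℕ.^ k) ℕ.^ k ℕ.* suc M ℕ.^ (2 ℕ.* k ℕ.* k))
          ≡⟨ ℕ.*-assoc 2 ((K ℕ.* c ℕ.^ k) ℕ.^ k) _ ⟨
        2 ℕ.* (K ℕ.* c ℕ.^ k) ℕ.^ k ℕ.* suc M ℕ.^ (2 ℕ.* k ℕ.* k) ∎

    -- M is supplied by `log₂ v`. The last inequality says, with roots cleared, that K R^k is at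
    -- most v^(1/k): for k = s - 1 it lets 1/p beat a power of log v.
    depth : ∃[ v₀ ] ∀ v → v₀ ℕ.≤ v →
      ∃[ M ] v ℕ.≤ 2 ℕ.^ M × K ℕ.≤ 2 ℕ.^ M × X M ℕ.^ k ℕ.≤ v
    depth with subexponential
    ... | M₀ , small = 2 ℕ.^ M₀ , λ v v₀≤v → choose v v₀≤v (log₂ v (ℕ.≤-trans (ℕ.m^n>0 2 M₀) v₀≤v))
      where
      choose : ∀ v → 2 ℕ.^ M₀ ℕ.≤ v → (∃[ M ] v ℕ.≤ 2 ℕ.^ M × 2 ℕ.^ M ℕ.≤ 2 ℕ.* v) →
        ∃[ M ] v ℕ.≤ 2 ℕ.^ M × K ℕ.≤ 2 ℕ.^ M × X M ℕ.^ k ℕ.≤ v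
      choose v v₀≤v (M , v≤ , ≤2v) = M , v≤ , ℕ.≤-trans K≤ big , ℕ.*-cancelˡ-≤ 2 (ℕ.≤-trans big ≤2v)
        where
        M₀≤M : M₀ ℕ.≤ M
        M₀≤M with M₀ ℕ.≤? M
        ... | yes le = le
        ... | no gt  = contradiction (ℕ.≤-trans v₀≤v v≤) (ℕ.<⇒≱ (ℕ.^-monoʳ-< 2 (s≤s (s≤s z≤n)) (ℕ.≰⇒> gt)))
        big : 2 ℕ.* X M ℕ.^ k ℕ.≤ 2 ℕ.^ M
        big = small M M₀≤M
        1≤X : 1 ℕ.≤ X M
        1≤X = ℕ.*-mono-≤ 1≤K (1≤R^ M)
        base≤ : ∀ x → 1 ℕ.≤ x → ∀ k → .{{ℕ.NonZero k}} → x ℕ.≤ x ℕ.^ k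
        base≤ x 1≤x (suc k) = ℕ.m≤m*n x (x ℕ.^ k) {{ℕ.>-nonZero (ℕ.m^n>0 x {{ℕ.>-nonZero 1≤x}} k)}}
        K≤ : K ℕ.≤ 2 ℕ.* X M ℕ.^ k
        K≤ = ℕ.≤-trans (ℕ.m≤m*n K (R M ℕ.^ k) {{ℕ.>-nonZero (1≤R^ M)}})
          (ℕ.≤-trans (base≤ (X M) 1≤X k) (ℕ.m≤n*m (X M ℕ.^ k) 2))

-- The failure probability for one hypergraph

module FirstMoment where

  open Rationals
  open Exploring
  open Choosing
  open Estimates
  open import Data.Fin.Subset using (∣_∣)
  open import Data.Nat.Base as ℕ using (ℕ; suc; z≤n; s≤s)
  import Data.Nat.Properties as ℕ
  open import Data.Product.Base using (∃-syntax; _×_; _,_; proj₁; proj₂)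
  open import Data.Rational.Base hiding (truncate) renaming (∣_∣ to abs)
  open import Data.Rational.Properties
  import Data.Rational.Solver as Solver
  open import Relation.Binary.PropositionalEquality hiding ([_])

  private
    variable
      N : ℕ

  -- Each of the two terms of the threshold θ contributes at most a half.
  total-small : ∀ {y Y r w h δ z q κ κ₂} → 0ℚ ≤ y → y ≤ 1ℚ → 0ℚ ≤ Y → Y ≤ 1ℚ → 0ℚ ≤ r → 0ℚ ≤ w → 0ℚ ≤ δ → 0ℚ ≤ z → 0ℚ ≤ q →
    w * Y ≤ 1ℚ → w * w * δ ≤ h → (1ℚ + 1ℚ) * (z * q) ≤ κ → κ ≤ κ₂ → κ₂ * h ≤ 1ℚ → κ * r * y ≤ 1ℚ → 0ℚ ≤ h →
    q * (z * (w * w) * ((Y * r + δ) * (y * Y))) ≤ 1ℚ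
  total-small {y} {Y} {r} {w} {h} {δ} {z} {q} {κ} {κ₂} 0≤y y≤1 0≤Y Y≤1 0≤r 0≤w 0≤δ 0≤z 0≤q
    wY≤1 wwδ≤h zq≤κ κ≤κ₂ κ₂h≤1 κry≤1 0≤h =
    *-cancelˡ-≤-pos (1ℚ + 1ℚ) (begin
      (1ℚ + 1ℚ) * (q * (z * (w * w) * ((Y * r + δ) * (y * Y))))
        -- In the application w Y is v p^(s-1), the product r y is p times a power of log v, and w w
        -- δ is v² 8^(-M).
        ≡⟨ solve 7 (λ y Y r w δ z q → (con 1ℚ :+ con 1ℚ) :* (q :* (z :* (w :* w) :* ((Y :* r :+ δ) :* (y :* Y))))
             := (con 1ℚ :+ con 1ℚ) :* (z :* q) :* (((w :* Y) :* (w :* Y)) :* (r :* y) :+ (y :* Y) :* (w :* w :* δ)))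
             refl y Y r w δ z q ⟩
      (1ℚ + 1ℚ) * (z * q) * (((w * Y) * (w * Y)) * (r * y) + (y * Y) * (w * w * δ))
        ≤⟨ *-mono-≤ (0≤* (0≤+ 0≤1 0≤1) (0≤* 0≤z 0≤q)) zq≤κ
             (0≤+ (0≤* (0≤* 0≤wY 0≤wY) (0≤* 0≤r 0≤y)) (0≤* (0≤* 0≤y 0≤Y) 0≤wwδ))
             (+-mono-≤ (*-≤ˡ (0≤* 0≤r 0≤y) (≤-trans (*-≤ˡ 0≤wY wY≤1) wY≤1))
                       (≤-trans (*-≤ˡ 0≤wwδ (≤-trans (*-≤ˡ 0≤Y y≤1) Y≤1)) wwδ≤h)) ⟩
      κ * (r * y + h)
        ≡⟨ trans (*-distribˡ-+ κ (r * y) h) (cong (_+ κ * h) (sym (*-assoc κ r y))) ⟩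
      κ * r * y + κ * h
        ≤⟨ +-mono-≤ κry≤1 (≤-trans (*-monoʳ 0≤h κ≤κ₂) κ₂h≤1) ⟩
      1ℚ + 1ℚ
        ≡⟨ *-identityʳ (1ℚ + 1ℚ) ⟨
      (1ℚ + 1ℚ) * 1ℚ ∎)
    where
    open ≤-Reasoning
    open Solver.+-*-Solver
    0≤wY : 0ℚ ≤ w * Y
    0≤wY = 0≤* 0≤w 0≤Y
    0≤wwδ : 0ℚ ≤ w * w * δ
    0≤wwδ = 0≤* (0≤* 0≤w 0≤w) 0≤δ

  ι2^*½^ : ∀ M → ι (2 ℕ.^ M) * ½ ^ M ≡ 1ℚ
  ι2^*½^ M = trans (cong (_* ½ ^ M) (ι-^ 2 M)) (trans (sym (^-distrib-* (ι 2) ½ M)) (1^ M))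

  eighth : ℚ
  eighth = ½ * ½ * ½

  ι8^ : ∀ M → eighth ^ M * ι 8 ^ M ≡ 1ℚ
  ι8^ M = trans (sym (^-distrib-* eighth (ι 8) M)) (1^ M)

  -- Here the reward 8 of a tree step is consumed: against v² choices of the first edge, with v ≤
  -- 2^M, the factor 8^(-M) still leaves 2^(-M).
  eighth^≤ : ∀ {w} M → 0ℚ ≤ w → w ≤ ι (2 ℕ.^ M) → w * w * eighth ^ M ≤ ½ ^ M
  eighth^≤ {w} M 0≤w w≤ = begin
    w * w * eighth ^ M
      ≤⟨ *-monoʳ (0≤^ M (nonNegative⁻¹ eighth)) (*-mono-≤ 0≤w w≤ 0≤w w≤) ⟩
    a * a * eighth ^ M
      ≡⟨ cong (a * a *_) (trans (^-distrib-* (½ * ½) ½ M) (cong (_* b) (^-distrib-* ½ ½ M))) ⟩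
    a * a * (b * b * b)
      ≡⟨ solve 2 (λ a b → a :* a :* (b :* b :* b) := (a :* b) :* ((a :* b) :* b)) refl a b ⟩
    (a * b) * ((a * b) * b)
      ≡⟨ cong₂ (λ x y → x * (y * b)) (ι2^*½^ M) (ι2^*½^ M) ⟩
    1ℚ * (1ℚ * b)
      ≡⟨ trans (*-identityˡ (1ℚ * b)) (*-identityˡ b) ⟩
    b ∎
    where
    open ≤-Reasoning
    open Solver.+-*-Solver
    a b : ℚ
    a = ι (2 ℕ.^ M)
    b = ½ ^ M

  -- `B` bounds the size of an unfinished exploration, 1 / `R` is the price ρ of a gained vertex,
  -- `K` absorbs the constant factors, and 1 / `suc Q` is the probability of failure that is
  -- allowed.
  module FewBad (H : Hypergraph N) (s-3 M D Q K R B : ℕ) where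

    private
      s-1 s v k : ℕ
      s-1 = suc (suc s-3)
      s = suc s-1
      v = ∣V∣ H
      k = suc (s ℕ.+ s ℕ.+ s ℕ.* M ℕ.+ (s ℕ.+ s ℕ.+ (s ℕ.+ s)))

    module _ (uniform : Uniform s H) (Δ≤D : Δ₂ H ℕ.≤ D)
      (B≥ : s ℕ.+ s-1 ℕ.* M ℕ.+ s-1 ℕ.≤ B) (R≥ : 9 ℕ.* (B ℕ.* (B ℕ.* D)) ℕ.≤ R) (9≤R : 9 ℕ.≤ R) (1≤K : 1 ℕ.≤ K)
      (K≥ : 2 ℕ.* (D ℕ.* 3 ℕ.^ s ℕ.* suc Q) ℕ.≤ K)
      (v≤2^M : v ℕ.≤ 2 ℕ.^ M) (K≤2^M : K ℕ.≤ 2 ℕ.^ M) (X≤v : (K ℕ.* R ℕ.^ s-1) ℕ.^ s-1 ℕ.≤ v)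
      {y : ℚ} (0≤y : 0ℚ ≤ y) (y≤1 : y ≤ 1ℚ) (Yv≤1 : y ^ s-1 * ι v ≤ 1ℚ)
      (rate : y ^ s-1 * ι v * (ι D * (ι 8 * ι 3 ^ s)) ≤ 1ℚ) where

      private
        open ≤-Reasoning
        open Solver.+-*-Solver

        1≤R : 1 ℕ.≤ R
        1≤R = ℕ.≤-trans (s≤s z≤n) 9≤R

        reciprocal-R : ∃[ ρ ] 0ℚ ≤ ρ × ρ * ι R ≡ 1ℚ
        reciprocal-R = reciprocal R 1≤R

        Y r w h δ z q κ θ x : ℚ
        Y = y ^ s-1
        r = ι R ^ s-1
        w = ι v
        h = ½ ^ M
        δ = eighth ^ M
        z = ι D * ι 3 ^ s
        q = ι (suc Q)
        κ = ι K
        -- The first term pays for success by gain, the second for success by tree steps.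
        θ = Y * r + δ
        x = z * (w * w) * (θ * (y * Y))

        0≤Y : 0ℚ ≤ Y
        0≤Y = 0≤^ s-1 0≤y
        0≤r : 0ℚ ≤ r
        0≤r = 0≤^ s-1 (0≤ι R)
        0≤δ : 0ℚ ≤ δ
        0≤δ = 0≤^ M (nonNegative⁻¹ eighth)
        0≤z : 0ℚ ≤ z
        0≤z = 0≤* (0≤ι D) (0≤^ s (0≤ι 3))

        -- The power with exponent s - 1 of the left-hand side is at most v y^(s-1), by `X≤v`. This
        -- is the bound on y times a power of log v.
        κry≤1 : κ * r * y ≤ 1ℚ
        κry≤1 = ^-cancel-≤1 (suc s-3) (0≤* (0≤* (0≤ι K) 0≤r) 0≤y) (begin
          (κ * r * y) ^ s-1                     ≡⟨ ^-distrib-* (κ * r) y s-1 ⟩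
          (κ * r) ^ s-1 * Y                     ≡⟨ cong (λ x → (κ * x) ^ s-1 * Y) (ι-^ R s-1) ⟨
          (κ * ι (R ℕ.^ s-1)) ^ s-1 * Y         ≡⟨ cong (λ x → x ^ s-1 * Y) (ι-* K (R ℕ.^ s-1)) ⟨
          ι (K ℕ.* R ℕ.^ s-1) ^ s-1 * Y         ≡⟨ cong (_* Y) (ι-^ (K ℕ.* R ℕ.^ s-1) s-1) ⟨
          ι ((K ℕ.* R ℕ.^ s-1) ℕ.^ s-1) * Y     ≤⟨ *-monoʳ 0≤Y (ι-mono X≤v) ⟩
          w * Y                                 ≡⟨ *-comm w Y ⟩
          Y * w                                 ≤⟨ Yv≤1 ⟩
          1ℚ                                    ∎)

        ιR≤κr : ι R ≤ κ * r
        ιR≤κr = subst (ι R ≤_) (trans (ι-* K (R ℕ.^ s-1)) (cong (κ *_) (ι-^ R s-1))) (ι-mono (ℕ.≤-trans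
          (ℕ.m≤m*n R (R ℕ.^ suc s-3) {{ℕ.>-nonZero (ℕ.m^n>0 R {{ℕ.>-nonZero 1≤R}} (suc s-3))}})
          (ℕ.m≤n*m (R ℕ.^ s-1) K {{ℕ.>-nonZero 1≤K}})))

        bounds : ∀ {ρ} → 0ℚ ≤ ρ → ρ * ι R ≡ 1ℚ →
          ∑ (λ S → y ^ ∣ S ∣) (Exploration.starts (edges H) s M (suc k)) ≤ x
        bounds {ρ} 0≤ρ ρR = begin
          ∑ (λ S → y ^ ∣ S ∣) (Exploration.starts (edges H) s M (suc k))
            ≤⟨ Weight.starts-≤ H (suc s-3) M D uniform Δ≤D y ρ θ 0≤y (0≤+ (0≤* 0≤Y 0≤r) 0≤δ) y≤ρ
                 tree-rate closer-rate 3ρ≤1 many-steps high-gain (suc k) ⟩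
          ι (v ℕ.* (v ℕ.* D)) * (θ * (y * Y * ι 3 ^ s))
            ≡⟨ cong (_* (θ * (y * Y * ι 3 ^ s))) (trans (ι-* v (v ℕ.* D)) (cong (w *_) (ι-* v D))) ⟩
          w * (w * ι D) * (θ * (y * Y * ι 3 ^ s))
            ≡⟨ solve 6 (λ w d θ y Y t → w :* (w :* d) :* (θ :* (y :* Y :* t)) := d :* t :* (w :* w) :* (θ :* (y :* Y)))
                 refl w (ι D) θ y Y (ι 3 ^ s) ⟩
          x ∎
          where
          y≤ρ : y ≤ ρ
          y≤ρ = begin
            y                  ≡⟨ *-identityˡ y ⟨
            1ℚ * y             ≡⟨ cong (_* y) ρR ⟨
            ρ * ι R * y        ≡⟨ *-assoc ρ (ι R) y ⟩
            ρ * (ι R * y)      ≤⟨ *-monoˡ 0≤ρ (≤-trans (*-monoʳ 0≤y ιR≤κr) κry≤1) ⟩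
            ρ * 1ℚ             ≡⟨ *-identityʳ ρ ⟩
            ρ                  ∎
          tree-rate : ι (v ℕ.* D) * (ι 8 * Y * ι 3 ^ s) ≤ 1ℚ
          tree-rate = ≤-trans (≤-reflexive (trans (cong (_* (ι 8 * Y * ι 3 ^ s)) (ι-* v D))
            (solve 5 (λ w d e Y t → w :* d :* (e :* Y :* t) := Y :* w :* (d :* (e :* t))) refl w (ι D) (ι 8) Y (ι 3 ^ s)))) rate
          B₀ : ℕ
          B₀ = s ℕ.+ s-1 ℕ.* M ℕ.+ s-1
          closer-rate : ι (B₀ ℕ.* (B₀ ℕ.* D)) * (ι 3 * (ι 3 * ρ)) ≤ 1ℚ
          closer-rate = begin
            ι (B₀ ℕ.* (B₀ ℕ.* D)) * (ι 3 * (ι 3 * ρ))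
              ≤⟨ *-monoʳ (0≤* (0≤ι 3) (0≤* (0≤ι 3) 0≤ρ)) (ι-mono (ℕ.*-mono-≤ B≥ (ℕ.*-monoˡ-≤ D B≥))) ⟩
            ι b * (ι 3 * (ι 3 * ρ))
              ≡⟨ solve 3 (λ b t ρ → b :* (t :* (t :* ρ)) := ρ :* (t :* t :* b)) refl (ι b) (ι 3) ρ ⟩
            ρ * (ι 9 * ι b)          ≡⟨ cong (ρ *_) (ι-* 9 b) ⟨
            ρ * ι (9 ℕ.* b)          ≤⟨ *-monoˡ 0≤ρ (ι-mono R≥) ⟩
            ρ * ι R                  ≡⟨ ρR ⟩
            1ℚ                       ∎
            where
            b : ℕ
            b = B ℕ.* (B ℕ.* D)
          3ρ≤1 : ι 3 * ρ ≤ 1ℚ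
          3ρ≤1 = ≤-trans (*-monoʳ 0≤ρ (ι-mono (ℕ.≤-trans (s≤s (s≤s (s≤s z≤n))) 9≤R))) (≤-reflexive (trans (*-comm (ι R) ρ) ρR))
          many-steps : 1ℚ ≤ θ * ι 8 ^ M
          many-steps = begin
            1ℚ                                  ≡⟨ +-identityˡ 1ℚ ⟨
            0ℚ + 1ℚ
              ≤⟨ +-mono-≤ (0≤* (0≤* 0≤Y 0≤r) (0≤^ M (0≤ι 8))) (≤-reflexive (sym (ι8^ M))) ⟩
            Y * r * ι 8 ^ M + δ * ι 8 ^ M       ≡⟨ *-distribʳ-+ (ι 8 ^ M) (Y * r) δ ⟨
            θ * ι 8 ^ M                         ∎
          high-gain : Y ≤ θ * ρ ^ s-1
          high-gain = begin
            Y                                   ≡⟨ trans (+-identityʳ (Y * 1ℚ)) (*-identityʳ Y) ⟨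
            Y * 1ℚ + 0ℚ
              ≤⟨ +-mono-≤ (≤-reflexive (cong (Y *_) (sym rρ))) (0≤* 0≤δ (0≤^ s-1 0≤ρ)) ⟩
            Y * (r * ρ ^ s-1) + δ * ρ ^ s-1     ≡⟨ cong (_+ δ * ρ ^ s-1) (*-assoc Y r (ρ ^ s-1)) ⟨
            Y * r * ρ ^ s-1 + δ * ρ ^ s-1       ≡⟨ *-distribʳ-+ (ρ ^ s-1) (Y * r) δ ⟨
            θ * ρ ^ s-1                         ∎
            where
            rρ : r * ρ ^ s-1 ≡ 1ℚ
            rρ = trans (sym (^-distrib-* (ι R) ρ s-1)) (trans (cong (_^ s-1) (trans (*-comm (ι R) ρ) ρR)) (1^ s-1))

        qx≤1 : q * x ≤ 1ℚ
        qx≤1 = total-small 0≤y y≤1 0≤Y (^-≤1 s-1 0≤y y≤1) 0≤r (0≤ι v) 0≤δ 0≤z (0≤ι (suc Q))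
          (subst (_≤ 1ℚ) (*-comm Y w) Yv≤1) (eighth^≤ M (0≤ι v) (ι-mono v≤2^M))
          (subst (_≤ κ) (trans (ι-* 2 (D ℕ.* 3 ℕ.^ s ℕ.* suc Q)) (cong (ι 2 *_) (trans (ι-* (D ℕ.* 3 ℕ.^ s) (suc Q))
            (cong (_* q) (trans (ι-* D (3 ℕ.^ s)) (cong (ι D *_) (ι-^ 3 s))))))) (ι-mono K≥))
          (ι-mono K≤2^M) (≤-reflexive (ι2^*½^ M)) κry≤1 (0≤^ M (nonNegative⁻¹ ½))

      few-bad : ∃[ x ] ι (suc Q) * x ≤ 1ℚ ×
        1ℚ ≤ Prℚ y (vertices H) (λ W → TwoChoosable? (H [ W ])) + x
      few-bad = x , qx≤1 , (begin
        1ℚ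
          ≤⟨ union-bound 0≤y y≤1 (vertices H) (λ W → TwoChoosable? (H [ W ]))
               (Exploration.starts (edges H) s M (suc k)) (cover H s-3 M k uniform ℕ.≤-refl) ⟩
        Prℚ y (vertices H) (λ W → TwoChoosable? (H [ W ])) + ∑ (λ S → y ^ ∣ S ∣) (Exploration.starts (edges H) s M (suc k))
          ≤⟨ +-monoʳ-≤ (Prℚ y (vertices H) (λ W → TwoChoosable? (H [ W ])))
               (bounds (proj₁ (proj₂ reciprocal-R)) (proj₂ (proj₂ reciprocal-R))) ⟩
        Prℚ y (vertices H) (λ W → TwoChoosable? (H [ W ])) + x ∎)

-- Real parameters and the limit

module Limits where

  open Rationals
  open Estimates
  open FirstMoment
  open import Data.Fin.Subset using (Subset; ∣_∣; _─_)
  open import Data.Integer.Base using (+_)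
  open import Data.List.Base using ([]; _∷_; map; filter)
  open import Data.Nat.Base as ℕ using (ℕ; zero; suc; z≤n; s≤s)
  import Data.Nat.Properties as ℕ
  import Data.Nat.Solver as ℕ
  open import Data.Product.Base using (∃-syntax; Σ-syntax; _×_; _,_; proj₁; proj₂)
  open import Data.Rational.Base hiding (truncate) renaming (∣_∣ to abs)
  open import Data.Rational.Properties
  import Data.Rational.Solver as Solver
  open import Data.Sum.Base using (inj₁; inj₂)
  open import Level using (Level)
  open import Relation.Binary.PropositionalEquality hiding ([_]; J)
  open import Relation.Unary using (Pred; Decidable)

  private
    variable
      a ℓ : Level
      N : ℕ

  size≤ : ∀ s k M → k ℕ.≤ s → s ℕ.+ k ℕ.* M ℕ.+ k ℕ.≤ (s ℕ.+ s) ℕ.* suc M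
  size≤ s k M k≤s = begin
    s ℕ.+ k ℕ.* M ℕ.+ k
      ≤⟨ ℕ.+-mono-≤ (ℕ.+-monoʳ-≤ s (ℕ.*-monoˡ-≤ M (ℕ.≤-trans k≤s (ℕ.m≤m+n s s)))) k≤s ⟩
    s ℕ.+ (s ℕ.+ s) ℕ.* M ℕ.+ s
      ≡⟨ solve 2 (λ s m → s :+ (s :+ s) :* m :+ s := (s :+ s) :* (con 1 :+ m)) refl s M ⟩
    (s ℕ.+ s) ℕ.* suc M           ∎
    where
    open ℕ.≤-Reasoning
    open ℕ.+-*-Solver

  Rates : ℕ → ℕ → Set
  Rates t D = Σ[ B ∈ (ℕ → ℕ) ] Σ[ R ∈ (ℕ → ℕ) ] Σ[ c ∈ ℕ ] (∀ M → t ℕ.* suc M ℕ.≤ B M) ×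
    (∀ M → 9 ℕ.* (B M ℕ.* (B M ℕ.* D)) ℕ.≤ R M) × (∀ M → 9 ℕ.≤ R M) × (∀ M → R M ℕ.≤ c ℕ.* suc M ℕ.^ 2)

  rates : ∀ t D → 1 ℕ.≤ t → Rates t D
  -- `suc D` in place of D keeps `R` at least 9 when D is 0.
  rates t D 1≤t = B , (λ M → 9 ℕ.* (B M ℕ.* (B M ℕ.* suc D))) , 9 ℕ.* suc D ℕ.* t ℕ.^ 2 , (λ M → ℕ.≤-refl) ,
    (λ M → nine (ℕ.*-monoʳ-≤ (B M) (ℕ.*-monoʳ-≤ (B M) (ℕ.n≤1+n D)))) ,
    (λ M → nine {1} (ℕ.*-mono-≤ (1≤B M) (ℕ.*-mono-≤ (1≤B M) (s≤s (z≤n {D}))))) ,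
    (λ M → ℕ.≤-reflexive (solve 3 (λ t m d → con 9 :* (t :* m :* (t :* m :* d)) :=
      con 9 :* d :* (t :* (t :* con 1)) :* (m :* (m :* con 1))) refl t (suc M) (suc D)))
    where
    open ℕ.+-*-Solver
    B : ℕ → ℕ
    B M = t ℕ.* suc M
    nine : ∀ {m n} → m ℕ.≤ n → 9 ℕ.* m ℕ.≤ 9 ℕ.* n
    nine = ℕ.*-monoʳ-≤ 9
    1≤B : ∀ M → 1 ℕ.≤ B M
    1≤B M = ℕ.*-mono-≤ 1≤t (s≤s z≤n)

  module _ (s-3 D Q : ℕ) where

    private
      s-1 s : ℕ
      s-1 = suc (suc s-3)
      s = suc s-1

    -- One `v₀` serves all hypergraphs and all y, which allows H, p and the approximants of p to
    -- vary with n.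
    Threshold : ℕ → Set
    Threshold v₀ = ∀ {N} (H : Hypergraph N) → Uniform s H → Δ₂ H ℕ.≤ D → v₀ ℕ.≤ ∣V∣ H →
      ∀ {y} → 0ℚ ≤ y → y ≤ 1ℚ → y ^ s-1 * ι (∣V∣ H) ≤ 1ℚ →
      y ^ s-1 * ι (∣V∣ H) * (ι D * (ι 8 * ι 3 ^ s)) ≤ 1ℚ →
      ∃[ x ] ι (suc Q) * x ≤ 1ℚ × 1ℚ ≤ Prℚ y (vertices H) (λ W → TwoChoosable? (H [ W ])) + x

    few-bad-eventually : ∃[ v₀ ] Threshold v₀
    few-bad-eventually = from (suc K₀) (s≤s z≤n) (ℕ.n≤1+n K₀) (rates (s ℕ.+ s) D (s≤s z≤n))
      where
      K₀ : ℕ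
      K₀ = 2 ℕ.* (D ℕ.* 3 ℕ.^ s ℕ.* suc Q)
      from : ∀ K → 1 ℕ.≤ K → K₀ ℕ.≤ K →
        Rates (s ℕ.+ s) D →
        ∃[ v₀ ] Threshold v₀
      from K 1≤K K≥ (B , R , c , B≥ , R≥ , 9≤R , R≤) = proj₁ deep , λ H uniform Δ≤D v₀≤v 0≤y y≤1 Yv≤1 rate →
        let M , v≤ , K≤ , X≤ = proj₂ deep (∣V∣ H) v₀≤v
        in FewBad.few-bad H s-3 M D Q K (R M) (B M) uniform Δ≤D (ℕ.≤-trans (size≤ s s-1 M (ℕ.n≤1+n s-1)) (B≥ M))
             (R≥ M) (9≤R M) 1≤K K≥ v≤ K≤ X≤ 0≤y y≤1 Yv≤1 rate
        where
        deep = depth s-1 K c 1≤K R (λ M → ℕ.≤-trans (s≤s z≤n) (9≤R M)) R≤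

  seq-^ : ∀ x k j → seq (x ^ℝ k) j ≡ seq x j ^ k
  seq-^ x zero    j = refl
  seq-^ x (suc k) j = cong (seq x j *_) (seq-^ x k j)

  seq-weight : ∀ p (V W : Subset N) j → seq (weight p V W) j ≡ weightℚ (seq p j) V W
  seq-weight p V W j = cong₂ _*_ (seq-^ p ∣ W ∣ j) (seq-^ (1ℝ -ℝ p) ∣ V ─ W ∣ j)

  seq-Pr : ∀ p (V : Subset N) {E : Pred (Subset N) ℓ} (E? : Decidable E) j →
    seq (Pr p V E?) j ≡ Prℚ (seq p j) V E?
  seq-Pr {N} p V E? j = go (filter E? (filter _ (subsets N)))
    where
    go : ∀ Ws → seq (sumℝ (map (weight p V) Ws)) j ≡ ∑ (weightℚ (seq p j) V) Ws
    go []       = refl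
    go (W ∷ Ws) = cong₂ _+_ (seq-weight p V W j) (go Ws)

  0<* : ∀ {x y} → 0ℚ < x → 0ℚ < y → 0ℚ < x * y
  0<* {x} {y} 0<x 0<y = subst (_< x * y) (*-zeroʳ x) (*-monoʳ-<-pos x {{positive 0<x}} 0<y)

  smaller : ∀ {x y} → 0ℚ < x → 0ℚ < y → ∃[ δ ] 0ℚ < δ × δ ≤ x × δ ≤ y
  smaller {x} {y} 0<x 0<y with ≤-total x y
  ... | inj₁ x≤y = x , 0<x , ≤-refl , x≤y
  ... | inj₂ y≤x = y , 0<y , y≤x , ≤-refl

  -- Dividing by 1 + c avoids the case c = 0.
  shrink : ∀ c {η} → 0ℚ ≤ c → 0ℚ < η → ∃[ δ ] 0ℚ < δ × c * δ ≤ η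
  shrink c {η} 0≤c 0<η = η * 1/d , 0<δ , (begin
    c * (η * 1/d)      ≤⟨ *-monoʳ (<⇒≤ 0<δ) (≤-trans (≤-reflexive (sym (+-identityˡ c))) (+-monoˡ-≤ c 0≤1)) ⟩
    d * (η * 1/d)      ≡⟨ solve 3 (λ d η i → d :* (η :* i) := η :* (d :* i)) refl d η 1/d ⟩
    η * (d * 1/d)      ≡⟨ cong (η *_) (*-inverseʳ d) ⟩
    η * 1ℚ             ≡⟨ *-identityʳ η ⟩
    η                  ∎)
    where
    open ≤-Reasoning
    open Solver.+-*-Solver
    d : ℚ
    d = 1ℚ + c
    instance
      d-pos : Positive d
      d-pos = positive (<-≤-trans (positive⁻¹ 1ℚ) (≤-trans (≤-reflexive (sym (+-identityʳ 1ℚ))) (+-monoʳ-≤ 1ℚ 0≤c)))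
      d-nonZero : NonZero d
      d-nonZero = pos⇒nonZero d
    1/d : ℚ
    1/d = 1/ d
    0<δ : 0ℚ < η * 1/d
    0<δ = 0<* 0<η (positive⁻¹ 1/d {{1/pos⇒pos d}})

  ≤-abs : ∀ z → z ≤ abs z
  ≤-abs z with ≤-total z 0ℚ
  ... | inj₁ z≤0 = ≤-trans z≤0 (0≤∣p∣ z)
  ... | inj₂ 0≤z = ≤-reflexive (sym (0≤p⇒∣p∣≡p 0≤z))

  abs-≤ : ∀ {z c} → z ≤ c → - z ≤ c → abs z ≤ c
  abs-≤ {z} {c} z≤c -z≤c with ∣p∣≡p∨∣p∣≡-p z
  ... | inj₁ eq = subst (_≤ c) (sym eq) z≤c
  ... | inj₂ eq = subst (_≤ c) (sym eq) -z≤c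

  ≤+⇒-≤ : ∀ x y z → x ≤ y + z → x - y ≤ z
  ≤+⇒-≤ x y z h = ≤-trans (+-monoˡ-≤ (- y) h) (≤-reflexive (solve 2 (λ y z → y :+ z :- y := z) refl y z))
    where open Solver.+-*-Solver

  -- y is the point of [0, 1] nearest to x. The last component preserves the upper bound on p:
  -- moving up to 0 does not exceed a nonnegative u, and moving down to 1 is harmless.
  clamp : ∀ x {δ} → 0ℚ ≤ δ → 0ℚ ≤ x + δ → x ≤ 1ℚ + δ →
    ∃[ y ] 0ℚ ≤ y × y ≤ 1ℚ × abs (x - y) ≤ δ × (∀ {u} → 0ℚ ≤ u → x ≤ u → y ≤ u)
  clamp x {δ} 0≤δ 0≤x+δ x≤1+δ with ≤-total x 0ℚ | ≤-total x 1ℚ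
  ... | inj₁ x≤0 | _ = 0ℚ , ≤-refl , 0≤1 ,
    abs-≤ (≤-trans (≤-reflexive (+-identityʳ x)) (≤-trans x≤0 0≤δ))
          (≤-trans (≤-reflexive (solve 1 (λ x → :- (x :- con 0ℚ) := con 0ℚ :- x) refl x)) (≤+⇒-≤ 0ℚ x δ 0≤x+δ)) ,
    (λ 0≤u _ → 0≤u)
    where open Solver.+-*-Solver
  ... | inj₂ 0≤x | inj₁ x≤1 = x , 0≤x , x≤1 , ≤-trans (≤-reflexive (cong abs (+-inverseʳ x))) 0≤δ , (λ _ x≤u → x≤u)
  ... | inj₂ 0≤x | inj₂ 1≤x = 1ℚ , 0≤1 , ≤-refl ,
    abs-≤ (≤+⇒-≤ x 1ℚ δ x≤1+δ) (≤-trans (≤-reflexive (solve 1 (λ x → :- (x :- con 1ℚ) := con 1ℚ :- x) refl x))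
      (≤-trans (≤+⇒-≤ 1ℚ x 0ℚ (≤-trans 1≤x (≤-reflexive (sym (+-identityʳ x))))) 0≤δ)) ,
    (λ _ x≤u → ≤-trans 1≤x x≤u)
    where open Solver.+-*-Solver

  -- The approximants of `_^-1/_` are rounded down, so the inequality holds exactly for each of
  -- them.
  root-≤ : ∀ v k j → let r = seq (suc v ^-1/ suc k) j in 0ℚ ≤ r × r ^ suc k * ι (suc v) ≤ 1ℚ
  root-≤ v k j = nonNegative⁻¹ r {{normalize-nonNeg F (suc j)}} ,
    *-cancelʳ-≤-pos (ι (suc j ℕ.^ suc k)) {{positive-power}} (begin
    r ^ suc k * ι (suc v) * ι (suc j ℕ.^ suc k)
      ≡⟨ cong (r ^ suc k * ι (suc v) *_) (ι-^ (suc j) (suc k)) ⟩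
    r ^ suc k * ι (suc v) * ι (suc j) ^ suc k
      ≡⟨ solve 3 (λ a b c → a :* b :* c := a :* c :* b) refl (r ^ suc k) (ι (suc v)) (ι (suc j) ^ suc k) ⟩
    r ^ suc k * ι (suc j) ^ suc k * ι (suc v)
      ≡⟨ cong (_* ι (suc v)) (^-distrib-* r (ι (suc j)) (suc k)) ⟨
    (r * ι (suc j)) ^ suc k * ι (suc v)
      ≡⟨ cong (λ x → x ^ suc k * ι (suc v)) (/-*ι F j) ⟩
    ι F ^ suc k * ι (suc v)
      ≡⟨ trans (ι-* (F ℕ.^ suc k) (suc v)) (cong (_* ι (suc v)) (ι-^ F (suc k))) ⟨
    ι (F ℕ.^ suc k ℕ.* suc v)
      ≤⟨ ι-mono (floorRoot-lower (suc v) (suc k) (suc j)) ⟩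
    ι (suc j ℕ.^ suc k)
      ≡⟨ *-identityˡ (ι (suc j ℕ.^ suc k)) ⟨
    1ℚ * ι (suc j ℕ.^ suc k) ∎)
    where
    open ≤-Reasoning
    open Solver.+-*-Solver
    F : ℕ
    F = floorRoot (suc v) (suc k) (suc j)
    r : ℚ
    r = + F / suc j
    positive-power : Positive (ι (suc j ℕ.^ suc k))
    positive-power = positive (<-≤-trans {0ℚ} {1ℚ} (positive⁻¹ 1ℚ) (1≤ι (ℕ.m^n>0 (suc j) (suc k))))

  -- The reciprocal of the number of vertices obeys the same bound as the approximants of the root
  -- and is positive, whereas those may be 0. Taking the larger of the two leaves room for an
  -- additive error.
  inverse-≤ : ∀ v k → let u = + 1 / suc v in 0ℚ ≤ u × u ^ suc k * ι (suc v) ≤ 1ℚ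
  inverse-≤ v k = small (nonNegative⁻¹ (+ 1 / suc v) {{normalize-nonNeg 1 (suc v)}}) (trans (/-*ι 1 v) (+-identityʳ 1ℚ))
    where
    open ≤-Reasoning
    open Solver.+-*-Solver
    small : ∀ {u} → 0ℚ ≤ u → u * ι (suc v) ≡ 1ℚ → 0ℚ ≤ u × u ^ suc k * ι (suc v) ≤ 1ℚ
    small {u} 0≤u uw≡1 = 0≤u , (begin
      u * u ^ k * ι (suc v)
        ≡⟨ solve 3 (λ a b c → a :* b :* c := b :* (a :* c)) refl u (u ^ k) (ι (suc v)) ⟩
      u ^ k * (u * ι (suc v))   ≡⟨ cong (u ^ k *_) uw≡1 ⟩
      u ^ k * 1ℚ                ≡⟨ *-identityʳ (u ^ k) ⟩
      u ^ k
        ≤⟨ ^-≤1 k 0≤u (subst₂ _≤_ (*-identityʳ u) uw≡1 (*-monoˡ 0≤u (1≤ι {suc v} (s≤s z≤n)))) ⟩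
      1ℚ                        ∎)

  larger-root : ∀ {r u w} k → 0ℚ ≤ r × r ^ k * w ≤ 1ℚ → 0ℚ ≤ u × u ^ k * w ≤ 1ℚ →
    Σ[ m ∈ ℚ ] r ≤ m × u ≤ m × 0ℚ ≤ m × m ^ k * w ≤ 1ℚ
  larger-root {r} {u} k hr hu with ≤-total r u
  ... | inj₁ r≤u = u , r≤u , ≤-refl , hu
  ... | inj₂ u≤r = r , ≤-refl , u≤r , hr

  module _ (s-3 D : ℕ) {rate : ℚ} (0<rate : 0ℚ < rate) (rate≤1 : rate ≤ 1ℚ)
    (rate-small : ι D * (ι 8 * ι 3 ^ suc (suc (suc s-3))) * rate ≤ 1ℚ) where

    private
      s-1 s : ℕ
      s-1 = suc (suc s-3)
      s = suc s-1

      0≤rate : 0ℚ ≤ rate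
      0≤rate = <⇒≤ 0<rate

      -- The constant c of the theorem. The approximants of p obey their upper bound only up to an
      -- additive error, which the other half of `rate` absorbs.
      constant : ℚ
      constant = ½ * rate

      0<constant : 0ℚ < constant
      0<constant = 0<* (positive⁻¹ ½) 0<rate

      rate^≤ : ∀ {y m w} → 0ℚ ≤ y → y ≤ rate * m → 0ℚ ≤ m → 0ℚ ≤ w → m ^ s-1 * w ≤ 1ℚ → y ^ s-1 * w ≤ rate
      rate^≤ {y} {m} {w} 0≤y y≤ 0≤m 0≤w m≤1 = begin
        y ^ s-1 * w                  ≤⟨ *-monoʳ 0≤w (^-mono-≤ s-1 0≤y y≤) ⟩
        (rate * m) ^ s-1 * w         ≡⟨ cong (_* w) (^-distrib-* rate m s-1) ⟩
        rate ^ s-1 * m ^ s-1 * w     ≡⟨ *-assoc (rate ^ s-1) (m ^ s-1) w ⟩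
        rate ^ s-1 * (m ^ s-1 * w)   ≤⟨ *-monoˡ (0≤^ s-1 0≤rate) m≤1 ⟩
        rate ^ s-1 * 1ℚ              ≡⟨ *-identityʳ (rate ^ s-1) ⟩
        rate * rate ^ suc s-3        ≤⟨ *-monoˡ 0≤rate (^-≤1 (suc s-3) 0≤rate rate≤1) ⟩
        rate * 1ℚ                    ≡⟨ *-identityʳ rate ⟩
        rate                         ∎
        where open ≤-Reasoning

      ≤rate⇒≤1 : ∀ {x} → x ≤ rate → x * (ι D * (ι 8 * ι 3 ^ s)) ≤ 1ℚ
      ≤rate⇒≤1 {x} x≤ = begin
        x * C      ≤⟨ *-monoʳ (0≤* (0≤ι D) (0≤* (0≤ι 8) (0≤^ s (0≤ι 3)))) x≤ ⟩
        rate * C   ≡⟨ *-comm rate C ⟩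
        C * rate   ≤⟨ rate-small ⟩
        1ℚ         ∎
        where
        open ≤-Reasoning
        C : ℚ
        C = ι D * (ι 8 * ι 3 ^ s)

      larger : ∀ v j → Σ[ m ∈ ℚ ] seq (suc v ^-1/ s-1) j ≤ m × + 1 / suc v ≤ m × 0ℚ ≤ m × m ^ s-1 * ι (suc v) ≤ 1ℚ
      larger v j = larger-root s-1 (root-≤ v (suc s-3) j) (inverse-≤ v (suc s-3))

    module _ (V : Subset N) {E : Pred (Subset N) ℓ} (E? : Decidable E) (p : ℝ) {η : ℚ} (Q : ℕ)
      (0≤p : 0ℝ ≤ℝ p) (p≤1 : p ≤ℝ 1ℝ) (0<η : 0ℚ < η) (1≤Qη : 1ℚ ≤ ι (suc Q) * η) where

      -- Each late approximant x of p is clamped to some y, to which the last hypothesis applies.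
      -- One η in the lower bound is the probability of failure at y, the other the change from y to
      -- x.
      Pr-near-1 : ∀ w → 1 ℕ.≤ w → p ≤ℝ fromℚ (½ * rate) *ℝ (w ^-1/ s-1) →
        (∀ {y} → 0ℚ ≤ y → y ≤ 1ℚ → y ^ s-1 * ι w ≤ 1ℚ → y ^ s-1 * ι w * (ι D * (ι 8 * ι 3 ^ s)) ≤ 1ℚ →
          ∃[ x ] ι (suc Q) * x ≤ 1ℚ × 1ℚ ≤ Prℚ y V E? + x) →
        ∃[ J ] ∀ j → J ℕ.≤ j → 1ℚ ≤ seq (Pr p V E?) j + (η + η) × seq (Pr p V E?) j ≤ 1ℚ + η
      Pr-near-1 (suc v) _ p≤ few = J , bound
        where
        u : ℚ
        u = + 1 / suc v
        0<u : 0ℚ < u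
        0<u = positive⁻¹ u {{normalize-pos 1 (suc v)}}
        -- Three demands on δ: at most 1 for `Pr-lipschitz`, at most `constant * u` for the upper
        -- bound on y, and `lipschitz N * δ ≤ η` for the comparison.
        δ₁ = smaller (positive⁻¹ 1ℚ) (0<* 0<constant 0<u)
        δ₂ = shrink (lipschitz N) (0≤lipschitz N) 0<η
        δ₃ = smaller (proj₁ (proj₂ δ₁)) (proj₁ (proj₂ δ₂))
        δ : ℚ
        δ = proj₁ δ₃
        0<δ : 0ℚ < δ
        0<δ = proj₁ (proj₂ δ₃)
        δ≤δ₁ = proj₁ (proj₂ (proj₂ δ₃))
        δ≤1 : δ ≤ 1ℚ
        δ≤1 = ≤-trans δ≤δ₁ (proj₁ (proj₂ (proj₂ δ₁)))
        δ≤cu : δ ≤ constant * u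
        δ≤cu = ≤-trans δ≤δ₁ (proj₂ (proj₂ (proj₂ δ₁)))
        Lδ≤η : lipschitz N * δ ≤ η
        Lδ≤η = ≤-trans (*-monoˡ (0≤lipschitz N) (proj₂ (proj₂ (proj₂ δ₃)))) (proj₂ (proj₂ δ₂))
        J₁ = 0≤p δ 0<δ
        J₂ = p≤1 δ 0<δ
        J₃ = p≤ δ 0<δ
        J : ℕ
        J = proj₁ J₁ ℕ.⊔ proj₁ J₂ ℕ.⊔ proj₁ J₃
        bound : ∀ j → J ℕ.≤ j → 1ℚ ≤ seq (Pr p V E?) j + (η + η) × seq (Pr p V E?) j ≤ 1ℚ + η
        bound j J≤j = subst (λ P → 1ℚ ≤ P + (η + η) × P ≤ 1ℚ + η) (sym (seq-Pr p V E? j)) (lower , upper)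
          where
          open ≤-Reasoning
          open Solver.+-*-Solver
          x : ℚ
          x = seq p j
          J₁₂≤j = ℕ.m⊔n≤o⇒m≤o (proj₁ J₁ ℕ.⊔ proj₁ J₂) (proj₁ J₃) J≤j
          clamped = clamp x (<⇒≤ 0<δ) (proj₂ J₁ j (ℕ.m⊔n≤o⇒m≤o (proj₁ J₁) (proj₁ J₂) J₁₂≤j))
            (proj₂ J₂ j (ℕ.m⊔n≤o⇒n≤o (proj₁ J₁) (proj₁ J₂) J₁₂≤j))
          y : ℚ
          y = proj₁ clamped
          0≤y : 0ℚ ≤ y
          0≤y = proj₁ (proj₂ clamped)
          y≤1 : y ≤ 1ℚ
          y≤1 = proj₁ (proj₂ (proj₂ clamped))
          close : abs (x - y) ≤ δ
          close = proj₁ (proj₂ (proj₂ (proj₂ clamped)))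
          m-spec = larger v j
          m : ℚ
          m = proj₁ m-spec
          0≤m : 0ℚ ≤ m
          0≤m = proj₁ (proj₂ (proj₂ (proj₂ m-spec)))
          x≤ : x ≤ rate * m
          x≤ = begin
            x
              ≤⟨ proj₂ J₃ j (ℕ.m⊔n≤o⇒n≤o (proj₁ J₁ ℕ.⊔ proj₁ J₂) (proj₁ J₃) J≤j) ⟩
            constant * seq (suc v ^-1/ s-1) j + δ
              ≤⟨ +-mono-≤ (*-monoˡ (<⇒≤ 0<constant) (proj₁ (proj₂ m-spec)))
                 (≤-trans δ≤cu (*-monoˡ (<⇒≤ 0<constant) (proj₁ (proj₂ (proj₂ m-spec))))) ⟩
            constant * m + constant * m
              ≡⟨ solve 2 (λ c m → con ½ :* c :* m :+ con ½ :* c :* m := c :* m) refl rate m ⟩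
            rate * m                                         ∎
          y≤ : y ≤ rate * m
          y≤ = proj₂ (proj₂ (proj₂ (proj₂ clamped))) (0≤* 0≤rate 0≤m) x≤
          Y≤rate : y ^ s-1 * ι (suc v) ≤ rate
          Y≤rate = rate^≤ 0≤y y≤ 0≤m (0≤ι (suc v)) (proj₂ (proj₂ (proj₂ (proj₂ m-spec))))
          bad = few 0≤y y≤1 (≤-trans Y≤rate rate≤1) (≤rate⇒≤1 Y≤rate)
          z : ℚ
          z = proj₁ bad
          z≤η : z ≤ η
          z≤η = *-cancelˡ-≤-pos (ι (suc Q)) {{ι-pos Q}} (≤-trans (proj₁ (proj₂ bad)) 1≤Qη)
          Px Py : ℚ
          Px = Prℚ x V E?
          Py = Prℚ y V E?
          Px-Py : abs (Px - Py) ≤ η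
          Px-Py = ≤-trans (Pr-lipschitz 0≤y y≤1 close δ≤1 V E?) Lδ≤η
          lower : 1ℚ ≤ Px + (η + η)
          lower = begin
            1ℚ                           ≤⟨ proj₂ (proj₂ bad) ⟩
            Py + z                       ≤⟨ +-monoʳ-≤ Py z≤η ⟩
            Py + η
              ≡⟨ solve 3 (λ a b e → b :+ e := a :+ (:- (a :- b) :+ e)) refl Px Py η ⟩
            Px + (- (Px - Py) + η)
              ≤⟨ +-monoʳ-≤ Px (+-monoˡ-≤ η (≤-trans (≤-abs (- (Px - Py))) (≤-trans (≤-reflexive (∣-p∣≡∣p∣ (Px - Py))) Px-Py))) ⟩
            Px + (η + η)                 ∎
          upper : Px ≤ 1ℚ + η
          upper = begin
            Px                ≡⟨ solve 2 (λ a b → a := b :+ (a :- b)) refl Px Py ⟩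
            Py + (Px - Py)    ≤⟨ +-mono-≤ (Pr≤1 0≤y y≤1 V E?) (≤-trans (≤-abs (Px - Py)) Px-Py) ⟩
            1ℚ + η            ∎

  -- The unit is a quarter of e: the lower bound loses two units and strictness a third, all within
  -- the margin e by which ε exceeds 0. The upper bound loses only two.
  squeeze : ∀ (P ε : ℝ) e → 0ℚ < ½ * ½ * e → ∀ J → (∀ j → J ℕ.≤ j → 0ℚ + e ≤ seq ε j) →
    ∀ J′ → (∀ j → J′ ℕ.≤ j → 1ℚ ≤ seq P j + (½ * ½ * e + ½ * ½ * e) × seq P j ≤ 1ℚ + ½ * ½ * e) →
    1ℝ -ℝ ε <ℝ P × P <ℝ 1ℝ +ℝ ε
  squeeze P ε e 0<η J e≤ε J′ near =
    (½ * ½ * e , 0<η , J ℕ.⊔ J′ , λ j j≥ → below (e≤ε j (ℕ.m⊔n≤o⇒m≤o J J′ j≥)) (proj₁ (near j (ℕ.m⊔n≤o⇒n≤o J J′ j≥)))) ,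
    (½ * ½ * e , 0<η , J ℕ.⊔ J′ , λ j j≥ → above (e≤ε j (ℕ.m⊔n≤o⇒m≤o J J′ j≥)) (proj₂ (near j (ℕ.m⊔n≤o⇒n≤o J J′ j≥))))
    where
    open ≤-Reasoning
    open Solver.+-*-Solver
    below : ∀ {ε P} → 0ℚ + e ≤ ε → 1ℚ ≤ P + (½ * ½ * e + ½ * ½ * e) → 1ℚ - ε + ½ * ½ * e ≤ P
    below {ε} {P} e≤ε 1≤ = begin
      1ℚ - ε + η                     ≤⟨ +-monoˡ-≤ η (+-mono-≤ 1≤ (neg-antimono-≤ e≤ε)) ⟩
      P + (η + η) - (0ℚ + e) + η
        ≡⟨ solve 2 (λ p e → p :+ (q :* e :+ q :* e) :- (con 0ℚ :+ e) :+ q :* e := p :- q :* e) refl P e ⟩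
      P - η                          ≤⟨ +-monoʳ-≤ P (neg-antimono-≤ (<⇒≤ 0<η)) ⟩
      P - 0ℚ                         ≡⟨ +-identityʳ P ⟩
      P                              ∎
      where
      η : ℚ
      η = ½ * ½ * e
      q : ∀ {n} → Polynomial n
      q = con ½ :* con ½
    above : ∀ {ε P} → 0ℚ + e ≤ ε → P ≤ 1ℚ + ½ * ½ * e → P + ½ * ½ * e ≤ 1ℚ + ε
    above {ε} {P} e≤ε P≤ = begin
      P + η                          ≡⟨ trans (+-identityʳ (P + η + 0ℚ)) (+-identityʳ (P + η)) ⟨
      P + η + 0ℚ + 0ℚ                ≤⟨ +-mono-≤ (+-mono-≤ (+-monoˡ-≤ η P≤) (<⇒≤ 0<η)) (<⇒≤ 0<η) ⟩
      1ℚ + η + η + η + η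
        ≡⟨ solve 1 (λ e → con 1ℚ :+ q :* e :+ q :* e :+ q :* e :+ q :* e := con 1ℚ :+ (con 0ℚ :+ e)) refl e ⟩
      1ℚ + (0ℚ + e)                  ≤⟨ +-monoʳ-≤ 1ℚ e≤ε ⟩
      1ℚ + ε                         ∎
      where
      η : ℚ
      η = ½ * ½ * e
      q : ∀ {n} → Polynomial n
      q = con ½ :* con ½

  small-rate : ∀ {C} → 0ℚ ≤ C → ∃[ rate ] 0ℚ < rate × rate ≤ 1ℚ × C * rate ≤ 1ℚ
  small-rate {C} 0≤C =
    let δ , 0<δ , Cδ≤1 = shrink C 0≤C (positive⁻¹ 1ℚ)
        rate , 0<rate , rate≤δ , rate≤1 = smaller 0<δ (positive⁻¹ 1ℚ)
    in rate , 0<rate , rate≤1 , ≤-trans (*-monoˡ 0≤C rate≤δ) Cδ≤1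

  choosable-limit : ∀ s-3 (N : ℕ → ℕ) (H : (n : ℕ) → Hypergraph (N n)) →
    (∀ n → Uniform (suc (suc (suc s-3))) (H n)) → (λ n → ∣V∣ (H n)) ⟶∞ → (∃[ D ] ∀ n → Δ₂ (H n) ℕ.≤ D) →
    ∃[ c ] 0ℝ <ℝ c ×
      (∀ (p : ℕ → ℝ) → (∀ n → 0ℝ ≤ℝ p n × p n ≤ℝ 1ℝ) →
      (∀ n → p n ≤ℝ c *ℝ (∣V∣ (H n) ^-1/ suc (suc s-3))) →
      (λ n → Pr (p n) (vertices (H n)) (λ W → TwoChoosable? (H n [ W ]))) ⟶ 1ℝ)
  choosable-limit s-3 N H uniform v→∞ (D , Δ≤D) =
    conclude (small-rate (0≤* (0≤ι D) (0≤* (0≤ι 8) (0≤^ (suc (suc (suc s-3))) (0≤ι 3)))))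
    where
    conclude : (∃[ rate ] 0ℚ < rate × rate ≤ 1ℚ × ι D * (ι 8 * ι 3 ^ suc (suc (suc s-3))) * rate ≤ 1ℚ) → _
    conclude (rate , 0<rate , rate≤1 , small) =
      fromℚ (½ * rate) , (½ * rate , 0<* (positive⁻¹ ½) 0<rate , 0 , λ _ _ → ≤-reflexive (+-identityˡ (½ * rate))) ,
      λ p p∈ p≤ ε (e , 0<e , J , e≤ε) →
        let 0<η      = 0<* (0<* (positive⁻¹ ½) (positive⁻¹ ½)) 0<e
            Q , 1≤Qη = archimedean (½ * ½ * e) 0<η
            v₀ , few = few-bad-eventually s-3 D Q
            -- At least one vertex is required as well, since `_^-1/_` is 0 by convention on an
            -- empty vertex set.
            K , v≥   = v→∞ (v₀ ℕ.⊔ 1)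
        in K , λ n n≥K →
          let J′ , near = Pr-near-1 s-3 D 0<rate rate≤1 small (vertices (H n)) (λ W → TwoChoosable? (H n [ W ])) (p n) Q
                (proj₁ (p∈ n)) (proj₂ (p∈ n)) 0<η 1≤Qη (∣V∣ (H n)) (ℕ.m⊔n≤o⇒n≤o v₀ 1 (v≥ n n≥K)) (p≤ n)
                (few (H n) (uniform n) (Δ≤D n) (ℕ.m⊔n≤o⇒m≤o v₀ 1 (v≥ n n≥K)))
          in squeeze (Pr (p n) (vertices (H n)) (λ W → TwoChoosable? (H n [ W ]))) ε e 0<η J e≤ε J′ near

open import Data.Nat.Base using (ℕ; suc; z≤n; s≤s; _≤_; _∸_)
open import Data.Product.Base using (_×_; ∃-syntax)

theorem1p7 : ∀ (s : ℕ) → 3 ≤ s →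
    ∀ (N : ℕ → ℕ) (H : (n : ℕ) → Hypergraph (N n)) →
    (∀ n → Uniform s (H n)) →
    (λ n → ∣V∣ (H n)) ⟶∞ →
    (∃[ D ] ∀ n → Δ₂ (H n) ≤ D) →
    ∃[ c ] 0ℝ <ℝ c ×
    (∀ (p : ℕ → ℝ) →
    (∀ n → 0ℝ ≤ℝ p n × p n ≤ℝ 1ℝ) →
    (∀ n → p n ≤ℝ c *ℝ (∣V∣ (H n) ^-1/ (s ∸ 1))) →
    (λ n → Pr (p n) (vertices (H n)) (λ W → TwoChoosable? (H n [ W ]))) ⟶ 1ℝ)
theorem1p7 (suc (suc (suc s-3))) (s≤s (s≤s (s≤s z≤n))) = Limits.choosable-limit s-3
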